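{- Let $P$ be a lattice $3$-polytope of width larger than one and size $n\ge 8$, and suppose $P$ is not merged. Then one of the following holds: (1) $P$ contains a unimodular tetrahedron (in particular it is spanning); (2) $P$ has sublattice index $2$ and $P\cong\conv\{(1,-1,0),(-1,1,0),(-1,-1,1),(0,0,n-4)\}$; (3) $P$ has sublattice index $3$ and $P\cong\conv\{(2,-1,1),(-1,2,-1),(-1,-1,0),(0,0,n-4)\}$.
   Context: A lattice $3$-polytope is a polytope in $\mathbb{R}^3$ with vertices in $\mathbb{Z}^3$ and dimension $3$; size is $|P\cap\mathbb{Z}^3|$; width is the minimum of $\max f(P)-\min f(P)$ over non-constant affine functionals $f$ with $f(\mathbb{Z}^3)\subseteq\mathbb{Z}$. Sublattice index: index in $\mathbb{Z}^3$ of the affine lattice generated by $P\cap\mathbb{Z}^3$; spanning means index $1$. $\cong$ is unimodular equivalence. A unimodular tetrahedron is a lattice tetrahedron of normalized volume $1$. For a vertex $v$ of $P$, $P^v:=\conv(P\cap\mathbb{Z}^3\setminus\{v\})$ and $P^{uv}:=(P^u)^v$. A lattice $3$-polytope $P$ of width $>1$ is merged if there exist two distinct vertices $u,v$ of $P$ such that $P^u$ and $P^v$ both have width larger than one and $P^{uv}$ is $3$-dimensional. -}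

module Defs where

open import Data.Integer using (ℤ; +_; _+_; _*_; _-_; -_; _<_; ∣_∣)
open import Data.Nat as ℕ using (ℕ)
open import Data.Product using (Σ; ∃; ∃₂; _×_; _,_; proj₁; proj₂)
open import Data.List using (List; []; _∷_; length)
open import Data.List.Relation.Unary.All using (All)
open import Data.List.Relation.Unary.Unique.Propositional using (Unique)
open import Data.List.Membership.Propositional using (_∈_)
open import Relation.Binary.PropositionalEquality using (_≡_; _≢_)

Pt : Set
Pt = ℤ × ℤ × ℤ

origin : Pt
origin = (+ 0 , + 0 , + 0)

_⊕_ : Pt → Pt → Pt
(a , b , c) ⊕ (x , y , z) = (a + x , b + y , c + z)

_⊖_ : Pt → Pt → Pt
(a , b , c) ⊖ (x , y , z) = (a - x , b - y , c - z)

scale : ℤ → Pt → Pt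
scale k (x , y , z) = (k * x , k * y , k * z)

dot : Pt → Pt → ℤ
dot (a , b , c) (x , y , z) = a * x + b * y + c * z

cross : Pt → Pt → Pt
cross (a , b , c) (x , y , z) = (b * z - c * y , c * x - a * z , a * y - b * x)

det3 : Pt → Pt → Pt → ℤ
det3 a b c = dot a (cross b c)

PtSet : Set₁
PtSet = Pt → Set

wtot : List (ℕ × Pt) → ℕ
wtot [] = 0
wtot ((w , _) ∷ ws) = w ℕ.+ wtot ws

wsum : List (ℕ × Pt) → Pt
wsum [] = origin
wsum ((w , p) ∷ ws) = scale (+ w) p ⊕ wsum ws

-- x ∈ conv(A), for a lattice point x: x is a rational convex combination of
-- finitely many points of A (denominators cleared: weights wᵢ ∈ ℕ, d = Σ wᵢ > 0,
-- Σ wᵢ pᵢ = d·x).  Thus  InConv A  is the set of lattice points of conv(A).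
InConv : PtSet → PtSet
InConv A x = Σ (List (ℕ × Pt)) λ ws →
  All (λ wp → A (proj₂ wp)) ws × (0 ℕ.< wtot ws) × (wsum ws ≡ scale (+ wtot ws) x)

-- Generators of P^v := conv(P ∩ ℤ³ ∖ {v}), for P = conv(A)
Del : PtSet → Pt → PtSet
Del A v x = InConv A x × x ≢ v

IsVertex : PtSet → Pt → Set
IsVertex A v = InConv A v × Σ Pt λ c → ∀ x → InConv A x → x ≢ v → dot c x < dot c v

Dim3 : PtSet → Set
Dim3 A = Σ Pt λ p → Σ Pt λ q → Σ Pt λ r → Σ Pt λ s →
  InConv A p × InConv A q × InConv A r × InConv A s ×
  det3 (q ⊖ p) (r ⊖ p) (s ⊖ p) ≢ + 0

-- width of conv(A) is > 1: every non-constant integral affine functional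
-- x ↦ a·x + b (a ∈ ℤ³ ∖ {0}, b ∈ ℤ) has max − min > 1 on conv(A)
-- (max/min are attained at vertices, which are lattice points).
WidthGt1 : PtSet → Set
WidthGt1 A = ∀ a → a ≢ origin →
  ∃₂ λ x y → InConv A x × InConv A y × (+ 1 < dot a x - dot a y)

Size : PtSet → ℕ → Set
Size A n = Σ (List Pt) λ L → Unique L ×
  (∀ x → (x ∈ L → InConv A x) × (InConv A x → x ∈ L)) × (length L ≡ n)

ContainsUnimodTet : PtSet → Set
ContainsUnimodTet A = Σ Pt λ p → Σ Pt λ q → Σ Pt λ r → Σ Pt λ s →
  InConv A p × InConv A q × InConv A r × InConv A s ×
  ∣ det3 (q ⊖ p) (r ⊖ p) (s ⊖ p) ∣ ≡ 1

wsumℤ : List (ℤ × Pt) → Pt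
wsumℤ [] = origin
wsumℤ ((k , p) ∷ ks) = scale k p ⊕ wsumℤ ks

IntSpan : PtSet → PtSet
IntSpan S y = Σ (List (ℤ × Pt)) λ ks → All (λ kp → S (proj₂ kp)) ks × (wsumℤ ks ≡ y)

Diffs : PtSet → PtSet
Diffs A y = ∃₂ λ x z → InConv A x × InConv A z × (y ≡ x ⊖ z)

-- The affine lattice generated by conv(A) ∩ ℤ³ has index k in ℤ³:
-- its direction lattice (ℤ-span of differences of lattice points) has a
-- basis b₁,b₂,b₃ with |det(b₁,b₂,b₃)| = k.
SublatticeIndex : PtSet → ℕ → Set
SublatticeIndex A k = Σ Pt λ b₁ → Σ Pt λ b₂ → Σ Pt λ b₃ →
  IntSpan (Diffs A) b₁ × IntSpan (Diffs A) b₂ × IntSpan (Diffs A) b₃ ×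
  (∀ y → Diffs A y → Σ ℤ λ m₁ → Σ ℤ λ m₂ → Σ ℤ λ m₃ →
      y ≡ scale m₁ b₁ ⊕ (scale m₂ b₂ ⊕ scale m₃ b₃)) ×
  (∣ det3 b₁ b₂ b₃ ∣ ≡ k)

apply : Pt → Pt → Pt → Pt → Pt → Pt
apply r₁ r₂ r₃ t x = (dot r₁ x , dot r₂ x , dot r₃ x) ⊕ t

-- conv(A) ≅ conv(B): some unimodular affine map sends the lattice points of
-- conv(A) exactly onto those of conv(B) (a lattice polytope is the convex hull
-- of its lattice points, so this is equality of the image polytope with conv(B)).
UnimodEquiv : PtSet → PtSet → Set
UnimodEquiv A B = Σ Pt λ r₁ → Σ Pt λ r₂ → Σ Pt λ r₃ → Σ Pt λ t →
  (∣ det3 r₁ r₂ r₃ ∣ ≡ 1) ×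
  (∀ x → (InConv A x → InConv B (apply r₁ r₂ r₃ t x)) ×
         (InConv B (apply r₁ r₂ r₃ t x) → InConv A x))

Merged : PtSet → Set
Merged A = WidthGt1 A × Σ Pt λ u → Σ Pt λ v →
  IsVertex A u × IsVertex A v × u ≢ v ×
  WidthGt1 (Del A u) × WidthGt1 (Del A v) × Dim3 (Del (Del A u) v)

T2 : ℕ → List Pt
T2 n = (+ 1 , - + 1 , + 0) ∷ (- + 1 , + 1 , + 0) ∷ (- + 1 , - + 1 , + 1)
     ∷ (+ 0 , + 0 , + n - + 4) ∷ []

T3 : ℕ → List Pt
T3 n = (+ 2 , - + 1 , + 1) ∷ (- + 1 , + 2 , - + 1) ∷ (- + 1 , - + 1 , + 0)
     ∷ (+ 0 , + 0 , + n - + 4) ∷ []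

{-# OPTIONS --safe #-}

-- Let L be the set of lattice points of P, and suppose that it contains no unimodular tetrahedron.
-- Sections at lattice distance one show that three non-collinear points of L in a lattice plane leave
-- no point of L on the adjacent lattice planes, and that L contains no unit parallelogram.  Hence a
-- subset of L of width one lies on two lines.  If no two points of L are congruent modulo 3, a line
-- contains at most three of them, so removing one of the n ≥ 8 points leaves width larger than one or a
-- planar set.  The latter happens for at most one of four vertices, and P is merged.  Otherwise some line
-- contains at least four points of L.  Comparing what remains after removing vertices, P is merged unless
-- one end of the line is not a vertex and exactly three points v₁, v₂, v₃ lie off the line, where each
-- pair is either coplanar with the line or lies on a plane parallel to it at lattice distance one.
-- In projection along the line this leaves a segment of length two centred at the line plus one point
-- (case 2), or the reflexive triangles with edges of lattice lengths 3, 3, 3 (case 3) or 2, 2, 4; the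
-- last one is impossible, because two of the three points would be congruent modulo 2, and their midpoint
-- would be a fourth point off the line.
module Submission where

open import Defs
open import Data.Empty using (⊥; ⊥-elim)
open import Data.Fin as Fin using (Fin; zero; suc; _↑ʳ_)
open import Data.Fin.Properties as Finₚ using ()
open import Data.Integer as ℤ using (ℤ; +_; -[1+_]; _+_; _*_; _-_; -_; ∣_∣; _≟_; _<_; +<+)
open import Data.Integer.Divisibility.Signed using (divides) renaming (_∣_ to _∣ℤ_; _∣?_ to _∣ℤ?_)
open import Data.Integer.DivMod using (_%ℕ_; _/ℕ_; n%ℕd<d; a≡a%ℕn+[a/ℕn]*n)
open import Data.Integer.Properties as ℤₚ using ()
open import Data.Integer.Solver using (module +-*-Solver)
open import Data.List using (List; []; _∷_; _++_; length; filter; lookup; map; upTo)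
import Data.List.Membership.DecPropositional as DecMembership
open import Data.List.Membership.Propositional using (_∈_; _∉_; find; lose)
open import Data.List.Membership.Propositional.Properties using (∈-filter⁺; ∈-filter⁻; ∈-lookup; ∈-map⁺; ∈-map⁻; ∈-upTo⁺; ∈-upTo⁻)
open import Data.List.Properties using (filter-notAll; length-map; length-upTo)
open import Data.List.Relation.Unary.All as All using (All; []; _∷_; all?)
open import Data.List.Relation.Unary.All.Properties using (++⁺)
open import Data.List.Relation.Unary.AllPairs using ([]; _∷_)
open import Data.List.Relation.Unary.Any as Any using (Any; here; there; any?)
open import Data.List.Relation.Unary.Unique.Propositional using (Unique)
import Data.List.Relation.Unary.Unique.Propositional.Properties as Uniqueₚ
open import Data.Nat as ℕ using (ℕ; _≤_; s≤s; z≤n)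
import Data.Nat.Divisibility as ℕ∣
open import Data.Nat.GCD using (module Bézout; module GCD)
open import Data.Nat.Properties as ℕₚ using ()
import Data.Nat.Solver
open import Data.Product using (Σ; _×_; _,_; proj₁; proj₂)
open import Data.Product.Properties using (≡-dec)
open import Data.Sum using (_⊎_; inj₁; inj₂; [_,_]′)
open import Data.Unit using (⊤; tt)
open import Data.Vec using (Vec; []; _∷_)
open import Relation.Binary.PropositionalEquality
open import Relation.Nullary using (¬_; Dec; yes; no)
open import Relation.Nullary.Decidable using (¬?; _×-dec_; _⊎-dec_; from-yes)
open +-*-Solver using (Polynomial; prove; _:+_; _:*_; _:-_; :-_; var; con; solve; _:=_; ⟦_⟧; ⟦_⟧↓)
module NS = Data.Nat.Solver.+-*-Solver

-- Vectors

-- Congruence modulo 3 detects exactly the lines of lattice length at least three. That length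
-- matters because, whichever point is removed, two points of the line at distance two survive. So a
-- functional of width at most one on the rest is constant along the line, and everything can be
-- read off in the projection along it.
--
-- Both regimes end in the same count. When two vertices never both leave a flat rest, three of any
-- four vertices leave a wide rest, and then the three pairwise remainders cannot all be planar.
--
-- In the exceptional families the projection fixes the index, as a determinant 2 or 3. The heights
-- of the three outer points along the line are free up to a shear except for residues modulo 2 or
-- 3. These residues are pinned because no further lattice point lies between two outer points, and
-- they put the midpoint or the centroid on a lattice point of the line. That point must be an end
-- of the line, since otherwise both ends would be vertices. The line has `K + 1` points and three
-- lie off it, hence `n - 4 = K`.

pt≡ : ∀ {a b c a′ b′ c′ : ℤ} → a ≡ a′ → b ≡ b′ → c ≡ c′ → (a , b , c) ≡ (a′ , b′ , c′)
pt≡ refl refl refl = refl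

-- Symbolic vectors: the operations below evaluate definitionally to those on points, so that vector
-- identities are statements about polynomials and can be passed to the ring solver.
VPoly : ℕ → Set
VPoly n = Polynomial n × Polynomial n × Polynomial n

module _ {n : ℕ} where
  infixl 6 _⊕′_ _⊖′_

  _⊕′_ _⊖′_ cross′ : VPoly n → VPoly n → VPoly n
  (a , b , c) ⊕′ (x , y , z) = (a :+ x , b :+ y , c :+ z)
  (a , b , c) ⊖′ (x , y , z) = (a :- x , b :- y , c :- z)
  cross′ (a , b , c) (x , y , z) = (b :* z :- c :* y , c :* x :- a :* z , a :* y :- b :* x)

  scale′ : Polynomial n → VPoly n → VPoly n
  scale′ k (x , y , z) = (k :* x , k :* y , k :* z)

  dot′ : VPoly n → VPoly n → Polynomial n
  dot′ (a , b , c) (x , y , z) = a :* x :+ b :* y :+ c :* z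

  det3′ : VPoly n → VPoly n → VPoly n → Polynomial n
  det3′ a b c = dot′ a (cross′ b c)

  origin′ : VPoly n
  origin′ = (con (+ 0) , con (+ 0) , con (+ 0))

  V₀ : VPoly (3 ℕ.+ n)
  V₀ = var zero , var (suc zero) , var (suc (suc zero))

  V₁ : VPoly (6 ℕ.+ n)
  V₁ = var (3 ↑ʳ zero) , var (3 ↑ʳ suc zero) , var (3 ↑ʳ suc (suc zero))

  V₂ : VPoly (9 ℕ.+ n)
  V₂ = var (6 ↑ʳ zero) , var (6 ↑ʳ suc zero) , var (6 ↑ʳ suc (suc zero))

  V₃ : VPoly (12 ℕ.+ n)
  V₃ = var (9 ↑ʳ zero) , var (9 ↑ʳ suc zero) , var (9 ↑ʳ suc (suc zero))

ν : ∀ i {n} → Polynomial (i ℕ.+ ℕ.suc n)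
ν i = var (i ↑ʳ zero)

infixr 5 _▸_
_▸_ : ∀ {n} → Pt → Vec ℤ n → Vec ℤ (3 ℕ.+ n)
(x , y , z) ▸ ρ = x ∷ y ∷ z ∷ ρ

⟦_⟧ᵥ : ∀ {n} → VPoly n → Vec ℤ n → Pt
⟦ a , b , c ⟧ᵥ ρ = ⟦ a ⟧ ρ , ⟦ b ⟧ ρ , ⟦ c ⟧ ρ

proveᵥ : ∀ {n} (ρ : Vec ℤ n) (l r : VPoly n) → ⟦ proj₁ l ⟧↓ ρ ≡ ⟦ proj₁ r ⟧↓ ρ →
  ⟦ proj₁ (proj₂ l) ⟧↓ ρ ≡ ⟦ proj₁ (proj₂ r) ⟧↓ ρ → ⟦ proj₂ (proj₂ l) ⟧↓ ρ ≡ ⟦ proj₂ (proj₂ r) ⟧↓ ρ →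
  ⟦ l ⟧ᵥ ρ ≡ ⟦ r ⟧ᵥ ρ
proveᵥ ρ (a , b , c) (a′ , b′ , c′) p q r = pt≡ (prove ρ a a′ p) (prove ρ b b′ q) (prove ρ c c′ r)

dot-⊕ : ∀ a x y → dot a (x ⊕ y) ≡ dot a x + dot a y
dot-⊕ a x y = prove (a ▸ x ▸ y ▸ []) (dot′ V₀ (V₁ ⊕′ V₂)) (dot′ V₀ V₁ :+ dot′ V₀ V₂) refl

dot-⊖ : ∀ a x y → dot a (x ⊖ y) ≡ dot a x - dot a y
dot-⊖ a x y = prove (a ▸ x ▸ y ▸ []) (dot′ V₀ (V₁ ⊖′ V₂)) (dot′ V₀ V₁ :- dot′ V₀ V₂) refl

dot-scale : ∀ a k x → dot a (scale k x) ≡ k * dot a x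
dot-scale a k x = prove (a ▸ x ▸ k ∷ []) (dot′ V₀ (scale′ k′ V₁)) (k′ :* dot′ V₀ V₁) refl
  where k′ = ν 6

dot-neg : ∀ a x → dot (scale (- + 1) a) x ≡ - dot a x
dot-neg a x = prove (a ▸ x ▸ []) (dot′ (scale′ (con (- + 1)) V₀) V₁) (:- dot′ V₀ V₁) refl

dot-comm : ∀ a x → dot a x ≡ dot x a
dot-comm a x = prove (a ▸ x ▸ []) (dot′ V₀ V₁) (dot′ V₁ V₀) refl

binet-cauchy : ∀ a b c d → dot (cross a b) (cross c d) ≡ dot a c * dot b d - dot a d * dot b c
binet-cauchy a b c d = prove (a ▸ b ▸ c ▸ d ▸ []) (dot′ (cross′ V₀ V₁) (cross′ V₂ V₃))
  (dot′ V₀ V₂ :* dot′ V₁ V₃ :- dot′ V₀ V₃ :* dot′ V₁ V₂) refl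

triple-product : ∀ g e x → scale (dot g e) x ≡ scale (dot g x) e ⊕ cross g (cross x e)
triple-product g e x = proveᵥ (g ▸ e ▸ x ▸ []) (scale′ (dot′ V₀ V₁) V₂)
  (scale′ (dot′ V₀ V₂) V₁ ⊕′ cross′ V₀ (cross′ V₂ V₁)) refl refl refl

dual-expansion : ∀ a b c n → scale (det3 a b c) n ≡
  scale (dot n a) (cross b c) ⊕ (scale (dot n b) (cross c a) ⊕ scale (dot n c) (cross a b))
dual-expansion a b c n = proveᵥ (a ▸ b ▸ c ▸ n ▸ []) (scale′ (det3′ V₀ V₁ V₂) V₃)
  (scale′ (dot′ V₃ V₀) (cross′ V₁ V₂) ⊕′ (scale′ (dot′ V₃ V₁) (cross′ V₂ V₀) ⊕′ scale′ (dot′ V₃ V₂) (cross′ V₀ V₁)))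
  refl refl refl

cramer : ∀ a b c x → scale (det3 a b c) x ≡
  scale (dot (cross b c) x) a ⊕ (scale (dot (cross c a) x) b ⊕ scale (dot (cross a b) x) c)
cramer a b c x = proveᵥ (a ▸ b ▸ c ▸ x ▸ []) (scale′ (det3′ V₀ V₁ V₂) V₃)
  (scale′ (dot′ (cross′ V₁ V₂) V₃) V₀ ⊕′ (scale′ (dot′ (cross′ V₂ V₀) V₃) V₁ ⊕′ scale′ (dot′ (cross′ V₀ V₁) V₃) V₂))
  refl refl refl

_≟ₚ_ : (x y : Pt) → Dec (x ≡ y)
_≟ₚ_ = ≡-dec _≟_ (≡-dec _≟_ _≟_)

scale-one : ∀ x → scale (+ 1) x ≡ x
scale-one (x , y , z) = pt≡ (ℤₚ.*-identityˡ x) (ℤₚ.*-identityˡ y) (ℤₚ.*-identityˡ z)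

⊕-identityʳ : ∀ x → x ⊕ origin ≡ x
⊕-identityʳ (x , y , z) = pt≡ (ℤₚ.+-identityʳ x) (ℤₚ.+-identityʳ y) (ℤₚ.+-identityʳ z)

⊖-inverse : ∀ x → x ⊖ x ≡ origin
⊖-inverse (x , y , z) = pt≡ (ℤₚ.+-inverseʳ x) (ℤₚ.+-inverseʳ y) (ℤₚ.+-inverseʳ z)

⊕-⊖ : ∀ p x → p ⊕ (x ⊖ p) ≡ x
⊕-⊖ p x = proveᵥ (p ▸ x ▸ []) (V₀ ⊕′ (V₁ ⊖′ V₀)) V₁ refl refl refl

⊖≡origin : ∀ x y → x ⊖ y ≡ origin → x ≡ y
⊖≡origin x y eq = trans (sym (⊕-⊖ y x)) (trans (cong (y ⊕_) eq) (⊕-identityʳ y))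

scale≡origin : ∀ k x → k ≢ + 0 → scale k x ≡ origin → x ≡ origin
scale≡origin k (x , y , z) k≢0 eq = pt≡ (f x (cong proj₁ eq))
  (f y (cong (λ w → proj₁ (proj₂ w)) eq)) (f z (cong (λ w → proj₂ (proj₂ w)) eq))
  where
  f : ∀ w → k * w ≡ + 0 → w ≡ + 0
  f w kw≡0 with ℤₚ.i*j≡0⇒i≡0∨j≡0 k kw≡0
  ... | inj₁ k≡0 = ⊥-elim (k≢0 k≡0)
  ... | inj₂ w≡0 = w≡0

linear₁ : ∀ {x y a b} k → x - y ≡ k * (a - b) → a ≡ b → x ≡ y
linear₁ {x} {y} {a = a} k eq refl = ℤₚ.i-j≡0⇒i≡j x y (trans eq (trans (cong (k *_) (ℤₚ.+-inverseʳ a)) (ℤₚ.*-zeroʳ k)))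

-- With `g` dual to `e`, a vector is its height `dot g x` times `e` plus a term that depends only on
-- `cross x e`, that is, on its projection along `e`.
along : ∀ g e x → dot g e ≡ + 1 → x ≡ scale (dot g x) e ⊕ cross g (cross x e)
along g e x ge = trans (sym (scale-one x)) (trans (cong (λ k → scale k x) (sym ge)) (triple-product g e x))

orthogonal : ∀ a b c n → dot n a ≡ + 0 → dot n b ≡ + 0 → dot n c ≡ + 0 → scale (det3 a b c) n ≡ origin
orthogonal a b c n na nb nc = trans (dual-expansion a b c n)
  (trans (cong₂ _⊕_ (cong (λ k → scale k _) na) (cong₂ _⊕_ (cong (λ k → scale k _) nb) (cong (λ k → scale k _) nc))) refl)

coplanar : ∀ a b c n → n ≢ origin → dot n a ≡ + 0 → dot n b ≡ + 0 → dot n c ≡ + 0 → det3 a b c ≡ + 0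
coplanar a b c n n≢0 na nb nc with det3 a b c ≟ + 0
... | yes d≡0 = d≡0
... | no d≢0 = ⊥-elim (n≢0 (scale≡origin (det3 a b c) n d≢0 (orthogonal a b c n na nb nc)))

-- Of the three coefficients in the dual expansion of `f` only the one at `v` survives. No
-- independence is assumed: when the determinant is 0 the conclusion is that `e` and `y` are
-- parallel, which is how it is mostly used.
normal : ∀ f e y v → dot f e ≡ + 0 → dot f y ≡ + 0 → dot f v ≡ + 1 → cross e y ≡ scale (det3 e y v) f
normal f e y v fe fy fv = sym (trans (dual-expansion e y v f)
  (trans (cong₂ _⊕_ (cong (λ k → scale k _) fe) (cong₂ _⊕_ (cong (λ k → scale k _) fy) (cong (λ k → scale k _) fv)))
  (proveᵥ (cross y v ▸ cross v e ▸ cross e y ▸ []) (scale′ (con (+ 0)) V₀ ⊕′ (scale′ (con (+ 0)) V₁ ⊕′ scale′ (con (+ 1)) V₂)) V₂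
    refl refl refl)))

det3-cong : ∀ {a b c a′ b′ c′} → a ≡ a′ → b ≡ b′ → c ≡ c′ → det3 a b c ≡ det3 a′ b′ c′
det3-cong refl refl refl = refl

-- The determinant reduces to a 2 by 2 one in the values of `g` and `f`. So `cross g f` completes
-- `e` and `q` to a lattice basis, with no search for a third vector.
complement-det : ∀ e q g f → dot g e ≡ + 1 → dot f e ≡ + 0 → dot f q ≡ + 1 → det3 e q (cross g f) ≡ + 1
complement-det e q g f ge fe fq = trans (prove (e ▸ q ▸ g ▸ f ▸ []) (det3′ V₀ V₁ (cross′ V₂ V₃))
    (dot′ V₂ V₀ :* dot′ V₃ V₁ :- dot′ V₃ V₀ :* dot′ V₂ V₁) refl)
  (trans (cong₂ (λ i j → i * dot f q - j * dot g q) ge fe) (trans (cong (λ k → + 1 * k - + 0 * dot g q) fq) refl))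

-- Primitive vectors and convex combinations

signed : ∀ a → Σ ℤ λ s → (+ ∣ a ∣ ≡ s * a) × (a ≡ s * + ∣ a ∣)
signed (+ n) = + 1 , sym (ℤₚ.*-identityˡ (+ n)) , sym (ℤₚ.*-identityˡ (+ n))
signed a@(-[1+ n ]) = - + 1 , sym (ℤₚ.-1*i≡-i a) , sym (ℤₚ.-1*i≡-i (+ ℕ.suc n))

opaque
  -- The signs of `a` and `b` carry the identity for natural numbers over to the integers. The
  -- divisor may be 0, which `primitive-part` excludes only for the vector as a whole.
  bezout : ∀ a b → Σ ℤ λ d → Σ ℤ λ a′ → Σ ℤ λ b′ → Σ ℤ λ u → Σ ℤ λ v →
    (a ≡ d * a′) × (b ≡ d * b′) × (u * a + v * b ≡ d)
  bezout a b with signed a | signed b | Bézout.lemma ∣ a ∣ ∣ b ∣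
  ... | s , sa , as | t , tb , bt | Bézout.result d g i =
    + d , s * + q₁ , t * + q₂ , proj₁ coefficients , proj₁ (proj₂ coefficients) , a≡ , b≡ , proj₂ (proj₂ coefficients)
    where
    open ℕ∣ using (quotient; _∣_)
    d∣a : d ∣ ∣ a ∣
    d∣a = proj₁ (GCD.commonDivisor g)
    d∣b : d ∣ ∣ b ∣
    d∣b = proj₂ (GCD.commonDivisor g)
    q₁ q₂ : ℕ
    q₁ = quotient d∣a
    q₂ = quotient d∣b
    a≡ : a ≡ + d * (s * + q₁)
    a≡ = trans as (trans (cong (λ n → s * + n) (_∣_.equality d∣a)) (trans (cong (s *_) (ℤₚ.pos-* q₁ d))
      (solve 3 (λ s q d → s :* (q :* d) := d :* (s :* q)) refl s (+ q₁) (+ d))))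
    b≡ : b ≡ + d * (t * + q₂)
    b≡ = trans bt (trans (cong (λ n → t * + n) (_∣_.equality d∣b)) (trans (cong (t *_) (ℤₚ.pos-* q₂ d))
      (solve 3 (λ s q d → s :* (q :* d) := d :* (s :* q)) refl t (+ q₂) (+ d))))
    cast : ∀ x y m n → d ℕ.+ y ℕ.* n ≡ x ℕ.* m → + d + + y * + n ≡ + x * + m
    cast x y m n eq = trans (cong (λ k → + d + k) (sym (ℤₚ.pos-* y n))) (trans (cong +_ eq) (ℤₚ.pos-* x m))
    combination : Bézout.Identity d ∣ a ∣ ∣ b ∣ → Σ ℤ λ u → Σ ℤ λ v → u * a + v * b ≡ + d
    combination (Bézout.+- x y eq) = + x * s , - (+ y * t) ,
      linear₁ (- + 1) (trans (solve 7 (λ x y s t a b d → x :* s :* a :+ :- (y :* t) :* b :- d := con (- + 1) :*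
        (d :+ y :* (t :* b) :- x :* (s :* a))) refl (+ x) (+ y) s t a b (+ d))
        (cong₂ (λ p q → - + 1 * (+ d + + y * q - + x * p)) (sym sa) (sym tb))) (cast x y ∣ a ∣ ∣ b ∣ eq)
    combination (Bézout.-+ x y eq) = - (+ x * s) , + y * t ,
      linear₁ (- + 1) (trans (solve 7 (λ x y s t a b d → :- (x :* s) :* a :+ y :* t :* b :- d := con (- + 1) :*
        (d :+ x :* (s :* a) :- y :* (t :* b))) refl (+ x) (+ y) s t a b (+ d))
        (cong₂ (λ p q → - + 1 * (+ d + + x * p - + y * q)) (sym sa) (sym tb))) (cast y x ∣ b ∣ ∣ a ∣ eq)
    coefficients : Σ ℤ λ u → Σ ℤ λ v → u * a + v * b ≡ + d
    coefficients = combination i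

  -- The functional `g` certifies that `e` is primitive and serves later as the height along `e`.
  primitive-part : ∀ d → d ≢ origin → Σ ℕ λ k → Σ Pt λ e → Σ Pt λ g → (d ≡ scale (+ ℕ.suc k) e) × (dot g e ≡ + 1)
  primitive-part (x , y , z) ≢0 with bezout x y
  ... | d₁ , x′ , y′ , u , v , x≡ , y≡ , uv with bezout d₁ z
  ... | d , d₁′ , z′ , u₁ , v₁ , d₁≡ , z≡ , uv₁ = answer d vec≡ ge
    where
    e g : Pt
    e = d₁′ * x′ , d₁′ * y′ , z′
    g = u₁ * u , u₁ * v , v₁
    vec≡ : (x , y , z) ≡ scale d e
    vec≡ = pt≡ (trans x≡ (trans (cong (_* x′) d₁≡) (ℤₚ.*-assoc d d₁′ x′)))
               (trans y≡ (trans (cong (_* y′) d₁≡) (ℤₚ.*-assoc d d₁′ y′))) z≡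
    d≢0 : d ≢ + 0
    d≢0 d≡0 = ≢0 (trans vec≡ (cong (λ k → scale k e) d≡0))
    ge : dot g e ≡ + 1
    ge = ℤₚ.*-cancelˡ-≡ d (dot g e) (+ 1) ⦃ ℤ.≢-nonZero d≢0 ⦄ (begin
      d * dot g e            ≡⟨ sym (dot-scale g d e) ⟩
      dot g (scale d e)      ≡⟨ cong (dot g) (sym vec≡) ⟩
      dot g (x , y , z)      ≡⟨ solve 7 (λ u₁ u v v₁ x y z → u₁ :* u :* x :+ u₁ :* v :* y :+ v₁ :* z := u₁ :* (u :* x :+ v :* y)
        :+ v₁ :* z) refl u₁ u v v₁ x y z ⟩
      u₁ * (u * x + v * y) + v₁ * z ≡⟨ cong (λ k → u₁ * k + v₁ * z) uv ⟩
      u₁ * d₁ + v₁ * z       ≡⟨ uv₁ ⟩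
      d                      ≡⟨ sym (ℤₚ.*-identityʳ d) ⟩
      d * + 1                ∎)
      where open ≡-Reasoning
    answer : ∀ d → (x , y , z) ≡ scale d e → dot g e ≡ + 1 →
      Σ ℕ λ k → Σ Pt λ e → Σ Pt λ g → ((x , y , z) ≡ scale (+ ℕ.suc k) e) × (dot g e ≡ + 1)
    answer (+ 0) eq _ = ⊥-elim (≢0 eq)
    answer (+ ℕ.suc k) eq ge = k , e , g , eq , ge
    answer -[1+ k ] eq ge = k , scale (- + 1) e , scale (- + 1) g ,
      trans eq (proveᵥ (e ▸ + ℕ.suc k ∷ []) (scale′ (:- ν 3) V₀)
        (scale′ (ν 3) (scale′ (con (- + 1)) V₀)) refl refl refl) ,
      trans (prove (e ▸ g ▸ []) (dot′ (scale′ (con (- + 1)) V₁) (scale′ (con (- + 1)) V₀)) (dot′ V₁ V₀) refl) ge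

  -- `x` is `t / (k + 1)` rounded up. Rounding up keeps the defect `r` nonnegative and at most `k`,
  -- so that `r` and `k - r` can be weights of a convex combination.
  ceiling : ∀ t k → Σ ℤ λ x → Σ ℕ λ r → (r ℕ.≤ k) × (+ ℕ.suc k * x ≡ t + + r)
  ceiling t k = - q , r , ℕ.s≤s⁻¹ (n%ℕd<d (- t) (ℕ.suc k)) ,
    linear₁ (- + 1) (solve 4 (λ d q t r → d :* (:- q) :- (t :+ r) := con (- + 1) :* (r :+ q :* d :- (:- t))) refl (+ ℕ.suc k) q t
      (+ r))
      (sym (a≡a%ℕn+[a/ℕn]*n (- t) (ℕ.suc k)))
    where
    q : ℤ
    q = (- t) /ℕ ℕ.suc k
    r : ℕ
    r = (- t) %ℕ ℕ.suc k

rescale : ℕ → List (ℕ × Pt) → List (ℕ × Pt)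
rescale k [] = []
rescale k ((w , p) ∷ ws) = (k ℕ.* w , p) ∷ rescale k ws

wtot-rescale : ∀ k ws → wtot (rescale k ws) ≡ k ℕ.* wtot ws
wtot-rescale k [] = sym (ℕₚ.*-zeroʳ k)
wtot-rescale k ((w , p) ∷ ws) = trans (cong (k ℕ.* w ℕ.+_) (wtot-rescale k ws)) (sym (ℕₚ.*-distribˡ-+ k w (wtot ws)))

scale-⊕ : ∀ k x y → scale k (x ⊕ y) ≡ scale k x ⊕ scale k y
scale-⊕ k x y = proveᵥ (x ▸ y ▸ k ∷ []) (scale′ (ν 6) (V₀ ⊕′ V₁))
  (scale′ (ν 6) V₀ ⊕′ scale′ (ν 6) V₁) refl refl refl

scale-scale : ∀ j k x → scale j (scale k x) ≡ scale (j * k) x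
scale-scale j k x = proveᵥ (x ▸ j ∷ k ∷ []) (scale′ (ν 3) (scale′ (ν 4) V₀))
  (scale′ (ν 3 :* ν 4) V₀) refl refl refl

scale-origin : ∀ k → scale k origin ≡ origin
scale-origin k = pt≡ (ℤₚ.*-zeroʳ k) (ℤₚ.*-zeroʳ k) (ℤₚ.*-zeroʳ k)

⊕-assoc : ∀ x y z → (x ⊕ y) ⊕ z ≡ x ⊕ (y ⊕ z)
⊕-assoc x y z = proveᵥ (x ▸ y ▸ z ▸ []) ((V₀ ⊕′ V₁) ⊕′ V₂) (V₀ ⊕′ (V₁ ⊕′ V₂)) refl refl refl

wsum-rescale : ∀ k ws → wsum (rescale k ws) ≡ scale (+ k) (wsum ws)
wsum-rescale k [] = sym (scale-origin (+ k))
wsum-rescale k ((w , p) ∷ ws) = trans (cong₂ _⊕_ (trans (cong (λ j → scale j p) (ℤₚ.pos-* k w)) (sym (scale-scale (+ k) (+ w) p)))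
  (wsum-rescale k ws)) (sym (scale-⊕ (+ k) (scale (+ w) p) (wsum ws)))

wtot-++ : ∀ us vs → wtot (us ++ vs) ≡ wtot us ℕ.+ wtot vs
wtot-++ [] vs = refl
wtot-++ ((w , p) ∷ us) vs = trans (cong (w ℕ.+_) (wtot-++ us vs)) (sym (ℕₚ.+-assoc w (wtot us) (wtot vs)))

wsum-++ : ∀ us vs → wsum (us ++ vs) ≡ wsum us ⊕ wsum vs
wsum-++ [] vs = sym (proveᵥ (wsum vs ▸ []) (origin′ ⊕′ V₀) V₀ refl refl refl)
wsum-++ ((w , p) ∷ us) vs = trans (cong (scale (+ w) p ⊕_) (wsum-++ us vs)) (sym (⊕-assoc (scale (+ w) p) (wsum us) (wsum vs)))

All-rescale : ∀ {A : PtSet} k {ws} → All (λ wp → A (proj₂ wp)) ws → All (λ wp → A (proj₂ wp)) (rescale k ws)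
All-rescale k [] = []
All-rescale k (a ∷ as) = a ∷ All-rescale k as

Convex : PtSet → Set
Convex M = ∀ x → InConv M x → M x

InConv-single : ∀ {A : PtSet} {x} → A x → InConv A x
InConv-single {A} {x} a = (1 , x) ∷ [] , a ∷ [] , s≤s z≤n , ⊕-identityʳ (scale (+ 1) x)

-- Nested combinations are flattened by clearing denominators: the factor `k` is the product of the
-- total weights of the inner combinations, so all weights stay natural numbers.
InConv-convex : ∀ {A : PtSet} → Convex (InConv A)
InConv-convex {A} x (ws , all , pos , eq) with flatten ws all
  where
  flatten : ∀ ws → All (λ wp → InConv A (proj₂ wp)) ws →
    Σ ℕ λ k → Σ (List (ℕ × Pt)) λ vs → All (λ wp → A (proj₂ wp)) vs × (0 ℕ.< k) ×
      (wtot vs ≡ k ℕ.* wtot ws) × (wsum vs ≡ scale (+ k) (wsum ws))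
  flatten [] [] = 1 , [] , [] , s≤s z≤n , refl , refl
  flatten ((w , p) ∷ ws) ((us , us∈ , d>0 , us≡) ∷ all) with flatten ws all
  ... | k , vs , vs∈ , k>0 , tot , sum =
    d ℕ.* k , rescale (w ℕ.* k) us ++ rescale d vs ,
    ++⁺ (All-rescale {A} (w ℕ.* k) us∈) (All-rescale {A} d vs∈) , ℕₚ.*-mono-≤ d>0 k>0 ,
    trans (wtot-++ (rescale (w ℕ.* k) us) (rescale d vs))
      (trans (cong₂ ℕ._+_ (wtot-rescale (w ℕ.* k) us) (trans (wtot-rescale d vs) (cong (d ℕ.*_) tot)))
        (NS.solve 4 (λ w k d t → w NS.:* k NS.:* d NS.:+ d NS.:* (k NS.:* t) NS.:= d NS.:* k NS.:* (w NS.:+ t)) refl w k d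
          (wtot ws))) ,
    trans (wsum-++ (rescale (w ℕ.* k) us) (rescale d vs))
      (trans (cong₂ _⊕_ (trans (wsum-rescale (w ℕ.* k) us) (cong₂ scale (ℤₚ.pos-* w k) us≡))
                        (trans (wsum-rescale d vs) (cong (scale (+ d)) sum)))
        (trans (proveᵥ (p ▸ wsum ws ▸ + w ∷ + k ∷ + d ∷ [])
          (scale′ (w′ :* k′) (scale′ d′ V₀) ⊕′ scale′ d′ (scale′ k′ V₁))
          (scale′ (d′ :* k′) (scale′ w′ V₀ ⊕′ V₁)) refl refl refl)
          (cong (λ j → scale j (scale (+ w) p ⊕ wsum ws)) (sym (ℤₚ.pos-* d k)))))
    where
    d = wtot us
    w′ k′ d′ : Polynomial 9
    w′ = ν 6
    k′ = ν 7
    d′ = ν 8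
... | k , vs , vs∈ , k>0 , tot , sum = vs , vs∈ , subst (0 ℕ.<_) (sym tot) (ℕₚ.*-mono-≤ k>0 pos) ,
  trans sum (trans (cong (scale (+ k)) eq) (trans (scale-scale (+ k) (+ wtot ws) x)
    (cong (λ j → scale j x) (trans (sym (ℤₚ.pos-* k (wtot ws))) (cong +_ (sym tot))))))

module _ {M : PtSet} (convex : Convex M) where
  combine₂ : ∀ m n {a b x} → M a → M b → 0 ℕ.< m ℕ.+ n →
    scale (+ m) a ⊕ scale (+ n) b ≡ scale (+ m + + n) x → M x
  combine₂ m n {a} {b} {x} ma mb pos eq = convex x ((m , a) ∷ (n , b) ∷ [] , ma ∷ mb ∷ [] ,
    subst (0 ℕ.<_) (cong (m ℕ.+_) (sym (ℕₚ.+-identityʳ n))) pos ,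
    trans (cong (scale (+ m) a ⊕_) (⊕-identityʳ (scale (+ n) b)))
      (trans eq (cong (λ k → scale (+ (m ℕ.+ k)) x) (sym (ℕₚ.+-identityʳ n)))))

  combine₃ : ∀ l m n {a b c x} → M a → M b → M c → 0 ℕ.< l ℕ.+ (m ℕ.+ n) →
    scale (+ l) a ⊕ (scale (+ m) b ⊕ scale (+ n) c) ≡ scale (+ l + (+ m + + n)) x → M x
  combine₃ l m n {a} {b} {c} {x} ma mb mc pos eq = convex x ((l , a) ∷ (m , b) ∷ (n , c) ∷ [] , ma ∷ mb ∷ mc ∷ [] ,
    subst (0 ℕ.<_) (cong (λ k → l ℕ.+ (m ℕ.+ k)) (sym (ℕₚ.+-identityʳ n))) pos ,
    trans (cong (λ y → scale (+ l) a ⊕ (scale (+ m) b ⊕ y)) (⊕-identityʳ (scale (+ n) c)))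
      (trans eq (cong (λ k → scale (+ (l ℕ.+ (m ℕ.+ k))) x) (sym (ℕₚ.+-identityʳ n)))))

  combine₄ : ∀ k l m n {a b c d x} → M a → M b → M c → M d → 0 ℕ.< k ℕ.+ (l ℕ.+ (m ℕ.+ n)) →
    scale (+ k) a ⊕ (scale (+ l) b ⊕ (scale (+ m) c ⊕ scale (+ n) d)) ≡ scale (+ k + (+ l + (+ m + + n))) x → M x
  combine₄ k l m n {a} {b} {c} {d} {x} ma mb mc md pos eq =
    convex x ((k , a) ∷ (l , b) ∷ (m , c) ∷ (n , d) ∷ [] , ma ∷ mb ∷ mc ∷ md ∷ [] ,
    subst (0 ℕ.<_) (cong (λ j → k ℕ.+ (l ℕ.+ (m ℕ.+ j))) (sym (ℕₚ.+-identityʳ n))) pos ,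
    trans (cong (λ y → scale (+ k) a ⊕ (scale (+ l) b ⊕ (scale (+ m) c ⊕ y))) (⊕-identityʳ (scale (+ n) d)))
      (trans eq (cong (λ j → scale (+ (k ℕ.+ (l ℕ.+ (m ℕ.+ j)))) x) (sym (ℕₚ.+-identityʳ n)))))

-- Sections at lattice distance one

UnimodularFree : PtSet → Set
UnimodularFree M = ∀ p q r s → M p → M q → M r → M s → ∣ det3 (q ⊖ p) (r ⊖ p) (s ⊖ p) ∣ ≢ 1

⊖-origin : ∀ x → x ⊖ origin ≡ x
⊖-origin (x , y , z) = pt≡ (ℤₚ.+-identityʳ x) (ℤₚ.+-identityʳ y) (ℤₚ.+-identityʳ z)

translate-convex : ∀ {M} p → Convex M → Convex (λ v → M (p ⊕ v))
translate-convex {M} p convex x (ws , ws∈ , pos , eq) =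
  convex (p ⊕ x) (shift ws , shift-∈ ws∈ , subst (0 ℕ.<_) (sym (shift-tot ws)) pos , total)
  where
  shift : List (ℕ × Pt) → List (ℕ × Pt)
  shift [] = []
  shift ((w , v) ∷ ws) = (w , p ⊕ v) ∷ shift ws
  shift-∈ : ∀ {ws} → All (λ wp → M (p ⊕ proj₂ wp)) ws → All (λ wp → M (proj₂ wp)) (shift ws)
  shift-∈ [] = []
  shift-∈ (m ∷ ms) = m ∷ shift-∈ ms
  shift-tot : ∀ ws → wtot (shift ws) ≡ wtot ws
  shift-tot [] = refl
  shift-tot ((w , v) ∷ ws) = cong (w ℕ.+_) (shift-tot ws)
  shift-sum : ∀ ws → wsum (shift ws) ≡ scale (+ wtot ws) p ⊕ wsum ws
  shift-sum [] = sym (⊕-identityʳ origin)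
  shift-sum ((w , v) ∷ ws) = trans (cong (scale (+ w) (p ⊕ v) ⊕_) (shift-sum ws))
    (proveᵥ (p ▸ v ▸ wsum ws ▸ + w ∷ + wtot ws ∷ [])
      (scale′ w′ (V₀ ⊕′ V₁) ⊕′ (scale′ t′ V₀ ⊕′ V₂)) (scale′ (w′ :+ t′) V₀ ⊕′ (scale′ w′ V₁ ⊕′ V₂)) refl refl refl)
    where
    w′ t′ : Polynomial 11
    w′ = ν 9
    t′ = ν 10
  total : wsum (shift ws) ≡ scale (+ wtot (shift ws)) (p ⊕ x)
  total = trans (shift-sum ws) (trans (cong (scale (+ wtot ws) p ⊕_) eq) (trans (sym (scale-⊕ (+ wtot ws) p x))
    (cong (λ k → scale (+ k) (p ⊕ x)) (sym (shift-tot ws)))))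

⊕-⊖-⊕ : ∀ p x y → (p ⊕ x) ⊖ (p ⊕ y) ≡ x ⊖ y
⊕-⊖-⊕ p x y = proveᵥ (p ▸ x ▸ y ▸ []) ((V₀ ⊕′ V₁) ⊖′ (V₀ ⊕′ V₂)) (V₁ ⊖′ V₂) refl refl refl

translate-free : ∀ {M} p → UnimodularFree M → UnimodularFree (λ v → M (p ⊕ v))
translate-free p free a b c d ma mb mc md unit = free (p ⊕ a) (p ⊕ b) (p ⊕ c) (p ⊕ d) ma mb mc md
  (trans (cong ∣_∣ (det3-cong (⊕-⊖-⊕ p b a) (⊕-⊖-⊕ p c a) (⊕-⊖-⊕ p d a))) unit)

∣∣≡1 : ∀ z → ∣ z ∣ ≡ 1 → (z ≡ + 1) ⊎ (z ≡ - + 1)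
∣∣≡1 (+ .1) refl = inj₁ refl
∣∣≡1 -[1+ .0 ] refl = inj₂ refl

module _ {M : PtSet} (convex : Convex M) (free : UnimodularFree M) (M0 : M origin) where

  free₀ : ∀ {a b c} → M a → M b → M c → ∣ det3 a b c ∣ ≢ 1
  free₀ {a} {b} {c} ma mb mc unit = free origin a b c M0 ma mb mc
    (trans (cong ∣_∣ (det3-cong (⊖-origin a) (⊖-origin b) (⊖-origin c))) unit)

  -- The section of the triangle 0, e, o at lattice distance one from 0e has length k/(k+1),
  -- hence it contains a lattice point.
  private
    no-apex : ∀ {e o v} → M e → M o → M v → ∀ t k q → o ≡ scale t e ⊕ scale (+ ℕ.suc k) q → ∣ det3 e q v ∣ ≢ 1
    no-apex {e} {o} {v} me mo mv t k q o≡ unit with ceiling t k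
    ... | x , r , r≤k , x≡ = free₀ me mw mv (trans (cong ∣_∣ (prove (e ▸ q ▸ v ▸ x ∷ [])
        (det3′ V₀ (scale′ (ν 9) V₀ ⊕′ V₁) V₂) (det3′ V₀ V₁ V₂) refl)) unit)
      where
      w = scale x e ⊕ q
      K = + ℕ.suc k
      mw : M w
      mw = combine₃ convex 1 r (k ℕ.∸ r) mo me M0 (s≤s z≤n) (begin
        scale (+ 1) o ⊕ (scale (+ r) e ⊕ scale (+ (k ℕ.∸ r)) origin)
          ≡⟨ cong (λ y → scale (+ 1) y ⊕ (scale (+ r) e ⊕ scale (+ (k ℕ.∸ r)) origin)) o≡ ⟩
        scale (+ 1) (scale t e ⊕ scale K q) ⊕ (scale (+ r) e ⊕ scale (+ (k ℕ.∸ r)) origin)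
          ≡⟨ proveᵥ (e ▸ q ▸ t ∷ K ∷ + r ∷ + (k ℕ.∸ r) ∷ [])
               (scale′ (con (+ 1)) (scale′ (ν 6) V₀ ⊕′ scale′ (ν 7) V₁)
                 ⊕′ (scale′ (ν 8) V₀ ⊕′ scale′ (ν 9) origin′))
               (scale′ (ν 6 :+ ν 8) V₀ ⊕′ scale′ (ν 7) V₁) refl refl refl ⟩
        scale (t + + r) e ⊕ scale K q
          ≡⟨ cong₂ _⊕_ (trans (cong (λ j → scale j e) (sym x≡)) (sym (scale-scale K x e))) refl ⟩
        scale K (scale x e) ⊕ scale K q
          ≡⟨ sym (scale-⊕ K (scale x e) q) ⟩
        scale K w
          ≡⟨ cong (λ j → scale (+ ℕ.suc j) w) (sym (ℕₚ.m+[n∸m]≡n r≤k)) ⟩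
        scale (+ 1 + (+ r + + (k ℕ.∸ r))) w ∎)
        where open ≡-Reasoning

  module _ {e g} (me : M e) (ge : dot g e ≡ + 1) where

    private
      no-apex-± : ∀ {o v} → M o → M v → ∀ t d q → d ≢ + 0 → o ≡ scale t e ⊕ scale d q → ∣ det3 e q v ∣ ≢ 1
      no-apex-± mo mv t (+ 0) q d≢0 _ _ = d≢0 refl
      no-apex-± mo mv t (+ ℕ.suc k) q _ o≡ unit = no-apex me mo mv t k q o≡ unit
      no-apex-± {o} {v} mo mv t -[1+ k ] q _ o≡ unit = no-apex me mo mv t k (scale (- + 1) q)
        (trans o≡ (cong (scale t e ⊕_) (proveᵥ (q ▸ + ℕ.suc k ∷ []) (scale′ (:- ν 3) V₀)
          (scale′ (ν 3) (scale′ (con (- + 1)) V₀)) refl refl refl)))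
        (trans (trans (cong ∣_∣ (prove (e ▸ q ▸ v ▸ []) (det3′ V₀ (scale′ (con (- + 1)) V₁) V₂) (:- det3′ V₀ V₁ V₂) refl))
          (ℤₚ.∣-i∣≡∣i∣ (det3 e q v))) unit)

      -- `cross g a` completes `e` to a basis of the lattice plane `a = 0`, and `v` at height one
      -- completes that to a basis of the whole lattice. In these coordinates `o` is a multiple of
      -- `e` plus a nonzero multiple of `cross g a`, the situation of `no-apex`.
      level₁ : ∀ a {o v} → dot a e ≡ + 0 → M o → dot a o ≡ + 0 → cross e o ≢ origin → M v → dot a v ≢ + 1
      level₁ a {o} {v} ae mo ao off mv av = no-apex-± mo mv (dot g o) (- d) (cross g a)
        (λ -d≡0 → d≢0 (trans (sym (ℤₚ.neg-involutive d)) (cong -_ -d≡0)))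
        (trans (along g e o ge) (cong (scale (dot g o) e ⊕_)
          (trans (cong (cross g) (trans (proveᵥ (e ▸ o ▸ []) (cross′ V₁ V₀) (scale′ (con (- + 1)) (cross′ V₀ V₁)) refl refl refl)
            (cong (scale (- + 1)) c≡)))
          (proveᵥ (g ▸ a ▸ d ∷ []) (cross′ V₀ (scale′ (con (- + 1)) (scale′ (ν 6) V₁)))
            (scale′ (:- ν 6) (cross′ V₀ V₁)) refl refl refl))))
        (trans (cong ∣_∣ det≡) refl)
        where
        d = det3 e o v
        c≡ : cross e o ≡ scale d a
        c≡ = normal a e o v ae ao av
        d≢0 : d ≢ + 0
        d≢0 d≡0 = off (trans c≡ (cong (λ k → scale k a) d≡0))
        det≡ : det3 e (cross g a) v ≡ - + 1
        det≡ = trans (prove (e ▸ g ▸ a ▸ v ▸ []) (det3′ V₀ (cross′ V₁ V₂) V₃)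
            (dot′ V₂ V₀ :* dot′ V₁ V₃ :- dot′ V₁ V₀ :* dot′ V₂ V₃) refl)
          (cong₂ _-_ (cong (_* dot g v) ae) (cong₂ _*_ ge av))

    level-one : ∀ a {o v} → dot a e ≡ + 0 → M o → dot a o ≡ + 0 → cross e o ≢ origin → M v → ∣ dot a v ∣ ≢ 1
    level-one a {o} {v} ae mo ao off mv unit with ∣∣≡1 (dot a v) unit
    ... | inj₁ av = level₁ a ae mo ao off mv av
    ... | inj₂ av = level₁ (scale (- + 1) a) (neg e ae) mo (neg o ao) off mv (neg v av)
      where
      neg : ∀ x {k} → dot a x ≡ k → dot (scale (- + 1) a) x ≡ - k
      neg x refl = prove (a ▸ x ▸ []) (dot′ (scale′ (con (- + 1)) V₀) V₁) (:- dot′ V₀ V₁) refl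

    -- The section at lattice distance one of a pyramid of height m+1 over a unit parallelogram
    -- is a parallelogram with edges m/(m+1), hence it contains a lattice point.
    private
      no-pyramid : ∀ {q y} → M q → M (e ⊕ q) → M y → ∀ α β m c →
        y ≡ scale α e ⊕ (scale β q ⊕ scale (+ ℕ.suc m) c) → ∣ det3 e q c ∣ ≢ 1
      no-pyramid {q} {y} mq meq my α β m c y≡ unit with ceiling α m | ceiling β m
      ... | x , r , r≤m , x≡ | z , s , s≤m , z≡ = free₀ me mq mw (trans (cong ∣_∣ (prove (e ▸ q ▸ c ▸ x ∷ z ∷ [])
            (det3′ V₀ V₁ (scale′ (ν 9) V₀ ⊕′ (scale′ (ν 10) V₁ ⊕′ V₂))) (det3′ V₀ V₁ V₂) refl)) unit)
        where
        open ≡-Reasoning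
        w = scale x e ⊕ (scale z q ⊕ c)
        K = + ℕ.suc m
        Kw : scale (α + + r) e ⊕ (scale (β + + s) q ⊕ scale K c) ≡ scale K w
        Kw = trans (cong₂ _⊕_ (cong (λ j → scale j e) (sym x≡)) (cong₂ _⊕_ (cong (λ j → scale j q) (sym z≡)) refl))
          (proveᵥ (e ▸ q ▸ c ▸ x ∷ z ∷ K ∷ [])
            (scale′ (ν 11 :* ν 9) V₀ ⊕′ (scale′ (ν 11 :* ν 10) V₁ ⊕′ scale′ (ν 11) V₂))
            (scale′ (ν 11) (scale′ (ν 9) V₀ ⊕′ (scale′ (ν 10) V₁ ⊕′ V₂))) refl refl refl)
        mw : M w
        -- The diagonal from `origin` to `e ⊕ q` cuts the base into two triangles. Comparing the
        -- defects `r` and `s` tells which of them supplies the remaining weights.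
        mw with ℕₚ.≤-total r s
        ... | inj₁ r≤s = combine₄ convex 1 r (s ℕ.∸ r) (m ℕ.∸ s) my meq mq M0 (s≤s z≤n) (begin
          scale (+ 1) y ⊕ (scale (+ r) (e ⊕ q) ⊕ (scale (+ (s ℕ.∸ r)) q ⊕ scale (+ (m ℕ.∸ s)) origin))
            ≡⟨ cong (λ y → scale (+ 1) y ⊕ (scale (+ r) (e ⊕ q) ⊕ (scale (+ (s ℕ.∸ r)) q ⊕ scale (+ (m ℕ.∸ s)) origin))) y≡ ⟩
          scale (+ 1) (scale α e ⊕ (scale β q ⊕ scale K c)) ⊕
            (scale (+ r) (e ⊕ q) ⊕ (scale (+ (s ℕ.∸ r)) q ⊕ scale (+ (m ℕ.∸ s)) origin))
            ≡⟨ proveᵥ (e ▸ q ▸ c ▸ α ∷ β ∷ K ∷ + r ∷ + (s ℕ.∸ r) ∷ + (m ℕ.∸ s) ∷ [])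
                 (scale′ (con (+ 1)) (scale′ α′ V₀ ⊕′ (scale′ β′ V₁ ⊕′ scale′ K′ V₂)) ⊕′
                   (scale′ r′ (V₀ ⊕′ V₁) ⊕′ (scale′ s′ V₁ ⊕′ scale′ t′ origin′)))
                 (scale′ (α′ :+ r′) V₀ ⊕′ (scale′ (β′ :+ (r′ :+ s′)) V₁ ⊕′ scale′ K′ V₂)) refl refl refl ⟩
          scale (α + + r) e ⊕ (scale (β + (+ (r ℕ.+ (s ℕ.∸ r)))) q ⊕ scale K c)
            ≡⟨ cong (λ j → scale (α + + r) e ⊕ (scale (β + + j) q ⊕ scale K c)) (ℕₚ.m+[n∸m]≡n r≤s) ⟩
          scale (α + + r) e ⊕ (scale (β + + s) q ⊕ scale K c)
            ≡⟨ Kw ⟩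
          scale K w
            ≡⟨ cong (λ j → scale (+ ℕ.suc j) w) (sym (trans (sym (ℕₚ.+-assoc r (s ℕ.∸ r) (m ℕ.∸ s)))
                 (trans (cong (ℕ._+ (m ℕ.∸ s)) (ℕₚ.m+[n∸m]≡n r≤s)) (ℕₚ.m+[n∸m]≡n s≤m)))) ⟩
          scale (+ 1 + (+ r + (+ (s ℕ.∸ r) + + (m ℕ.∸ s)))) w ∎)
          where
          α′ β′ K′ r′ s′ t′ : Polynomial 15
          α′ = ν 9
          β′ = ν 10
          K′ = ν 11
          r′ = ν 12
          s′ = ν 13
          t′ = ν 14
        ... | inj₂ s≤r = combine₄ convex 1 s (r ℕ.∸ s) (m ℕ.∸ r) my meq me M0 (s≤s z≤n) (begin
          scale (+ 1) y ⊕ (scale (+ s) (e ⊕ q) ⊕ (scale (+ (r ℕ.∸ s)) e ⊕ scale (+ (m ℕ.∸ r)) origin))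
            ≡⟨ cong (λ y → scale (+ 1) y ⊕ (scale (+ s) (e ⊕ q) ⊕ (scale (+ (r ℕ.∸ s)) e ⊕ scale (+ (m ℕ.∸ r)) origin))) y≡ ⟩
          scale (+ 1) (scale α e ⊕ (scale β q ⊕ scale K c)) ⊕
            (scale (+ s) (e ⊕ q) ⊕ (scale (+ (r ℕ.∸ s)) e ⊕ scale (+ (m ℕ.∸ r)) origin))
            ≡⟨ proveᵥ (e ▸ q ▸ c ▸ α ∷ β ∷ K ∷ + s ∷ + (r ℕ.∸ s) ∷ + (m ℕ.∸ r) ∷ [])
                 (scale′ (con (+ 1)) (scale′ α′ V₀ ⊕′ (scale′ β′ V₁ ⊕′ scale′ K′ V₂)) ⊕′
                   (scale′ r′ (V₀ ⊕′ V₁) ⊕′ (scale′ s′ V₀ ⊕′ scale′ t′ origin′)))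
                 (scale′ (α′ :+ (r′ :+ s′)) V₀ ⊕′ (scale′ (β′ :+ r′) V₁ ⊕′ scale′ K′ V₂)) refl refl refl ⟩
          scale (α + (+ (s ℕ.+ (r ℕ.∸ s)))) e ⊕ (scale (β + + s) q ⊕ scale K c)
            ≡⟨ cong (λ j → scale (α + + j) e ⊕ (scale (β + + s) q ⊕ scale K c)) (ℕₚ.m+[n∸m]≡n s≤r) ⟩
          scale (α + + r) e ⊕ (scale (β + + s) q ⊕ scale K c)
            ≡⟨ Kw ⟩
          scale K w
            ≡⟨ cong (λ j → scale (+ ℕ.suc j) w) (sym (trans (sym (ℕₚ.+-assoc s (r ℕ.∸ s) (m ℕ.∸ r)))
                 (trans (cong (ℕ._+ (m ℕ.∸ r)) (ℕₚ.m+[n∸m]≡n s≤r)) (ℕₚ.m+[n∸m]≡n r≤m)))) ⟩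
          scale (+ 1 + (+ s + (+ (r ℕ.∸ s) + + (m ℕ.∸ r)))) w ∎)
          where
          α′ β′ K′ r′ s′ t′ : Polynomial 15
          α′ = ν 9
          β′ = ν 10
          K′ = ν 11
          r′ = ν 12
          s′ = ν 13
          t′ = ν 14

    -- In the lattice basis `e`, `q`, `c` the determinant is the coordinate of `y` along `c`, so its
    -- absolute value is the height of the pyramid with apex `y`. Any height except 0 is refuted by
    -- `no-pyramid`, after reflecting `c` when the sign is negative.
    parallelogram : ∀ f {q y} → dot f e ≡ + 0 → M q → dot f q ≡ + 1 → M (e ⊕ q) → M y → det3 e q y ≡ + 0
    parallelogram f {q} {y} fe mq fq meq my = go (det3 e q y) refl
      where
      c = cross g f
      det≡ : det3 e q c ≡ + 1
      det≡ = complement-det e q g f ge fe fq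
      α = dot (cross q c) y
      β = dot (cross c e) y
      y≡ : y ≡ scale α e ⊕ (scale β q ⊕ scale (det3 e q y) c)
      y≡ = trans (sym (scale-one y)) (trans (cong (λ k → scale k y) (sym det≡)) (trans (cramer e q c y)
        (cong (λ k → scale α e ⊕ (scale β q ⊕ scale k c))
          (prove (e ▸ q ▸ y ▸ []) (dot′ (cross′ V₀ V₁) V₂) (det3′ V₀ V₁ V₂) refl))))
      go : ∀ d → det3 e q y ≡ d → d ≡ + 0
      go (+ 0) _ = refl
      go (+ ℕ.suc m) eq = ⊥-elim (no-pyramid mq meq my α β m c
        (trans y≡ (cong (λ k → scale α e ⊕ (scale β q ⊕ scale k c)) eq)) (cong ∣_∣ det≡))
      go -[1+ m ] eq = ⊥-elim (no-pyramid mq meq my α β m (scale (- + 1) c)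
        (trans y≡ (trans (cong (λ k → scale α e ⊕ (scale β q ⊕ scale k c)) eq)
          (cong (λ v → scale α e ⊕ (scale β q ⊕ v)) (proveᵥ (c ▸ + ℕ.suc m ∷ []) (scale′ (:- ν 3) V₀)
          (scale′ (ν 3) (scale′ (con (- + 1)) V₀)) refl refl refl))))
        (cong ∣_∣ (trans (prove (e ▸ q ▸ c ▸ []) (det3′ V₀ V₁ (scale′ (con (- + 1)) V₂)) (:- det3′ V₀ V₁ V₂) refl)
          (cong -_ det≡))))

-- Lists and vertices

open DecMembership _≟ₚ_ using (_∈?_)

infixl 6 _∖_
_∖_ : List Pt → Pt → List Pt
xs ∖ u = filter (λ x → ¬? (x ≟ₚ u)) xs

∈-∖⁺ : ∀ {x u xs} → x ∈ xs → x ≢ u → x ∈ xs ∖ u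
∈-∖⁺ {u = u} = ∈-filter⁺ (λ x → ¬? (x ≟ₚ u))

∈-∖⁻ : ∀ {x u} xs → x ∈ xs ∖ u → x ∈ xs × x ≢ u
∈-∖⁻ {u = u} xs = ∈-filter⁻ (λ x → ¬? (x ≟ₚ u)) {xs = xs}

Unique-∖ : ∀ {xs} u → Unique xs → Unique (xs ∖ u)
Unique-∖ u = Uniqueₚ.filter⁺ (λ x → ¬? (x ≟ₚ u))

Unique⇒∉ : ∀ {x : Pt} {xs} → Unique (x ∷ xs) → x ∉ xs
Unique⇒∉ (x≢ ∷ _) x∈ = All.lookup x≢ x∈ refl

Unique-tail : ∀ {x : Pt} {xs} → Unique (x ∷ xs) → Unique xs
Unique-tail (_ ∷ u) = u

Unique-⊆⇒≤ : ∀ {xs ys : List Pt} → Unique xs → (∀ {x} → x ∈ xs → x ∈ ys) → length xs ℕ.≤ length ys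
Unique-⊆⇒≤ {[]} _ _ = z≤n
Unique-⊆⇒≤ {x ∷ xs} {ys} uniq xs⊆ys = ℕₚ.≤-<-trans
  (Unique-⊆⇒≤ (Unique-tail uniq) λ y∈ → ∈-∖⁺ (xs⊆ys (there y∈)) λ { refl → Unique⇒∉ uniq y∈ })
  (filter-notAll (λ y → ¬? (y ≟ₚ x)) ys (Any.map (λ { refl y≢y → y≢y refl }) (xs⊆ys (here refl))))

Unique-⊆⇒⊇ : ∀ {xs ys : List Pt} → Unique xs → (∀ {x} → x ∈ xs → x ∈ ys) → length ys ℕ.≤ length xs →
  ∀ {y} → y ∈ ys → y ∈ xs
Unique-⊆⇒⊇ {xs} {ys} uniq xs⊆ys ≤len {y} y∈ with y ∈? xs
... | yes y∈xs = y∈xs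
... | no y∉xs = ⊥-elim (ℕₚ.<⇒≱ (Unique-⊆⇒≤ {y ∷ xs} {ys} (All.tabulate (λ { x∈ refl → y∉xs x∈ }) ∷ uniq)
  λ { (here refl) → y∈ ; (there x∈) → xs⊆ys x∈ }) ≤len)

length-∖ : ∀ {xs} u → Unique xs → length xs ℕ.≤ ℕ.suc (length (xs ∖ u))
length-∖ {xs} u uniq = Unique-⊆⇒≤ {xs} {u ∷ xs ∖ u} uniq go
  where
  go : ∀ {x} → x ∈ xs → x ∈ u ∷ xs ∖ u
  go {x} x∈ with x ≟ₚ u
  ... | yes refl = here refl
  ... | no x≢u = there (∈-∖⁺ x∈ x≢u)

≤-witness : ∀ {a b} → a ℤ.≤ b → Σ ℕ λ k → b ≡ a + + k
≤-witness {a} {b} a≤b = ∣ b - a ∣ , trans (sym (solve 2 (λ a b → a :+ (b :- a) := b) refl a b))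
  (cong (λ z → a + z) (sym (ℤₚ.0≤i⇒+∣i∣≡i (ℤₚ.i≤j⇒0≤j-i a≤b))))

witness-≤ : ∀ {a b} k → b ≡ a + + k → a ℤ.≤ b
witness-≤ {a} k refl = ℤₚ.i≤i+j a (+ k)

<-witness : ∀ {a b} → a < b → Σ ℕ λ k → b ≡ a + + ℕ.suc k
<-witness {a} {b} a<b with ≤-witness (ℤₚ.i<j⇒suc[i]≤j a<b)
... | k , eq = k , trans eq (solve 2 (λ a k → con (+ 1) :+ a :+ k := a :+ (con (+ 1) :+ k)) refl a (+ k))

witness-< : ∀ {a b} k → b ≡ a + + ℕ.suc k → a < b
witness-< {a} k refl = ℤₚ.suc[i]≤j⇒i<j (witness-≤ k (solve 2 (λ a k → a :+ (con (+ 1) :+ k) := con (+ 1) :+ a :+ k) refl a (+ k)))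

maximum : ∀ (f : Pt → ℤ) {x} xs → x ∈ xs → Σ Pt λ m → m ∈ xs × (∀ {y} → y ∈ xs → f y ℤ.≤ f m)
maximum f (x ∷ []) _ = x , here refl , λ { (here refl) → ℤₚ.≤-refl }
maximum f (x ∷ xs@(_ ∷ _)) _ with maximum f xs (here refl)
... | m , m∈ , max with ℤₚ.≤-total (f x) (f m)
... | inj₁ x≤m = m , there m∈ , λ { (here refl) → x≤m ; (there y∈) → max y∈ }
... | inj₂ m≤x = x , here refl , λ { (here refl) → ℤₚ.≤-refl ; (there y∈) → ℤₚ.≤-trans (max y∈) m≤x }

-- Only the leading functional is maximised over the whole list; the later ones act on successive
-- faces, where nothing is claimed about the rest.
HeadMax : List Pt → Pt → Pt → Set
HeadMax [] y v = ⊤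
HeadMax (a ∷ _) y v = dot a y ℤ.≤ dot a v

opaque
  -- A functional maximal on a list whose ties are broken by the functionals cs: on the face where the
  -- first one is maximal use the rest, then add a large multiple of the first one.
  lex-max : ∀ cs {x} xs → x ∈ xs → Σ Pt λ v → v ∈ xs × (∀ {y} → y ∈ xs → HeadMax cs y v) × Σ Pt λ c →
    ∀ {y} → y ∈ xs → All (λ d → dot d y ≡ dot d v) cs ⊎ dot c y < dot c v
  lex-max [] {x} xs x∈ = x , x∈ , (λ _ → tt) , origin , λ _ → inj₁ []
  lex-max (a ∷ cs) xs x∈ with maximum (dot a) xs x∈
  ... | m , m∈ , max with lex-max cs (filter (λ y → dot a y ≟ dot a m) xs) (∈-filter⁺ (λ y → dot a y ≟ dot a m) m∈ refl)
  ... | v , v∈ , _ , b , strict with ∈-filter⁻ (λ y → dot a y ≟ dot a m) {xs = xs} v∈ | maximum (dot b) xs m∈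
  ... | v∈xs , av | m′ , _ , max′ with ≤-witness (max′ v∈xs)
  -- `n` is the most by which `b` can exceed its value at `v`. Off the face `a` loses at least one,
  -- so weighting it with `n + 1` outweighs any gain in `b`.
  ... | n , bm = v , v∈xs , (λ {y} y∈ → subst (dot a y ℤ.≤_) (sym av) (max y∈)) , scale (+ ℕ.suc n) a ⊕ b , separate
    where
    value : ∀ y → dot (scale (+ ℕ.suc n) a ⊕ b) y ≡ + ℕ.suc n * dot a y + dot b y
    value y = prove (a ▸ b ▸ y ▸ + ℕ.suc n ∷ []) (dot′ (scale′ (ν 9) V₀ ⊕′ V₁) V₂)
      (ν 9 :* dot′ V₀ V₂ :+ dot′ V₁ V₂) refl
    separate : ∀ {y} → y ∈ xs → All (λ d → dot d y ≡ dot d v) (a ∷ cs) ⊎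
      dot (scale (+ ℕ.suc n) a ⊕ b) y < dot (scale (+ ℕ.suc n) a ⊕ b) v
    separate {y} y∈ with dot a y ≟ dot a m
    ... | yes ay with strict (∈-filter⁺ (λ y → dot a y ≟ dot a m) y∈ ay)
    ... | inj₁ eqs = inj₁ (trans ay (sym av) ∷ eqs)
    ... | inj₂ by<bv = inj₂ (subst₂ _<_ (sym (value y)) (sym (value v))
      (subst (λ k → + ℕ.suc n * k + dot b y < + ℕ.suc n * dot a v + dot b v) (trans av (sym ay))
        (ℤₚ.+-monoʳ-< (+ ℕ.suc n * dot a v) by<bv)))
    separate {y} y∈ | no ay≢ with <-witness (ℤₚ.≤∧≢⇒< (max y∈) ay≢) | ≤-witness (max′ y∈)
    ... | k , am≡ | j , bm≡ = inj₂ (subst₂ _<_ (sym (value y)) (sym (value v)) (witness-< (k ℕ.* ℕ.suc n ℕ.+ j) (begin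
      + ℕ.suc n * dot a v + dot b v
        ≡⟨ cong₂ (λ p q → + ℕ.suc n * p + q) (trans av am≡) bv≡ ⟩
      + ℕ.suc n * (dot a y + + ℕ.suc k) + (dot b y + + j - + n)
        ≡⟨ solve 5 (λ n k j ay by → (con (+ 1) :+ n) :* (ay :+ (con (+ 1) :+ k)) :+ (by :+ j :- n)
             := (con (+ 1) :+ n) :* ay :+ by :+ (con (+ 1) :+ (k :* (con (+ 1) :+ n) :+ j))) refl (+ n) (+ k) (+ j) (dot a y)
               (dot b y) ⟩
      + ℕ.suc n * dot a y + dot b y + (+ 1 + (+ k * + ℕ.suc n + + j))
        ≡⟨ cong (λ z → + ℕ.suc n * dot a y + dot b y + (+ 1 + (z + + j))) (sym (ℤₚ.pos-* k (ℕ.suc n))) ⟩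
      + ℕ.suc n * dot a y + dot b y + + ℕ.suc (k ℕ.* ℕ.suc n ℕ.+ j) ∎)))
      where
      open ≡-Reasoning
      bv≡ : dot b v ≡ dot b y + + j - + n
      bv≡ = trans (sym (solve 2 (λ x n → x :+ n :- n := x) refl (dot b v) (+ n))) (cong (λ z → z - + n) (trans (sym bm) bm≡))

Vertex : List Pt → Pt → Set
Vertex L v = v ∈ L × Σ Pt λ c → ∀ {x} → x ∈ L → x ≢ v → dot c x < dot c v

axis₁ axis₂ axis₃ : Pt
axis₁ = + 1 , + 0 , + 0
axis₂ = + 0 , + 1 , + 0
axis₃ = + 0 , + 0 , + 1

axes-separate : ∀ y v → dot axis₁ y ≡ dot axis₁ v → dot axis₂ y ≡ dot axis₂ v → dot axis₃ y ≡ dot axis₃ v → y ≡ v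
axes-separate (x , y , z) (x′ , y′ , z′) p q r = pt≡ (trans (first x y z) (trans p (sym (first x′ y′ z′))))
  (trans (second x y z) (trans q (sym (second x′ y′ z′)))) (trans (third x y z) (trans r (sym (third x′ y′ z′))))
  where
  first : ∀ x y z → x ≡ + 1 * x + + 0 * y + + 0 * z
  first = solve 3 (λ x y z → x := con (+ 1) :* x :+ con (+ 0) :* y :+ con (+ 0) :* z) refl
  second : ∀ x y z → y ≡ + 0 * x + + 1 * y + + 0 * z
  second = solve 3 (λ x y z → y := con (+ 0) :* x :+ con (+ 1) :* y :+ con (+ 0) :* z) refl
  third : ∀ x y z → z ≡ + 0 * x + + 0 * y + + 1 * z
  third = solve 3 (λ x y z → z := con (+ 0) :* x :+ con (+ 0) :* y :+ con (+ 1) :* z) refl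

opaque
  -- Breaking ties by the three coordinates leaves a single maximiser, which is therefore a vertex
  -- of the face selected by `a`.
  max-vertex : ∀ a L {x} → x ∈ L → Σ Pt λ v → Vertex L v × (∀ {y} → y ∈ L → dot a y ℤ.≤ dot a v)
  max-vertex a L x∈ with lex-max (a ∷ axis₁ ∷ axis₂ ∷ axis₃ ∷ []) L x∈
  ... | v , v∈ , max , c , strict = v , (v∈ , c , λ {y} y∈ y≢v → separate y y≢v (strict y∈)) , max
    where
    separate : ∀ y → y ≢ v → All (λ d → dot d y ≡ dot d v) (a ∷ axis₁ ∷ axis₂ ∷ axis₃ ∷ []) ⊎ dot c y < dot c v → dot c y < dot c
      v
    separate y y≢v (inj₁ (_ ∷ p ∷ q ∷ r ∷ [])) = ⊥-elim (y≢v (axes-separate y v p q r))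
    separate _ _ (inj₂ lt) = lt

opaque
  -- A point strictly on one side of the plane `a = t` forces the extreme vertex of that side off
  -- the plane as well.
  vertex-off : ∀ a t L {x} → x ∈ L → dot a x ≢ t → Σ Pt λ v → Vertex L v × dot a v ≢ t
  vertex-off a t L {x} x∈ ax≢t with ℤₚ.≤-total t (dot a x)
  ... | inj₁ t≤ with max-vertex a L x∈
  ... | v , vertex , max = v , vertex , λ av≡t → ax≢t (ℤₚ.≤-antisym (subst (dot a x ℤ.≤_) av≡t (max x∈)) t≤)
  vertex-off a t L {x} x∈ ax≢t | inj₂ ≤t with max-vertex (scale (- + 1) a) L x∈
  ... | v , vertex , max = v , vertex , λ av≡t → ax≢t (ℤₚ.≤-antisym ≤t
      (subst (ℤ._≤ dot a x) av≡t (ℤₚ.neg-cancel-≤ {dot a x} {dot a v} (subst₂ ℤ._≤_ (neg x) (neg v) (max x∈)))))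
    where
    neg : ∀ y → dot (scale (- + 1) a) y ≡ - dot a y
    neg y = prove (a ▸ y ▸ []) (dot′ (scale′ (con (- + 1)) V₀) V₁) (:- dot′ V₀ V₁) refl

Spatial : List Pt → Set
Spatial L = ∀ n → n ≢ origin → ∀ t → Σ Pt λ x → x ∈ L × dot n x ≢ t

opaque
  perpendicular : ∀ d → d ≢ origin → Σ Pt λ c → c ≢ origin × dot c d ≡ + 0
  perpendicular (+ 0 , + 0 , z) _ = (+ 1 , + 0 , + 0) , (λ ()) , prove (z ∷ [])
    (dot′ (con (+ 1) , con (+ 0) , con (+ 0)) (con (+ 0) , con (+ 0) , var zero)) (con (+ 0)) refl
  perpendicular (x , y , z) d≢0 with x ≟ + 0 | y ≟ + 0
  ... | yes refl | yes refl = (+ 1 , + 0 , + 0) , (λ ()) , prove (z ∷ [])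
    (dot′ (con (+ 1) , con (+ 0) , con (+ 0)) (con (+ 0) , con (+ 0) , var zero)) (con (+ 0)) refl
  ... | no x≢0 | _ = (y , - x , + 0) , (λ eq → x≢0 (ℤₚ.neg-injective (cong (λ w → proj₁ (proj₂ w)) eq))) ,
    prove ((x , y , z) ▸ []) (dot′ (proj₁ (proj₂ V₀) , :- proj₁ V₀ , con (+ 0)) V₀) (con (+ 0)) refl
  ... | _ | no y≢0 = (y , - x , + 0) , (λ eq → y≢0 (cong proj₁ eq)) ,
    prove ((x , y , z) ▸ []) (dot′ (proj₁ (proj₂ V₀) , :- proj₁ V₀ , con (+ 0)) V₀) (con (+ 0)) refl

-- A functional that kills `d` but not `y` witnesses that `y` is not a multiple of `d`.
cross≢origin : ∀ c d y → dot c d ≡ + 0 → dot c y ≢ + 0 → d ≢ origin → cross d y ≢ origin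
cross≢origin c d y cd cy d≢0 eq = d≢0 (scale≡origin (dot c y) d cy (begin
  scale (dot c y) d                         ≡⟨ triple-product c y d ⟩
  scale (dot c d) y ⊕ cross c (cross d y)   ≡⟨ cong₂ (λ k w → scale k y ⊕ cross c w) cd eq ⟩
  scale (+ 0) y ⊕ cross c origin            ≡⟨ proveᵥ (c ▸ y ▸ []) (scale′ (con (+ 0)) V₁ ⊕′ cross′ V₀ origin′) origin′ refl refl
    refl ⟩
  origin ∎))
  where open ≡-Reasoning

record FourVertices (L : List Pt) : Set where
  field
    v₁ v₂ v₃ v₄ : Pt
    vertex₁ : Vertex L v₁
    vertex₂ : Vertex L v₂
    vertex₃ : Vertex L v₃
    vertex₄ : Vertex L v₄
    distinct : Unique (v₁ ∷ v₂ ∷ v₃ ∷ v₄ ∷ [])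

module _ {L : List Pt} (spatial : Spatial L) where

  opaque
    vertex-off-plane : ∀ n → n ≢ origin → ∀ v → Σ Pt λ w → Vertex L w × dot n w ≢ dot n v
    vertex-off-plane n n≢0 v = let (x , x∈ , nx) = spatial n n≢0 (dot n v) in vertex-off n (dot n v) L x∈ nx

  opaque
    vertex-off-line : ∀ v w → w ⊖ v ≢ origin → Σ Pt λ x → Vertex L x × cross (w ⊖ v) (x ⊖ v) ≢ origin
    vertex-off-line v w w≢v with perpendicular (w ⊖ v) w≢v
    ... | c , c≢0 , cd with vertex-off-plane c c≢0 v
    ... | x , vertex , cx = x , vertex , cross≢origin c (w ⊖ v) (x ⊖ v) cd
      (λ eq → cx (ℤₚ.i-j≡0⇒i≡j (dot c x) (dot c v) (trans (sym (dot-⊖ c x v)) eq))) w≢v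

  private
    cross-self : ∀ x → cross x x ≡ origin
    cross-self x = proveᵥ (x ▸ []) (cross′ V₀ V₀) origin′ refl refl refl

    cross-⊖-self : ∀ d v → cross d (v ⊖ v) ≡ origin
    cross-⊖-self d v = proveᵥ (d ▸ v ▸ []) (cross′ V₀ (V₁ ⊖′ V₁)) origin′ refl refl refl

    det-second : ∀ v w x → dot (cross (w ⊖ v) (x ⊖ v)) w ≡ dot (cross (w ⊖ v) (x ⊖ v)) v
    det-second v w x = prove (v ▸ w ▸ x ▸ []) (dot′ (cross′ (V₁ ⊖′ V₀) (V₂ ⊖′ V₀)) V₁) (dot′ (cross′ (V₁ ⊖′ V₀) (V₂ ⊖′ V₀)) V₀)
      refl

    det-third : ∀ v w x → dot (cross (w ⊖ v) (x ⊖ v)) x ≡ dot (cross (w ⊖ v) (x ⊖ v)) v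
    det-third v w x = prove (v ▸ w ▸ x ▸ []) (dot′ (cross′ (V₁ ⊖′ V₀) (V₂ ⊖′ V₀)) V₂) (dot′ (cross′ (V₁ ⊖′ V₀) (V₂ ⊖′ V₀)) V₀)
      refl

    distinct-four : ∀ v₁ v₂ v₃ v₄ → v₂ ⊖ v₁ ≢ origin → cross (v₂ ⊖ v₁) (v₃ ⊖ v₁) ≢ origin →
      dot (cross (v₂ ⊖ v₁) (v₃ ⊖ v₁)) v₄ ≢ dot (cross (v₂ ⊖ v₁) (v₃ ⊖ v₁)) v₁ → Unique (v₁ ∷ v₂ ∷ v₃ ∷ v₄ ∷ [])
    distinct-four v₁ v₂ v₃ v₄ v₂≢ v₃≢ v₄≢ =
      ((λ { refl → v₂≢ (⊖-inverse v₁) }) ∷ (λ { refl → v₃≢ (cross-⊖-self (v₂ ⊖ v₁) v₁) }) ∷ (λ { refl → v₄≢ refl }) ∷ [])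
      ∷ ((λ { refl → v₃≢ (cross-self (v₂ ⊖ v₁)) }) ∷ (λ { refl → v₄≢ (det-second v₁ v₂ v₃) }) ∷ [])
      ∷ ((λ { refl → v₄≢ (det-third v₁ v₂ v₃) }) ∷ []) ∷ [] ∷ []

  opaque
    -- Each vertex is chosen outside the affine hull of the earlier ones, which exists because `L`
    -- is in no plane. The zero functional provides an arbitrary first vertex.
    four-vertices : FourVertices L
    four-vertices with spatial axis₁ (λ ()) (+ 0)
    ... | x , x∈ , _ with max-vertex origin L x∈
    ... | v₁ , vertex₁ , _ with vertex-off-plane axis₁ (λ ()) v₁
    ... | v₂ , vertex₂ , v₂≢ with vertex-off-line v₁ v₂ (λ eq → v₂≢ (cong (dot axis₁) (⊖≡origin v₂ v₁ eq)))
    ... | v₃ , vertex₃ , v₃≢ with vertex-off-plane (cross (v₂ ⊖ v₁) (v₃ ⊖ v₁)) v₃≢ v₁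
    ... | v₄ , vertex₄ , v₄≢ = record
      { v₁ = v₁ ; v₂ = v₂ ; v₃ = v₃ ; v₄ = v₄
      ; vertex₁ = vertex₁ ; vertex₂ = vertex₂ ; vertex₃ = vertex₃ ; vertex₄ = vertex₄
      ; distinct = distinct-four v₁ v₂ v₃ v₄ (λ eq → v₂≢ (cong (dot axis₁) (⊖≡origin v₂ v₁ eq))) v₃≢ v₄≢ }

-- Merging

Flat : List Pt → Pt → Set
Flat xs a = ∀ {x y} → x ∈ xs → y ∈ xs → dot a x - dot a y ℤ.≤ + 1

Planar : List Pt → Set
Planar xs = ∀ {p q r s} → p ∈ xs → q ∈ xs → r ∈ xs → s ∈ xs → det3 (q ⊖ p) (r ⊖ p) (s ⊖ p) ≡ + 0

Wide : List Pt → Set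
Wide xs = ∀ a → a ≢ origin → ¬ Flat xs a

-- For two vertices with wide remainders, failure to be merged refutes four affinely independent
-- points in what is left. The doubly negated form can be fed a continuation, since it is always
-- applied on the way to a contradiction.
Unmerged : List Pt → Set
Unmerged L = ∀ {u v} → Vertex L u → Vertex L v → u ≢ v → Wide (L ∖ u) → Wide (L ∖ v) → ¬ ¬ Planar (L ∖ u ∖ v)

det3-dot : ∀ a b c → dot (cross a b) c ≡ det3 a b c
det3-dot a b c = prove (a ▸ b ▸ c ▸ []) (dot′ (cross′ V₀ V₁) V₂) (det3′ V₀ V₁ V₂) refl

dot-⊖≡0 : ∀ n x p → dot n (x ⊖ p) ≡ + 0 → dot n x ≡ dot n p
dot-⊖≡0 n x p eq = ℤₚ.i-j≡0⇒i≡j (dot n x) (dot n p) (trans (sym (dot-⊖ n x p)) eq)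

dot≡⇒⊖ : ∀ n x p → dot n x ≡ dot n p → dot n (x ⊖ p) ≡ + 0
dot≡⇒⊖ n x p eq = trans (dot-⊖ n x p) (trans (cong (_- dot n p) eq) (ℤₚ.+-inverseʳ (dot n p)))

Triangle : List Pt → Pt → Pt → Pt → Set
Triangle L u v w = Σ Pt λ p → Σ Pt λ q → Σ Pt λ r → (p ∈ L ∖ u ∖ v ∖ w) × (q ∈ L ∖ u ∖ v ∖ w) × (r ∈ L ∖ u ∖ v ∖ w) ×
  cross (q ⊖ p) (r ⊖ p) ≢ origin

∖-⊆ : ∀ {x} xs u → x ∈ xs ∖ u → x ∈ xs
∖-⊆ xs u x∈ = proj₁ (∈-∖⁻ xs x∈)

∈-∖∖ : ∀ {x u v L} → x ∈ L → x ≢ u → x ≢ v → x ∈ L ∖ u ∖ v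
∈-∖∖ x∈ x≢u x≢v = ∈-∖⁺ (∈-∖⁺ x∈ x≢u) x≢v

∈-∖∖∖⁻ : ∀ {x} L u v w → x ∈ L ∖ u ∖ v ∖ w → x ∈ L × x ≢ u × x ≢ v × x ≢ w
∈-∖∖∖⁻ L u v w x∈ with ∈-∖⁻ (L ∖ u ∖ v) x∈
... | x∈₁ , x≢w with ∈-∖⁻ (L ∖ u) x∈₁
... | x∈₂ , x≢v with ∈-∖⁻ L x∈₂
... | x∈L , x≢u = x∈L , x≢u , x≢v , x≢w

-- The counting argument is isolated behind `bad-pair` and `triangle` because two situations supply
-- them: no two points congruent modulo 3, and a long line with at least four points off it.
module _ {L : List Pt} (spatial : Spatial L) (unmerged : Unmerged L)
  (bad-pair : ∀ {u v} → Vertex L u → Vertex L v → u ≢ v → ∀ a b → a ≢ origin → b ≢ origin → Flat (L ∖ u) a → ¬ Flat (L ∖ v) b)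
  (triangle : ∀ {u v w} → Vertex L u → Vertex L v → Vertex L w → Triangle L u v w) where

  -- If L minus any two of u, v, w is planar, these planes agree on L minus all three, hence L is planar.
  private
    not-three-wide : ∀ {u v w} → Vertex L u → Vertex L v → Vertex L w → u ≢ v → u ≢ w → v ≢ w →
      Wide (L ∖ u) → Wide (L ∖ v) → Wide (L ∖ w) → ⊥
    not-three-wide {u} {v} {w} vu vv vw u≢v u≢w v≢w wu wv ww =
      unmerged vu vv u≢v wu wv λ uv → unmerged vu vw u≢w wu ww λ uw → unmerged vv vw v≢w wv ww λ vw′ → planar uv uw vw′
      where
      planar : Planar (L ∖ u ∖ v) → Planar (L ∖ u ∖ w) → Planar (L ∖ v ∖ w) → ⊥
      planar uv uw vw′ with triangle vu vv vw
      ... | p , q , r , p∈ , q∈ , r∈ , n≢0 with ∈-∖∖∖⁻ L u v w p∈ | ∈-∖∖∖⁻ L u v w q∈ | ∈-∖∖∖⁻ L u v w r∈ | spatial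
        (cross (q ⊖ p) (r ⊖ p)) n≢0 (dot (cross (q ⊖ p) (r ⊖ p)) p)
      ... | p∈L , p≢u , p≢v , p≢w | q∈L , q≢u , q≢v , q≢w | r∈L , r≢u , r≢v , r≢w | x , x∈ , nx = nx
        (dot-⊖≡0 (cross (q ⊖ p) (r ⊖ p)) x p
          (trans (det3-dot (q ⊖ p) (r ⊖ p) (x ⊖ p)) det≡0))
        where
        det≡0 : det3 (q ⊖ p) (r ⊖ p) (x ⊖ p) ≡ + 0
        det≡0 with x ≟ₚ u | x ≟ₚ v
        ... | yes refl | _ = vw′ (∈-∖∖ p∈L p≢v p≢w) (∈-∖∖ q∈L q≢v q≢w) (∈-∖∖ r∈L r≢v r≢w) (∈-∖∖ x∈ u≢v u≢w)
        ... | no x≢u | yes refl = uw (∈-∖∖ p∈L p≢u p≢w) (∈-∖∖ q∈L q≢u q≢w) (∈-∖∖ r∈L r≢u r≢w) (∈-∖∖ x∈ x≢u v≢w)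
        ... | no x≢u | no x≢v = uv (∈-∖∖ p∈L p≢u p≢v) (∈-∖∖ q∈L q≢u q≢v) (∈-∖∖ r∈L r≢u r≢v) (∈-∖∖ x∈ x≢u x≢v)

  -- At most one of four vertices leaves a flat configuration when removed.
  always-merged : ⊥
  always-merged with four-vertices spatial
  ... | record { v₁ = v₁ ; v₂ = v₂ ; v₃ = v₃ ; v₄ = v₄ ; vertex₁ = a₁ ; vertex₂ = a₂ ; vertex₃ = a₃ ; vertex₄ = a₄
               ; distinct = (≢₁₂ ∷ ≢₁₃ ∷ ≢₁₄ ∷ []) ∷ (≢₂₃ ∷ ≢₂₄ ∷ []) ∷ (≢₃₄ ∷ []) ∷ [] ∷ [] } =
    not-three-wide a₁ a₂ a₃ ≢₁₂ ≢₁₃ ≢₂₃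
      (λ a a≢0 flat → not-three-wide a₂ a₃ a₄ ≢₂₃ ≢₂₄ ≢₃₄ (other a₁ a₂ ≢₁₂ a≢0 flat) (other a₁ a₃ ≢₁₃ a≢0 flat)
        (other a₁ a₄ ≢₁₄ a≢0 flat))
      (λ a a≢0 flat → not-three-wide a₁ a₃ a₄ ≢₁₃ ≢₁₄ ≢₃₄ (other a₂ a₁ (λ eq → ≢₁₂ (sym eq)) a≢0 flat) (other a₂ a₃ ≢₂₃ a≢0 flat)
        (other a₂ a₄ ≢₂₄ a≢0 flat))
      (λ a a≢0 flat → not-three-wide a₁ a₂ a₄ ≢₁₂ ≢₁₄ ≢₂₄ (other a₃ a₁ (λ eq → ≢₁₃ (sym eq)) a≢0 flat)
        (other a₃ a₂ (λ eq → ≢₂₃ (sym eq)) a≢0 flat) (other a₃ a₄ ≢₃₄ a≢0 flat))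
    where
    other : ∀ {u v} → Vertex L u → Vertex L v → u ≢ v → ∀ {a} → a ≢ origin → Flat (L ∖ u) a → Wide (L ∖ v)
    other vu vv u≢v {a} a≢0 flat b b≢0 = bad-pair vu vv u≢v a b a≢0 b≢0 flat

module _ {L : List Pt} (convex : Convex (_∈ L)) (free : UnimodularFree (_∈ L)) where

  -- `level-one` wants a primitive edge vector inside the set. With `p` moved to the origin, the
  -- first lattice point on the way to `q` provides it, by convexity.
  adjacent-slices : ∀ a {p q r x} → p ∈ L → q ∈ L → r ∈ L → x ∈ L → dot a q ≡ dot a p → dot a r ≡ dot a p →
    cross (q ⊖ p) (r ⊖ p) ≢ origin → ∣ dot a x - dot a p ∣ ≢ 1
  adjacent-slices a {p} {q} {r} {x} p∈ q∈ r∈ x∈ aq ar n≢0 unit =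
    let (k , e , g , d≡ , ge) = primitive-part (q ⊖ p) q≢p in along-edge k e g d≡ ge
    where
    q≢p : q ⊖ p ≢ origin
    q≢p q⊖p≡0 = n≢0 (trans (cong (λ d → cross d (r ⊖ p)) q⊖p≡0) (proveᵥ (r ⊖ p ▸ []) (cross′ origin′ V₀) origin′ refl refl refl))
    M : PtSet
    M v = (p ⊕ v) ∈ L
    M-⊖ : ∀ y → y ∈ L → M (y ⊖ p)
    M-⊖ y y∈ = subst (_∈ L) (sym (⊕-⊖ p y)) y∈
    M0 : M origin
    M0 = subst (_∈ L) (sym (⊕-identityʳ p)) p∈
    along-edge : ∀ k e g → q ⊖ p ≡ scale (+ ℕ.suc k) e → dot g e ≡ + 1 → ⊥
    along-edge k e g d≡ ge = level-one {M} (translate-convex {_∈ L} p convex) (translate-free {_∈ L} p free) M0 {e} {g} Me ge a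
      {r ⊖ p} {x ⊖ p} ae
      (M-⊖ r r∈) (dot≡⇒⊖ a r p ar) off (M-⊖ x x∈) (trans (cong ∣_∣ (dot-⊖ a x p)) unit)
      where
      Me : M e
      Me = combine₂ {M} (translate-convex {_∈ L} p convex) k 1 {origin} {q ⊖ p} {e} M0 (M-⊖ q q∈)
        (subst (0 ℕ.<_) (ℕₚ.+-comm 1 k) (s≤s z≤n))
        (trans (cong₂ _⊕_ (scale-origin (+ k)) (trans (scale-one (q ⊖ p)) d≡))
          (proveᵥ (e ▸ + k ∷ []) (origin′ ⊕′ scale′ (con (+ 1) :+ ν 3) V₀) (scale′ (ν 3 :+ con (+ 1)) V₀) refl refl refl))
      ae : dot a e ≡ + 0
      ae = [ (λ ()) , (λ eq → eq) ]′ (ℤₚ.i*j≡0⇒i≡0∨j≡0 (+ ℕ.suc k) {dot a e}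
        (trans (sym (dot-scale a (+ ℕ.suc k) e)) (trans (cong (dot a) (sym d≡)) (dot≡⇒⊖ a q p aq))))
      off : cross e (r ⊖ p) ≢ origin
      off eq = n≢0 (trans (cong (λ d → cross d (r ⊖ p)) d≡) (trans
        (proveᵥ (e ▸ r ⊖ p ▸ + ℕ.suc k ∷ []) (cross′ (scale′ (ν 6) V₀) V₁) (scale′ (ν 6) (cross′ V₀ V₁)) refl refl refl)
        (trans (cong (scale (+ ℕ.suc k)) eq) (scale-origin (+ ℕ.suc k)))))

-- Configurations without four collinear points

lookup-distinct : ∀ {xs : List Pt} → Unique xs → ∀ i j → i Fin.< j → lookup xs i ≢ lookup xs j
lookup-distinct {x ∷ xs} (x≢ ∷ uniq) zero (suc j) _ = All.lookup x≢ (∈-lookup j)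
lookup-distinct {x ∷ xs} (_ ∷ uniq) (suc i) (suc j) (s≤s i<j) = lookup-distinct uniq i j i<j

length-split : ∀ {P : Pt → Set} (P? : ∀ x → Dec (P x)) xs →
  length xs ≡ length (filter P? xs) ℕ.+ length (filter (λ x → ¬? (P? x)) xs)
length-split P? [] = refl
length-split P? (x ∷ xs) with P? x
... | yes _ = cong ℕ.suc (length-split P? xs)
... | no _ = trans (cong ℕ.suc (length-split P? xs)) (sym (ℕₚ.+-suc (length (filter P? xs)) _))

unit-gap : ∀ s t → s - t ℤ.≤ + 1 → t - s ℤ.≤ + 1 → s ≡ t ⊎ ∣ s - t ∣ ≡ 1
unit-gap s t st ts = go (s - t) refl st (subst (ℤ._≤ + 1) (solve 2 (λ s t → t :- s := :- (s :- t)) refl s t) ts)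
  where
  go : ∀ z → s - t ≡ z → z ℤ.≤ + 1 → - z ℤ.≤ + 1 → s ≡ t ⊎ ∣ s - t ∣ ≡ 1
  go (+ 0) eq _ _ = inj₁ (ℤₚ.i-j≡0⇒i≡j s t eq)
  go (+ 1) eq _ _ = inj₂ (cong ∣_∣ eq)
  go (+ ℕ.suc (ℕ.suc _)) _ (ℤ.+≤+ (s≤s ())) _
  go -[1+ 0 ] eq _ _ = inj₂ (cong ∣_∣ eq)
  go -[1+ ℕ.suc _ ] _ _ (ℤ.+≤+ (s≤s ()))

-- Values on opposite sides of `c` would differ by two.
unit-gaps : ∀ s t c → ∣ s - c ∣ ≡ 1 → ∣ t - c ∣ ≡ 1 → s - t ℤ.≤ + 1 → t - s ℤ.≤ + 1 → s ≡ t
unit-gaps s t c sc tc st ts with ∣∣≡1 (s - c) sc | ∣∣≡1 (t - c) tc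
... | inj₁ p | inj₁ q = linear₁ {s} {t} {s - c} {t - c} (+ 1)
  (solve 3 (λ s t c → s :- t := con (+ 1) :* ((s :- c) :- (t :- c))) refl s t c) (trans p (sym q))
... | inj₂ p | inj₂ q = linear₁ {s} {t} {s - c} {t - c} (+ 1)
  (solve 3 (λ s t c → s :- t := con (+ 1) :* ((s :- c) :- (t :- c))) refl s t c) (trans p (sym q))
... | inj₁ p | inj₂ q = ⊥-elim (two≰one (subst (ℤ._≤ + 1)
  (trans (solve 3 (λ s t c → s :- t := (s :- c) :- (t :- c)) refl s t c) (cong₂ _-_ p q)) st))
  where
  two≰one : ¬ (+ 2 ℤ.≤ + 1)
  two≰one (ℤ.+≤+ (s≤s ()))
... | inj₂ p | inj₁ q = ⊥-elim (two≰one (subst (ℤ._≤ + 1)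
  (trans (solve 3 (λ s t c → t :- s := (t :- c) :- (s :- c)) refl s t c) (cong₂ _-_ q p)) ts))
  where
  two≰one : ¬ (+ 2 ℤ.≤ + 1)
  two≰one (ℤ.+≤+ (s≤s ()))

Congruent₃ : Pt → Pt → Set
Congruent₃ x y = Σ Pt λ z → x ≡ y ⊕ scale (+ 3) z

NonCollinear : List Pt → Set
NonCollinear xs = Σ Pt λ p → Σ Pt λ q → Σ Pt λ r → p ∈ xs × q ∈ xs × r ∈ xs × cross (q ⊖ p) (r ⊖ p) ≢ origin

module _ {L : List Pt} (distinct₃ : ∀ {x y} → x ∈ L → y ∈ L → Congruent₃ x y → x ≡ y) where

  -- Among four points of a line two are congruent modulo 3.
  private
    residue₃ : Pt → Pt → Pt → Fin 3
    residue₃ p g r = Fin.fromℕ< (n%ℕd<d (dot g (r ⊖ p)) 3)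

    same-residue : ∀ p g e r s → r ≡ p ⊕ scale (dot g (r ⊖ p)) e → s ≡ p ⊕ scale (dot g (s ⊖ p)) e →
      residue₃ p g r ≡ residue₃ p g s → Congruent₃ r s
    same-residue p g e r s r≡ s≡ eq = scale (i /ℕ 3 - j /ℕ 3) e , (begin
        r                                                      ≡⟨ r≡ ⟩
        p ⊕ scale i e                                          ≡⟨ cong (λ k → p ⊕ scale k e) i≡ ⟩
        p ⊕ scale (j + + 3 * (i /ℕ 3 - j /ℕ 3)) e
          ≡⟨ proveᵥ (p ▸ e ▸ j ∷ i /ℕ 3 - j /ℕ 3 ∷ []) (V₀ ⊕′ scale′ (ν 6 :+ con (+ 3) :* ν 7) V₁)
               ((V₀ ⊕′ scale′ (ν 6) V₁) ⊕′ scale′ (con (+ 3)) (scale′ (ν 7) V₁)) refl refl refl ⟩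
        (p ⊕ scale j e) ⊕ scale (+ 3) (scale (i /ℕ 3 - j /ℕ 3) e) ≡⟨ cong (_⊕ scale (+ 3) (scale (i /ℕ 3 - j /ℕ 3) e)) (sym s≡) ⟩
        s ⊕ scale (+ 3) (scale (i /ℕ 3 - j /ℕ 3) e)            ∎)
      where
      open ≡-Reasoning
      i j : ℤ
      i = dot g (r ⊖ p)
      j = dot g (s ⊖ p)
      m≡n : i %ℕ 3 ≡ j %ℕ 3
      m≡n = trans (sym (Finₚ.toℕ-fromℕ< (n%ℕd<d i 3))) (trans (cong Fin.toℕ eq) (Finₚ.toℕ-fromℕ< (n%ℕd<d j 3)))
      i≡ : i ≡ j + + 3 * (i /ℕ 3 - j /ℕ 3)
      i≡ = begin
        i                                            ≡⟨ a≡a%ℕn+[a/ℕn]*n i 3 ⟩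
        + (i %ℕ 3) + i /ℕ 3 * + 3                    ≡⟨ cong (λ n → + n + i /ℕ 3 * + 3) m≡n ⟩
        + (j %ℕ 3) + i /ℕ 3 * + 3
          ≡⟨ solve 3 (λ m a b → m :+ a :* con (+ 3) := (m :+ b :* con (+ 3)) :+ con (+ 3) :* (a :- b)) refl (+ (j %ℕ 3)) (i /ℕ 3)
            (j /ℕ 3) ⟩
        (+ (j %ℕ 3) + j /ℕ 3 * + 3) + + 3 * (i /ℕ 3 - j /ℕ 3) ≡⟨ cong (_+ + 3 * (i /ℕ 3 - j /ℕ 3)) (sym (a≡a%ℕn+[a/ℕn]*n j 3)) ⟩
        j + + 3 * (i /ℕ 3 - j /ℕ 3)                  ∎

    collinear-few : ∀ {xs} → Unique xs → (∀ {x} → x ∈ xs → x ∈ L) → 4 ℕ.≤ length xs → ∀ p d → d ≢ origin →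
      ¬ (∀ {r} → r ∈ xs → cross d (r ⊖ p) ≡ origin)
    collinear-few {xs} uniq ⊆L four p d d≢0 collinear =
      let (k , e , g , d≡ , ge) = primitive-part d d≢0
          (i , j , i<j , eq) = Finₚ.pigeonhole {3} {length xs} four (λ i → residue₃ p g (lookup xs i))
      in lookup-distinct uniq i j i<j (distinct₃ (⊆L (∈-lookup i)) (⊆L (∈-lookup j))
           (same-residue p g e (lookup xs i) (lookup xs j)
             (on-line k e g d≡ ge (lookup xs i) (collinear (∈-lookup i)))
               (on-line k e g d≡ ge (lookup xs j) (collinear (∈-lookup j))) eq))
      where
      on-line : ∀ k e g → d ≡ scale (+ ℕ.suc k) e → dot g e ≡ + 1 → ∀ r → cross d (r ⊖ p) ≡ origin → r ≡ p ⊕ scale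
        (dot g (r ⊖ p)) e
      on-line k e g d≡ ge r eq = trans (sym (⊕-⊖ p r)) (cong (p ⊕_) (trans (along g e (r ⊖ p) ge)
        (trans (cong (λ w → scale (dot g (r ⊖ p)) e ⊕ cross g w) parallel)
          (proveᵥ (scale (dot g (r ⊖ p)) e ▸ g ▸ []) (V₀ ⊕′ cross′ V₁ origin′) V₀ refl refl refl))))
        where
        parallel : cross (r ⊖ p) e ≡ origin
        parallel = scale≡origin (- + ℕ.suc k) (cross (r ⊖ p) e) (λ ()) (trans
          (proveᵥ (r ⊖ p ▸ e ▸ + ℕ.suc k ∷ []) (scale′ (:- ν 6) (cross′ V₀ V₁)) (cross′ (scale′ (ν 6) V₁) V₀) refl refl refl)
          (trans (cong (λ w → cross w (r ⊖ p)) (sym d≡)) eq))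

  opaque
    non-collinear : ∀ {xs} → Unique xs → (∀ {x} → x ∈ xs → x ∈ L) → 4 ℕ.≤ length xs → NonCollinear xs
    non-collinear {p ∷ q ∷ xs} uniq@((p≢q ∷ _) ∷ _) ⊆L four
      with any? (λ r → ¬? (cross (q ⊖ p) (r ⊖ p) ≟ₚ origin)) (p ∷ q ∷ xs)
    ... | yes some = let (r , r∈ , ne) = find some in p , q , r , here refl , there (here refl) , r∈ , ne
    ... | no none = ⊥-elim (collinear-few uniq ⊆L four p (q ⊖ p) (λ eq → p≢q (sym (⊖≡origin q p eq))) all)
      where
      all : ∀ {r} → r ∈ p ∷ q ∷ xs → cross (q ⊖ p) (r ⊖ p) ≡ origin
      all {r} r∈ with cross (q ⊖ p) (r ⊖ p) ≟ₚ origin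
      ... | yes eq = eq
      ... | no ne = ⊥-elim (none (lose r∈ ne))
    non-collinear {[]} _ _ ()
    non-collinear {_ ∷ []} _ _ (s≤s ())

  module _ (uniqL : Unique L) (convex : Convex (_∈ L)) (free : UnimodularFree (_∈ L)) (eight : 8 ℕ.≤ length L) where

    private
      seven : ∀ u → 7 ℕ.≤ length (L ∖ u)
      seven u = ℕ.s≤s⁻¹ (ℕₚ.≤-trans eight (length-∖ u uniqL))

      six : ∀ u v → 6 ℕ.≤ length (L ∖ u ∖ v)
      six u v = ℕ.s≤s⁻¹ (ℕₚ.≤-trans (seven u) (length-∖ v (Unique-∖ u uniqL)))

      five : ∀ u v w → 5 ℕ.≤ length (L ∖ u ∖ v ∖ w)
      five u v w = ℕ.s≤s⁻¹ (ℕₚ.≤-trans (six u v) (length-∖ w (Unique-∖ v (Unique-∖ u uniqL))))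

    -- One of two consecutive slices contains four points, hence the other one is empty.
    flat⇒level : ∀ u a → Flat (L ∖ u) a → Σ ℤ λ t → ∀ {x} → x ∈ L ∖ u → dot a x ≡ t
    flat⇒level u a flat = from-first (L ∖ u) (seven u) (∖-⊆ L u) (Unique-∖ u uniqL) flat
      where
      from-slice : ∀ {xs} ys t → 4 ℕ.≤ length ys → Unique ys → (∀ {x} → x ∈ ys → x ∈ xs × dot a x ≡ t) →
        (∀ {x} → x ∈ xs → x ∈ L) → Flat xs a → ∀ {x} → x ∈ xs → dot a x ≡ t
      from-slice {xs} ys t four uniq ys⊆ xs⊆ flat {x} x∈ =
        let (p , q , r , p∈ , q∈ , r∈ , n≢0) = non-collinear uniq (λ y∈ → xs⊆ (proj₁ (ys⊆ y∈))) four
            (p∈xs , ap) = ys⊆ p∈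
            (q∈xs , aq) = ys⊆ q∈
            (r∈xs , ar) = ys⊆ r∈
        in [ (λ eq → trans eq ap) , (λ unit → ⊥-elim (adjacent-slices convex free a (xs⊆ p∈xs) (xs⊆ q∈xs) (xs⊆ r∈xs) (xs⊆ x∈)
               (trans aq (sym ap)) (trans ar (sym ap)) n≢0 unit)) ]′
           (unit-gap (dot a x) (dot a p) (flat x∈ p∈xs) (flat p∈xs x∈))
      from-first : ∀ xs → 7 ℕ.≤ length xs → (∀ {x} → x ∈ xs → x ∈ L) → Unique xs → Flat xs a → Σ ℤ λ t → ∀ {x} → x ∈ xs → dot a x
        ≡ t
      from-first xs@(x₀ ∷ _) len xs⊆ uniq flat = [ at-first , off-first ]′
        (large (ℕₚ.≤-trans len (ℕₚ.≤-reflexive (length-split P? xs))))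
        where
        P? : ∀ x → Dec (dot a x ≡ dot a x₀)
        P? x = dot a x ≟ dot a x₀
        Q? : ∀ x → Dec (¬ (dot a x ≡ dot a x₀))
        Q? x = ¬? (P? x)
        -- Here eight points are used: seven remain after a removal, and two slices with at most
        -- three points each hold only six.
        large : ∀ {m n} → 7 ℕ.≤ m ℕ.+ n → (4 ℕ.≤ m) ⊎ (4 ℕ.≤ n)
        large {m} {n} 7≤ with 4 ℕ.≤? m
        ... | yes 4≤m = inj₁ 4≤m
        ... | no 4≰m = inj₂ (ℕₚ.+-cancelˡ-≤ 3 4 n (ℕₚ.≤-trans 7≤ (ℕₚ.+-monoˡ-≤ n (ℕ.s≤s⁻¹ (ℕₚ.≰⇒> 4≰m)))))
        at-first : 4 ℕ.≤ length (filter P? xs) → Σ ℤ λ t → ∀ {x} → x ∈ xs → dot a x ≡ t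
        at-first four = dot a x₀ , from-slice (filter P? xs) (dot a x₀) four (Uniqueₚ.filter⁺ P? uniq) (∈-filter⁻ P? {xs = xs})
          xs⊆ flat
        gap : ∀ {x y} → x ∈ xs → y ∈ xs → dot a x ≢ dot a y → ∣ dot a x - dot a y ∣ ≡ 1
        gap {x} {y} x∈ y∈ ne = [ (λ eq → ⊥-elim (ne eq)) , (λ unit → unit) ]′
          (unit-gap (dot a x) (dot a y) (flat x∈ y∈) (flat y∈ x∈))
        off-first : 4 ℕ.≤ length (filter Q? xs) → Σ ℤ λ t → ∀ {x} → x ∈ xs → dot a x ≡ t
        off-first four with filter Q? xs in eq
        off-first four | y₀ ∷ ys = dot a y₀ , from-slice (y₀ ∷ ys) (dot a y₀) four (subst Unique eq (Uniqueₚ.filter⁺ Q? uniq))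
          (λ y∈ → proj₁ (member y∈) , same y∈ (here refl)) xs⊆ flat
          where
          member : ∀ {y} → y ∈ y₀ ∷ ys → y ∈ xs × dot a y ≢ dot a x₀
          member y∈ = ∈-filter⁻ Q? {xs = xs} (subst (_ ∈_) (sym eq) y∈)
          same : ∀ {y z} → y ∈ y₀ ∷ ys → z ∈ y₀ ∷ ys → dot a y ≡ dot a z
          same {y} {z} y∈ z∈ = let (y∈xs , y≢) = member y∈ ; (z∈xs , z≢) = member z∈ in
            unit-gaps (dot a y) (dot a z) (dot a x₀) (gap y∈xs (here refl) y≢) (gap z∈xs (here refl) z≢) (flat y∈xs z∈xs)
              (flat z∈xs y∈xs)

    no-short-lines : Spatial L → ¬ Unmerged L
    no-short-lines spatial unmerged = always-merged spatial unmerged bad-pair triangle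
      where
      triangle : ∀ {u v w} → Vertex L u → Vertex L v → Vertex L w → Triangle L u v w
      triangle {u} {v} {w} _ _ _ = non-collinear (Unique-∖ w (Unique-∖ v (Unique-∖ u uniqL)))
        (λ x∈ → proj₁ (∈-∖∖∖⁻ L u v w x∈)) (ℕₚ.≤-trans (ℕₚ.n≤1+n 4) (five u v w))
      -- All of `L` but `u` lies in one plane and all but `v` in another. Three non-collinear common
      -- points identify the two planes, and then `L` would be planar.
      bad-pair : ∀ {u v} → Vertex L u → Vertex L v → u ≢ v → ∀ a b → a ≢ origin → b ≢ origin → Flat (L ∖ u) a → ¬ Flat (L ∖ v) b
      bad-pair {u} {v} _ _ u≢v a b a≢0 b≢0 flatᵤ flatᵥ =
        let (s , level-a) = flat⇒level u a flatᵤ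
            (t , level-b) = flat⇒level v b flatᵥ
            (p , q , r , p∈ , q∈ , r∈ , n≢0) = non-collinear (Unique-∖ v (Unique-∖ u uniqL)) (λ x∈ → ∖-⊆ L u (∖-⊆ (L ∖ u) v x∈))
              (ℕₚ.≤-trans (ℕₚ.m≤n+m 4 2) (six u v))
            (x , x∈ , nx) = spatial (cross (q ⊖ p) (r ⊖ p)) n≢0 (dot (cross (q ⊖ p) (r ⊖ p)) p)
        in nx (dot-⊖≡0 (cross (q ⊖ p) (r ⊖ p)) x p (trans (det3-dot (q ⊖ p) (r ⊖ p) (x ⊖ p))
             (det≡0 s level-a t level-b p q r x p∈ q∈ r∈ x∈)))
        where
        in-plane : ∀ c t p y → dot c y ≡ t → dot c p ≡ t → dot c (y ⊖ p) ≡ + 0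
        in-plane c t p y cy cp = dot≡⇒⊖ c y p (trans cy (sym cp))
        det≡0 : ∀ s → (∀ {x} → x ∈ L ∖ u → dot a x ≡ s) → ∀ t → (∀ {x} → x ∈ L ∖ v → dot b x ≡ t) → ∀ p q r x →
          p ∈ L ∖ u ∖ v → q ∈ L ∖ u ∖ v → r ∈ L ∖ u ∖ v → x ∈ L → det3 (q ⊖ p) (r ⊖ p) (x ⊖ p) ≡ + 0
        det≡0 s level-a t level-b p q r x p∈ q∈ r∈ x∈ with x ≟ₚ u
        ... | no x≢u = coplanar (q ⊖ p) (r ⊖ p) (x ⊖ p) a a≢0 (in-plane a s p q (at q∈) (at p∈))
          (in-plane a s p r (at r∈) (at p∈))
            (in-plane a s p x (level-a (∈-∖⁺ x∈ x≢u)) (at p∈))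
          where
          at : ∀ {y} → y ∈ L ∖ u ∖ v → dot a y ≡ s
          at y∈ = level-a (∖-⊆ (L ∖ u) v y∈)
        ... | yes refl = coplanar (q ⊖ p) (r ⊖ p) (x ⊖ p) b b≢0 (in-plane b t p q (at q∈) (at p∈))
          (in-plane b t p r (at r∈) (at p∈))
            (in-plane b t p x (level-b (∈-∖⁺ x∈ u≢v)) (at p∈))
          where
          at : ∀ {y} → y ∈ L ∖ u ∖ v → dot b y ≡ t
          at y∈ = level-b (let (y∈₁ , y≢v) = ∈-∖⁻ (L ∖ u) y∈ in ∈-∖⁺ (∖-⊆ L u y∈₁) y≢v)

-- Configurations with four collinear points

double-small : ∀ z → + 2 * z ℤ.≤ + 1 → - (+ 2 * z) ℤ.≤ + 1 → z ≡ + 0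
double-small (+ 0) _ _ = refl
double-small (+ ℕ.suc n) (ℤ.+≤+ (s≤s le)) _ = ⊥-elim (ℕₚ.n≮0 (subst (ℕ._≤ 0) (ℕₚ.+-suc n (n ℕ.+ 0)) le))
double-small -[1+ n ] _ (ℤ.+≤+ (s≤s le)) = ⊥-elim (ℕₚ.n≮0 (subst (ℕ._≤ 0) (ℕₚ.+-suc n (n ℕ.+ 0)) le))

-- The complete section of `L` with one lattice line: `line` excludes points beyond the two ends, so
-- only these ends can be vertices on the line. `g` is the height along `e`.
record Frame (L : List Pt) : Set where
  field
    o e g : Pt
    K : ℕ
    ge : dot g e ≡ + 1
    long : 3 ℕ.≤ K
    on : ∀ j → j ℕ.≤ K → (o ⊕ scale (+ j) e) ∈ L
    line : ∀ {x} → x ∈ L → cross e (x ⊖ o) ≡ origin → Σ ℕ λ j → j ℕ.≤ K × x ≡ o ⊕ scale (+ j) e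

module Framed {L : List Pt} (F : Frame L) (convex : Convex (_∈ L)) (free : UnimodularFree (_∈ L))
  (spatial : Spatial L) (wide : Wide L) (unmerged : Unmerged L) where
  open Frame F

  P : ℕ → Pt
  P j = o ⊕ scale (+ j) e

  Off : Pt → Set
  Off x = cross e (x ⊖ o) ≢ origin

  off? : ∀ x → Dec (Off x)
  off? x = ¬? (cross e (x ⊖ o) ≟ₚ origin)

  off-or-on : ∀ x → Off x ⊎ cross e (x ⊖ o) ≡ origin
  off-or-on x with cross e (x ⊖ o) ≟ₚ origin
  ... | yes eq = inj₂ eq
  ... | no ne = inj₁ ne

  dot-P : ∀ a j → dot a (P j) ≡ dot a o + + j * dot a e
  dot-P a j = trans (dot-⊕ a o (scale (+ j) e)) (cong (λ k → dot a o + k) (dot-scale a (+ j) e))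

  dot-P₀ : ∀ a j → dot a e ≡ + 0 → dot a (P j) ≡ dot a o
  dot-P₀ a j ae = trans (dot-P a j) (trans (cong (λ k → dot a o + + j * k) ae)
    (trans (cong (λ k → dot a o + k) (ℤₚ.*-zeroʳ (+ j))) (ℤₚ.+-identityʳ (dot a o))))

  P-injective : ∀ i j → P i ≡ P j → i ≡ j
  P-injective i j eq = ℤₚ.+-injective (begin
    + i                  ≡⟨ height i ⟩
    dot g (P i) - dot g o ≡⟨ cong (λ x → dot g x - dot g o) eq ⟩
    dot g (P j) - dot g o ≡⟨ sym (height j) ⟩
    + j ∎)
    where
    open ≡-Reasoning
    height : ∀ i → + i ≡ dot g (P i) - dot g o
    height i = sym (trans (cong (_- dot g o) (trans (dot-P g i) (cong (λ k → dot g o + + i * k) ge)))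
      (solve 2 (λ x i → x :+ i :* con (+ 1) :- x := i) refl (dot g o) (+ i)))

  ≤K : ∀ {j} → j ℕ.≤ 3 → j ℕ.≤ K
  ≤K j≤3 = ℕₚ.≤-trans j≤3 long

  P∈ : ∀ j → j ℕ.≤ 3 → P j ∈ L
  P∈ j j≤3 = on j (≤K j≤3)

  P-on : ∀ j → cross e (P j ⊖ o) ≡ origin
  P-on j = proveᵥ (o ▸ e ▸ + j ∷ []) (cross′ V₁ ((V₀ ⊕′ scale′ (ν 6) V₁) ⊖′ V₀)) origin′ refl refl refl

  o∈ : o ∈ L
  o∈ = subst (_∈ L) (⊕-identityʳ o) (on 0 z≤n)

  P0≡o : P 0 ≡ o
  P0≡o = ⊕-identityʳ o

  off≢P : ∀ {u} → Off u → ∀ j → P j ≢ u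
  off≢P off j refl = off (P-on j)

  not-in-plane : ∀ n → n ≢ origin → ¬ (∀ {x} → x ∈ L → dot n (x ⊖ o) ≡ + 0)
  not-in-plane n n≢0 flat = let (x , x∈ , nx) = spatial n n≢0 (dot n o) in nx (dot-⊖≡0 n x o (flat x∈))

  private
    gap-two : ∀ u a → Flat (L ∖ u) a → ∀ j → P j ∈ L ∖ u → P (2 ℕ.+ j) ∈ L ∖ u → dot a e ≡ + 0
    gap-two u a flat j j∈ k∈ = double-small (dot a e) (subst (ℤ._≤ + 1) up (flat k∈ j∈)) (subst (ℤ._≤ + 1) down (flat j∈ k∈))
      where
      up : dot a (P (2 ℕ.+ j)) - dot a (P j) ≡ + 2 * dot a e
      up = trans (cong₂ _-_ (dot-P a (2 ℕ.+ j)) (dot-P a j))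
        (solve 3 (λ x j d → x :+ (con (+ 2) :+ j) :* d :- (x :+ j :* d) := con (+ 2) :* d) refl (dot a o) (+ j) (dot a e))
      down : dot a (P j) - dot a (P (2 ℕ.+ j)) ≡ - (+ 2 * dot a e)
      down = trans (cong₂ _-_ (dot-P a j) (dot-P a (2 ℕ.+ j)))
        (solve 3 (λ x j d → x :+ j :* d :- (x :+ (con (+ 2) :+ j) :* d) := :- (con (+ 2) :* d)) refl (dot a o) (+ j) (dot a e))

    P-avoids : ∀ i j {u} → i ≢ j → P j ≡ u → P i ≢ u
    P-avoids i j i≢j eq eq′ = i≢j (P-injective i j (trans eq′ (sym eq)))

  -- Of `P 0`, ..., `P 3` some pair at distance two avoids `u`. Hence `2 * dot a e` lies between -1
  -- and 1.
  flat⇒e : ∀ u a → Flat (L ∖ u) a → dot a e ≡ + 0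
  flat⇒e u a flat with P 0 ≟ₚ u | P 2 ≟ₚ u
  ... | no 0≢ | no 2≢ = gap-two u a flat 0 (∈-∖⁺ (P∈ 0 z≤n) 0≢) (∈-∖⁺ (P∈ 2 (s≤s (s≤s z≤n))) 2≢)
  ... | yes eq | _ = gap-two u a flat 1 (∈-∖⁺ (P∈ 1 (s≤s z≤n)) (P-avoids 1 0 (λ ()) eq))
    (∈-∖⁺ (P∈ 3 ℕₚ.≤-refl) (P-avoids 3 0 (λ ()) eq))
  ... | no _ | yes eq = gap-two u a flat 1 (∈-∖⁺ (P∈ 1 (s≤s z≤n)) (P-avoids 1 2 (λ ()) eq))
    (∈-∖⁺ (P∈ 3 ℕₚ.≤-refl) (P-avoids 3 2 (λ ()) eq))

  -- Another point of the line has the same value as the removed one.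
  line-wide : ∀ j → Wide (L ∖ P j)
  line-wide j a a≢0 flat = wide a a≢0 λ {x} {y} x∈ y∈ → subst₂ (λ s t → s - t ℤ.≤ + 1) (sym (value x)) (sym (value y))
    (flat (move∈ x∈) (move∈ y∈))
    where
    ae : dot a e ≡ + 0
    ae = flat⇒e (P j) a flat
    substitute : Σ ℕ λ i → (i ℕ.≤ 1) × (i ≢ j)
    substitute with j ℕ.≟ 0
    ... | yes refl = 1 , ℕₚ.≤-refl , λ ()
    ... | no j≢0 = 0 , z≤n , λ 0≡j → j≢0 (sym 0≡j)
    i : ℕ
    i = proj₁ substitute
    move : Pt → Pt
    move x with x ≟ₚ P j
    ... | yes _ = P i
    ... | no _ = x
    move∈ : ∀ {x} → x ∈ L → move x ∈ L ∖ P j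
    move∈ {x} x∈ with x ≟ₚ P j
    ... | yes _ = ∈-∖⁺ (P∈ i (ℕₚ.≤-trans (proj₁ (proj₂ substitute)) (s≤s z≤n)))
      (λ eq → proj₂ (proj₂ substitute) (P-injective i j eq))
    ... | no x≢ = ∈-∖⁺ x∈ x≢
    value : ∀ x → dot a x ≡ dot a (move x)
    value x with x ≟ₚ P j
    ... | yes eq = trans (cong (dot a) eq) (trans (dot-P₀ a j ae) (sym (dot-P₀ a i ae)))
    ... | no _ = refl

  interior-not-vertex : ∀ j → 2 ℕ.+ j ℕ.≤ K → ¬ Vertex L (P (1 ℕ.+ j))
  interior-not-vertex j le (_ , c , strict) = ℤₚ.<-irrefl middle (ℤₚ.+-mono-<
    (strict (on j (ℕₚ.≤-trans (ℕₚ.n≤1+n j) (ℕₚ.≤-trans (ℕₚ.n≤1+n (1 ℕ.+ j)) le)))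
      (λ eq → ℕₚ.<⇒≢ (ℕₚ.n<1+n j) (P-injective j (1 ℕ.+ j) eq)))
    (strict (on (2 ℕ.+ j) le) (λ eq → ℕₚ.<⇒≢ (ℕₚ.n<1+n (1 ℕ.+ j)) (sym (P-injective (2 ℕ.+ j) (1 ℕ.+ j) eq)))))
    where
    middle : dot c (P j) + dot c (P (2 ℕ.+ j)) ≡ dot c (P (1 ℕ.+ j)) + dot c (P (1 ℕ.+ j))
    middle = trans (cong₂ _+_ (dot-P c j) (dot-P c (2 ℕ.+ j))) (trans
      (solve 3 (λ x j d → (x :+ j :* d) :+ (x :+ (con (+ 2) :+ j) :* d) := (x :+ (con (+ 1) :+ j) :* d) :+
        (x :+ (con (+ 1) :+ j) :* d)) refl (dot c o) (+ j) (dot c e))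
      (sym (cong₂ _+_ (dot-P c (1 ℕ.+ j)) (dot-P c (1 ℕ.+ j)))))

  vertex-on-line : ∀ {v} → Vertex L v → Off v ⊎ (v ≡ P 0) ⊎ (v ≡ P K)
  vertex-on-line {v} vertex with off-or-on v
  ... | inj₁ off = inj₁ off
  ... | inj₂ eq = inj₂ (ends (line (proj₁ vertex) eq))
    where
    ends : (Σ ℕ λ j → j ℕ.≤ K × v ≡ P j) → (v ≡ P 0) ⊎ (v ≡ P K)
    ends (0 , _ , v≡) = inj₁ v≡
    ends (ℕ.suc j , le , v≡) with ℕ.suc j ℕ.≟ K
    ... | yes refl = inj₂ v≡
    ... | no ne = ⊥-elim (interior-not-vertex j (ℕₚ.≤∧≢⇒< le ne) (subst (Vertex L) v≡ vertex))

  P₁≢vertex : ∀ {v} → Vertex L v → P 1 ≢ v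
  P₁≢vertex vertex refl = interior-not-vertex 0 (≤K (s≤s (s≤s z≤n))) vertex

  P₂≢vertex : ∀ {v} → Vertex L v → P 2 ≢ v
  P₂≢vertex vertex refl = interior-not-vertex 1 (≤K ℕₚ.≤-refl) vertex

  P₂⊖P₁ : P 2 ⊖ P 1 ≡ e
  P₂⊖P₁ = proveᵥ (o ▸ e ▸ []) ((V₀ ⊕′ scale′ (con (+ 2)) V₁) ⊖′ (V₀ ⊕′ scale′ (con (+ 1)) V₁)) V₁ refl refl refl

  cross-P₁ : ∀ x → cross e (x ⊖ P 1) ≡ cross e (x ⊖ o)
  cross-P₁ x = proveᵥ (o ▸ e ▸ x ▸ []) (cross′ V₁ (V₂ ⊖′ (V₀ ⊕′ scale′ (con (+ 1)) V₁))) (cross′ V₁ (V₂ ⊖′ V₀)) refl refl refl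

  planar⇒det : ∀ {xs x y} → Planar xs → P 1 ∈ xs → P 2 ∈ xs → x ∈ xs → y ∈ xs → det3 e (x ⊖ o) (y ⊖ o) ≡ + 0
  planar⇒det {xs} {x} {y} planar p₁ p₂ x∈ y∈ = trans
    (prove (o ▸ e ▸ x ▸ y ▸ []) (det3′ V₁ (V₂ ⊖′ V₀) (V₃ ⊖′ V₀))
      (det3′ ((V₀ ⊕′ scale′ (con (+ 2)) V₁) ⊖′ (V₀ ⊕′ scale′ (con (+ 1)) V₁)) (V₂ ⊖′ (V₀ ⊕′ scale′ (con (+ 1)) V₁))
        (V₃ ⊖′ (V₀ ⊕′ scale′ (con (+ 1)) V₁))) refl)
    (planar p₁ p₂ x∈ y∈)

  det-on-line : ∀ x y → cross e (y ⊖ o) ≡ origin → det3 e (x ⊖ o) (y ⊖ o) ≡ + 0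
  det-on-line x y eq = trans (prove (e ▸ x ⊖ o ▸ y ⊖ o ▸ []) (det3′ V₀ V₁ V₂) (:- dot′ V₁ (cross′ V₀ V₂)) refl)
    (trans (cong (λ w → - dot (x ⊖ o) w) eq) (prove (x ⊖ o ▸ []) (:- dot′ V₀ origin′) (con (+ 0)) refl))

  not-coplanar : ∀ x → Off x → ¬ (∀ {y} → y ∈ L → det3 e (x ⊖ o) (y ⊖ o) ≡ + 0)
  not-coplanar x off all = not-in-plane (cross e (x ⊖ o)) off λ {y} y∈ → trans (det3-dot e (x ⊖ o) (y ⊖ o)) (all y∈)

  opaque
    some-off : Σ Pt λ x → x ∈ L × Off x
    some-off =
      let (c , c≢0 , ce) = perpendicular e e≢0
          (x , x∈ , cx) = spatial c c≢0 (dot c o)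
      in x , x∈ , cross≢origin c e (x ⊖ o) ce (λ eq → cx (dot-⊖≡0 c x o eq)) e≢0
      where
      e≢0 : e ≢ origin
      e≢0 eq = one≢0 (trans (sym ge) (trans (cong (dot g) eq) (prove (g ▸ []) (dot′ V₀ origin′) (con (+ 0)) refl)))
        where
        one≢0 : + 1 ≢ + 0
        one≢0 ()

  -- Removing one end keeps the set wide, by `line-wide`. Removing both keeps `P 1`, `P 2` and every
  -- point off the line, so the rest is planar only if `L` is; otherwise the two ends would witness
  -- merging.
  not-both-ends : Vertex L (P 0) → ¬ Vertex L (P K)
  not-both-ends v₀ vₖ = unmerged v₀ vₖ 0≢K (line-wide 0) (line-wide K) λ planar →
    let (x , x∈ , off) = some-off in not-coplanar x off λ {y} y∈ → coplanar-with planar x x∈ off y y∈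
    where
    0≢K : P 0 ≢ P K
    0≢K eq = ℕₚ.<⇒≢ (ℕₚ.≤-trans (s≤s z≤n) long) (P-injective 0 K eq)
    coplanar-with : Planar (L ∖ P 0 ∖ P K) → ∀ x → x ∈ L → Off x → ∀ y → y ∈ L → det3 e (x ⊖ o) (y ⊖ o) ≡ + 0
    coplanar-with planar x x∈ off y y∈ with off-or-on y
    ... | inj₁ offy = planar⇒det planar (∈-∖∖ (P∈ 1 (s≤s z≤n)) (P₁≢vertex v₀) (P₁≢vertex vₖ))
      (∈-∖∖ (P∈ 2 (s≤s (s≤s z≤n))) (P₂≢vertex v₀) (P₂≢vertex vₖ))
      (∈-∖∖ x∈ (λ eq → off≢P off 0 (sym eq)) (λ eq → off≢P off K (sym eq)))
        (∈-∖∖ y∈ (λ eq → off≢P offy 0 (sym eq)) (λ eq → off≢P offy K (sym eq)))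
    ... | inj₂ eq = det-on-line x y eq

  M : PtSet
  M v = (o ⊕ v) ∈ L

  M-⊖ : ∀ y → y ∈ L → M (y ⊖ o)
  M-⊖ y y∈ = subst (_∈ L) (sym (⊕-⊖ o y)) y∈

  M-convex : Convex M
  M-convex = translate-convex {_∈ L} o convex

  M-free : UnimodularFree M
  M-free = translate-free {_∈ L} o free

  M-origin : M origin
  M-origin = subst (_∈ L) (sym (⊕-identityʳ o)) o∈

  M-e : M e
  M-e = subst (λ v → (o ⊕ v) ∈ L) (scale-one e) (P∈ 1 (s≤s z≤n))

  parallel⇒multiple : ∀ x → cross e x ≡ origin → x ≡ scale (dot g x) e
  parallel⇒multiple x eq = trans (along g e x ge) (trans (cong (λ w → scale (dot g x) e ⊕ cross g w) (trans
      (proveᵥ (e ▸ x ▸ []) (cross′ V₁ V₀) (scale′ (con (- + 1)) (cross′ V₀ V₁)) refl refl refl)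
      (trans (cong (scale (- + 1)) eq) refl)))
    (proveᵥ (scale (dot g x) e ▸ g ▸ []) (V₀ ⊕′ cross′ V₁ origin′) V₀ refl refl refl))

  -- Two points of M with the same projection span, with a segment of the line, a unit parallelogram.
  private
    no-fibre : ∀ f q k → M q → M (q ⊕ scale (+ ℕ.suc k) e) → dot f e ≡ + 0 → dot f q ≡ + 1 → cross e q ≢ origin → ⊥
    no-fibre f q k mq mt fe fq off = not-in-plane (cross e q) off λ {y} y∈ → trans (det3-dot e q (y ⊖ o))
        (parallelogram {M} M-convex M-free M-origin {e} {g} M-e ge f {q} {y ⊖ o} fe mq fq meq (M-⊖ y y∈))
      where
      meq : M (e ⊕ q)
      meq = combine₂ {M} M-convex k 1 {q} {q ⊕ scale (+ ℕ.suc k) e} {e ⊕ q} mq mt (subst (0 ℕ.<_) (ℕₚ.+-comm 1 k) (s≤s z≤n))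
        (proveᵥ (q ▸ e ▸ + k ∷ []) (scale′ (ν 6) V₀ ⊕′ scale′ (con (+ 1)) (V₀ ⊕′ scale′ (con (+ 1) :+ ν 6) V₁))
          (scale′ (ν 6 :+ con (+ 1)) (V₁ ⊕′ V₀)) refl refl refl)

  distinct-fibres : ∀ f s t → s ∈ L → t ∈ L → Off s → Off t → s ≢ t → dot f e ≡ + 0 → dot f (s ⊖ o) ≡ + 1 → dot f (t ⊖ o) ≡ + 1 →
    cross e (t ⊖ s) ≢ origin
  distinct-fibres f s t s∈ t∈ offs offt s≢t fe fs ft eq = go (dot g (t ⊖ s)) (parallel⇒multiple (t ⊖ s) eq)
    where
    go : ∀ m → t ⊖ s ≡ scale m e → ⊥
    go (+ 0) t≡ = s≢t (sym (⊖≡origin t s t≡))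
    go (+ ℕ.suc k) t≡ = no-fibre f (s ⊖ o) k (M-⊖ s s∈) (subst M (trans
        (proveᵥ (o ▸ s ▸ t ▸ []) (V₂ ⊖′ V₀) ((V₁ ⊖′ V₀) ⊕′ (V₂ ⊖′ V₁)) refl refl refl) (cong ((s ⊖ o) ⊕_) t≡)) (M-⊖ t t∈)) fe fs
          offs
    go -[1+ k ] t≡ = no-fibre f (t ⊖ o) k (M-⊖ t t∈) (subst M (trans
        (proveᵥ (o ▸ s ▸ t ▸ []) (V₁ ⊖′ V₀) ((V₂ ⊖′ V₀) ⊕′ scale′ (con (- + 1)) (V₂ ⊖′ V₁)) refl refl refl)
        (cong ((t ⊖ o) ⊕_) (trans (cong (scale (- + 1)) t≡)
          (proveᵥ (e ▸ + ℕ.suc k ∷ []) (scale′ (con (- + 1)) (scale′ (:- ν 3) V₀)) (scale′ (ν 3) V₀) refl refl refl))))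
        (M-⊖ s s∈)) fe ft offt

  Level : Pt → Pt → Set
  Level u f = dot f e ≡ + 0 × (∀ {x} → x ∈ L → x ≢ u → Off x → dot f (x ⊖ o) ≡ + 1)

  private
    normalise : ∀ u a → dot a e ≡ + 0 → ∀ t → ∣ t ∣ ≡ 1 → (∀ {x} → x ∈ L → x ≢ u → Off x → dot a (x ⊖ o) ≡ t) → Σ Pt (Level u)
    normalise u a ae t unit all = by-sign (∣∣≡1 t unit)
      where
      by-sign : (t ≡ + 1) ⊎ (t ≡ - + 1) → Σ Pt (Level u)
      by-sign (inj₁ t≡1) = a , ae , λ x∈ x≢u off → trans (all x∈ x≢u off) t≡1
      by-sign (inj₂ t≡-1) = scale (- + 1) a , trans (dot-neg a e) (cong -_ ae) ,
        λ {x} x∈ x≢u off → trans (dot-neg a (x ⊖ o)) (cong -_ (trans (all x∈ x≢u off) t≡-1))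

  opaque
    -- A point off the line at the level of the line forms three non-collinear points of that level
    -- together with two points of the line, and `adjacent-slices` then empties both neighbouring
    -- levels. So the points off the line other than `u` are all at that level or all next to it; in
    -- the latter case they share a side, since opposite sides are two apart. The point `s` decides
    -- which alternative holds.
    dichotomy : ∀ u a → Off u → Flat (L ∖ u) a → ∀ s → s ∈ L → s ≢ u → Off s →
      (∀ {x} → x ∈ L → x ≢ u → dot a (x ⊖ o) ≡ + 0) ⊎ Σ Pt (Level u)
    dichotomy u a offu flat s s∈ s≢u offs = [ on-level , off-level ]′ (gap s s∈ s≢u)
      where
      ae : dot a e ≡ + 0
      ae = flat⇒e u a flat
      o≢u : o ≢ u
      o≢u o≡u = off≢P offu 0 (trans P0≡o o≡u)
      gap : ∀ x → x ∈ L → x ≢ u → dot a x ≡ dot a o ⊎ ∣ dot a x - dot a o ∣ ≡ 1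
      gap x x∈ x≢u = unit-gap (dot a x) (dot a o) (flat (∈-∖⁺ x∈ x≢u) (∈-∖⁺ o∈ o≢u)) (flat (∈-∖⁺ o∈ o≢u) (∈-∖⁺ x∈ x≢u))
      P₁⊖P₀ : P 1 ⊖ o ≡ e
      P₁⊖P₀ = proveᵥ (o ▸ e ▸ []) ((V₀ ⊕′ scale′ (con (+ 1)) V₁) ⊖′ V₀) V₁ refl refl refl
      mixed : ∀ x y → x ∈ L → y ∈ L → Off x → dot a x ≡ dot a o → ∣ dot a y - dot a o ∣ ≢ 1
      mixed x y x∈ y∈ off ax = adjacent-slices convex free a {o} {P 1} {x} {y} o∈ (P∈ 1 (s≤s z≤n)) x∈ y∈
        (dot-P₀ a 1 ae) ax (λ eq → off (trans (cong (λ w → cross w (x ⊖ o)) (sym P₁⊖P₀)) eq))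
      on-level : dot a s ≡ dot a o → (∀ {x} → x ∈ L → x ≢ u → dot a (x ⊖ o) ≡ + 0) ⊎ Σ Pt (Level u)
      on-level as = inj₁ λ {x} x∈ x≢u → dot≡⇒⊖ a x o ([ (λ eq → eq) , (λ unit → ⊥-elim (mixed s x s∈ x∈ offs as unit)) ]′
        (gap x x∈ x≢u))
      off-level : ∣ dot a s - dot a o ∣ ≡ 1 → (∀ {x} → x ∈ L → x ≢ u → dot a (x ⊖ o) ≡ + 0) ⊎ Σ Pt (Level u)
      off-level unit = inj₂ (normalise u a ae (dot a s - dot a o) unit λ {x} x∈ x≢u offx → trans (dot-⊖ a x o) (cong (_- dot a o)
        ([ (λ eq → ⊥-elim (mixed x s x∈ s∈ offx eq unit)) ,
           (λ unitx → unit-gaps (dot a x) (dot a s) (dot a o) unitx unit (flat (∈-∖⁺ x∈ x≢u) (∈-∖⁺ s∈ s≢u))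
             (flat (∈-∖⁺ s∈ s≢u) (∈-∖⁺ x∈ x≢u))) ]′
         (gap x x∈ x≢u))))

  vertex-off-line-flat : ∀ {u} a → a ≢ origin → Vertex L u → Flat (L ∖ u) a → Off u
  vertex-off-line-flat {u} a a≢0 vertex flat with vertex-on-line vertex
  ... | inj₁ off = off
  ... | inj₂ (inj₁ refl) = ⊥-elim (line-wide 0 a a≢0 flat)
  ... | inj₂ (inj₂ refl) = ⊥-elim (line-wide K a a≢0 flat)

-- The number of points off the line

module Counted {L : List Pt} (F : Frame L) (convex : Convex (_∈ L)) (free : UnimodularFree (_∈ L))
  (spatial : Spatial L) (wide : Wide L) (unmerged : Unmerged L) (uniqL : Unique L) where
  open Frame F
  open Framed F convex free spatial wide unmerged

  outer : List Pt
  outer = filter off? L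

  outer⁻ : ∀ {u} → u ∈ outer → u ∈ L × Off u
  outer⁻ = ∈-filter⁻ off? {xs = L}

  uniq-outer : Unique outer
  uniq-outer = Uniqueₚ.filter⁺ off? uniqL

  -- Such an `f` takes only the values 0 on the line and 1 off it, relative to `o`, so the width
  -- would be one.
  not-all-level : ∀ f → dot f e ≡ + 0 → ¬ (∀ {x} → x ∈ L → Off x → dot f (x ⊖ o) ≡ + 1)
  not-all-level f fe all = wide f f≢0 λ {x} {y} x∈ y∈ → subst (ℤ._≤ + 1) (sym (difference x y)) (small _ _ (value x∈) (value y∈))
    where
    f≢0 : f ≢ origin
    f≢0 refl = let (x , x∈ , off) = some-off in one≢0 (trans (sym (all x∈ off)) (prove (x ⊖ o ▸ []) (dot′ origin′ V₀) (con (+ 0)) refl))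
      where
      one≢0 : + 1 ≢ + 0
      one≢0 ()
    value : ∀ {x} → x ∈ L → dot f (x ⊖ o) ≡ + 0 ⊎ dot f (x ⊖ o) ≡ + 1
    value {x} x∈ with off-or-on x
    ... | inj₁ off = inj₂ (all x∈ off)
    ... | inj₂ eq = inj₁ (trans (cong (dot f) (parallel⇒multiple (x ⊖ o) eq)) (trans (dot-scale f (dot g (x ⊖ o)) e)
      (trans (cong (dot g (x ⊖ o) *_) fe) (ℤₚ.*-zeroʳ (dot g (x ⊖ o))))))
    difference : ∀ x y → dot f x - dot f y ≡ dot f (x ⊖ o) - dot f (y ⊖ o)
    difference x y = prove (f ▸ x ▸ y ▸ o ▸ []) (dot′ V₀ V₁ :- dot′ V₀ V₂) (dot′ V₀ (V₁ ⊖′ V₃) :- dot′ V₀ (V₂ ⊖′ V₃)) refl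
    small : ∀ i j → i ≡ + 0 ⊎ i ≡ + 1 → j ≡ + 0 ⊎ j ≡ + 1 → i - j ℤ.≤ + 1
    small _ _ (inj₁ refl) (inj₁ refl) = ℤ.+≤+ z≤n
    small _ _ (inj₁ refl) (inj₂ refl) = ℤ.-≤+
    small _ _ (inj₂ refl) (inj₁ refl) = ℤₚ.≤-refl
    small _ _ (inj₂ refl) (inj₂ refl) = ℤ.+≤+ z≤n

  module _ (s t : Pt) (s∈ : s ∈ L) (t∈ : t ∈ L) (offs : Off s) (offt : Off t) (s≢t : s ≢ t) where
    private
      t-s : ∀ c → dot c (t ⊖ s) ≡ dot c (t ⊖ o) - dot c (s ⊖ o)
      t-s c = prove (c ▸ t ▸ s ▸ o ▸ []) (dot′ V₀ (V₁ ⊖′ V₂)) (dot′ V₀ (V₁ ⊖′ V₃) :- dot′ V₀ (V₂ ⊖′ V₃)) refl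

      -- Coplanar with the line, `s` and `t` project to one line through the projection of `o`. Both
      -- at level one of `h`, they would project to the same point, which `distinct-fibres` forbids.
      transversal : ∀ a h → a ≢ origin → dot a e ≡ + 0 → dot a (s ⊖ o) ≡ + 0 → dot a (t ⊖ o) ≡ + 0 →
        dot h e ≡ + 0 → dot h (s ⊖ o) ≡ + 1 → dot h (t ⊖ o) ≢ + 1
      transversal a h a≢0 ae as at he hs ht = distinct-fibres h s t s∈ t∈ offs offt s≢t he hs ht
        (trans (normal h e (t ⊖ s) (s ⊖ o) he (trans (t-s h) (cong₂ _-_ ht hs)) hs)
          (cong (λ k → scale k h) (coplanar e (t ⊖ s) (s ⊖ o) a a≢0 ae (trans (t-s a) (cong₂ _-_ at as)) as)))

    -- Two planes, each containing the line and `s`, coincide and swallow `L`. Two equal level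
    -- functionals level all of `L`. Two different ones have a difference that vanishes on the line,
    -- on `s` and on `t`, so this case and the mixed ones fall to `transversal`. That is why two
    -- spare points `s` and `t` are needed.
    not-two-flat : ∀ u v a b → a ≢ origin → b ≢ origin → Off u → Off v → u ≢ v → s ≢ u → s ≢ v → t ≢ u → t ≢ v →
      Flat (L ∖ u) a → ¬ Flat (L ∖ v) b
    not-two-flat u v a b a≢0 b≢0 offu offv u≢v s≢u s≢v t≢u t≢v flatᵤ flatᵥ =
      cases (dichotomy u a offu flatᵤ s s∈ s≢u offs) (dichotomy v b offv flatᵥ s s∈ s≢v offs)
      where
      ae : dot a e ≡ + 0
      ae = flat⇒e u a flatᵤ
      be : dot b e ≡ + 0
      be = flat⇒e v b flatᵥ
      cases : ((∀ {x} → x ∈ L → x ≢ u → dot a (x ⊖ o) ≡ + 0) ⊎ Σ Pt (Level u)) →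
        ((∀ {x} → x ∈ L → x ≢ v → dot b (x ⊖ o) ≡ + 0) ⊎ Σ Pt (Level v)) → ⊥
      cases (inj₁ A) (inj₁ B) = not-coplanar s offs λ {y} y∈ → plane y y∈ (y ≟ₚ u)
        where
        plane : ∀ y → y ∈ L → Dec (y ≡ u) → det3 e (s ⊖ o) (y ⊖ o) ≡ + 0
        plane y y∈ (no y≢u) = coplanar e (s ⊖ o) (y ⊖ o) a a≢0 ae (A s∈ s≢u) (A y∈ y≢u)
        plane y y∈ (yes refl) = coplanar e (s ⊖ o) (y ⊖ o) b b≢0 be (B s∈ s≢v) (B y∈ u≢v)
      cases (inj₁ A) (inj₂ (h , he , H)) = transversal a h a≢0 ae (A s∈ s≢u) (A t∈ t≢u) he (H s∈ s≢v offs) (H t∈ t≢v offt)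
      cases (inj₂ (f , fe , F)) (inj₁ B) = transversal b f b≢0 be (B s∈ s≢v) (B t∈ t≢v) fe (F s∈ s≢u offs) (F t∈ t≢u offt)
      cases (inj₂ (f , fe , F)) (inj₂ (h , he , H)) with (f ⊖ h) ≟ₚ origin
      ... | no f≢h = transversal (f ⊖ h) h f≢h (minus e fe he) (minus (s ⊖ o) (F s∈ s≢u offs) (H s∈ s≢v offs))
          (minus (t ⊖ o) (F t∈ t≢u offt) (H t∈ t≢v offt)) he (H s∈ s≢v offs) (H t∈ t≢v offt)
        where
        minus : ∀ x {k} → dot f x ≡ k → dot h x ≡ k → dot (f ⊖ h) x ≡ + 0
        minus x {k} fx hx = trans (prove (f ▸ h ▸ x ▸ []) (dot′ (V₀ ⊖′ V₁) V₂) (dot′ V₀ V₂ :- dot′ V₁ V₂) refl)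
          (trans (cong₂ _-_ fx hx) (ℤₚ.+-inverseʳ k))
      ... | yes f≡h = not-all-level f fe λ {x} x∈ off → level x x∈ off (x ≟ₚ u)
        where
        level : ∀ x → x ∈ L → Off x → Dec (x ≡ u) → dot f (x ⊖ o) ≡ + 1
        level x x∈ off (no x≢u) = F x∈ x≢u off
        level x x∈ off (yes refl) = trans (cong (λ c → dot c (x ⊖ o)) (⊖≡origin f h f≡h)) (H x∈ u≢v off)

  private
    two : ∀ {xs : List Pt} → Unique xs → 2 ℕ.≤ length xs → Σ Pt λ s → Σ Pt λ t → s ∈ xs × t ∈ xs × s ≢ t
    two {s ∷ t ∷ _} ((s≢t ∷ _) ∷ _) _ = s , t , here refl , there (here refl) , s≢t
    two {_ ∷ []} _ (s≤s ())

    one : ∀ {xs : List Pt} → 1 ℕ.≤ length xs → Σ Pt λ s → s ∈ xs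
    one {s ∷ _} _ = s , here refl

  -- Four points suffice for both hypotheses of the count: without `u` and `v` two are left for
  -- `not-two-flat`, and without `u`, `v`, `w` one is left to form a triangle with `P 1` and `P 2`,
  -- which are never vertices.
  few-outer : ¬ (4 ℕ.≤ length outer)
  few-outer four = always-merged spatial unmerged bad-pair triangle
    where
    three : ∀ u → 3 ℕ.≤ length (outer ∖ u)
    three u = ℕ.s≤s⁻¹ (ℕₚ.≤-trans four (length-∖ u uniq-outer))
    uniq₂ : ∀ u v → Unique (outer ∖ u ∖ v)
    uniq₂ u v = Unique-∖ v (Unique-∖ u uniq-outer)
    two-left : ∀ u v → 2 ℕ.≤ length (outer ∖ u ∖ v)
    two-left u v = ℕ.s≤s⁻¹ (ℕₚ.≤-trans (three u) (length-∖ v (Unique-∖ u uniq-outer)))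
    one-left : ∀ u v w → 1 ℕ.≤ length (outer ∖ u ∖ v ∖ w)
    one-left u v w = ℕ.s≤s⁻¹ (ℕₚ.≤-trans (two-left u v) (length-∖ w (uniq₂ u v)))
    bad-pair : ∀ {u v} → Vertex L u → Vertex L v → u ≢ v → ∀ a b → a ≢ origin → b ≢ origin → Flat (L ∖ u) a → ¬ Flat (L ∖ v) b
    bad-pair {u} {v} vu vv u≢v a b a≢0 b≢0 flatᵤ flatᵥ =
      let (s , t , s∈ , t∈ , s≢t) = two (uniq₂ u v) (two-left u v)
          (s∈₁ , s≢v) = ∈-∖⁻ (outer ∖ u) s∈
          (s∈₂ , s≢u) = ∈-∖⁻ outer s∈₁
          (s∈L , offs) = outer⁻ s∈₂
          (t∈₁ , t≢v) = ∈-∖⁻ (outer ∖ u) t∈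
          (t∈₂ , t≢u) = ∈-∖⁻ outer t∈₁
          (t∈L , offt) = outer⁻ t∈₂
      in not-two-flat s t s∈L t∈L offs offt s≢t u v a b a≢0 b≢0 (vertex-off-line-flat a a≢0 vu flatᵤ)
        (vertex-off-line-flat b b≢0 vv flatᵥ)
           u≢v s≢u s≢v t≢u t≢v flatᵤ flatᵥ
    triangle : ∀ {u v w} → Vertex L u → Vertex L v → Vertex L w → Triangle L u v w
    triangle {u} {v} {w} vu vv vw =
      let (s , s∈) = one (one-left u v w)
          (s∈₂ , s≢u , s≢v , s≢w) = ∈-∖∖∖⁻ outer u v w s∈
          (s∈L , offs) = outer⁻ s∈₂
      in P 1 , P 2 , s , avoid (P∈ 1 (s≤s z≤n)) (P₁≢vertex vu) (P₁≢vertex vv) (P₁≢vertex vw) ,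
         avoid (P∈ 2 (s≤s (s≤s z≤n))) (P₂≢vertex vu) (P₂≢vertex vv) (P₂≢vertex vw) , avoid s∈L s≢u s≢v s≢w ,
         λ eq → offs (trans (sym (cross-P₁ s)) (trans (cong (λ d → cross d (s ⊖ P 1)) (sym P₂⊖P₁)) eq))
      where
      avoid : ∀ {x} → x ∈ L → x ≢ u → x ≢ v → x ≢ w → x ∈ L ∖ u ∖ v ∖ w
      avoid x∈ x≢u x≢v x≢w = ∈-∖⁺ (∈-∖∖ x∈ x≢u x≢v) x≢w

  OuterVertices : Set
  OuterVertices = (3 ℕ.≤ length outer) × (∀ {u} → u ∈ outer → Vertex L u) × Σ ℕ λ j → Vertex L (P j)

  opaque
    -- Four vertices have to fit among at most three points off the line and at most one end of it.
    -- The bound is attained, so every point off the line is a vertex and so is one end.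
    outer-vertices : OuterVertices
    outer-vertices with four-vertices spatial
    ... | record { v₁ = v₁ ; v₂ = v₂ ; v₃ = v₃ ; v₄ = v₄ ; vertex₁ = a₁ ; vertex₂ = a₂ ; vertex₃ = a₃ ; vertex₄ = a₄ ; distinct =
      distinct } = by-end (P 0 ∈? vs)
      where
      vs : List Pt
      vs = v₁ ∷ v₂ ∷ v₃ ∷ v₄ ∷ []
      vertices : ∀ {v} → v ∈ vs → Vertex L v
      vertices (here refl) = a₁
      vertices (there (here refl)) = a₂
      vertices (there (there (here refl))) = a₃
      vertices (there (there (there (here refl)))) = a₄
      with-end : ∀ j → (∀ {v} → v ∈ vs → v ∈ P j ∷ outer) → OuterVertices
      with-end j vs⊆ = ℕ.s≤s⁻¹ (Unique-⊆⇒≤ distinct vs⊆) , (λ u∈ → vertices (vs⊇ (there u∈))) , j , vertices (vs⊇ (here refl))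
        where
        vs⊇ : ∀ {v} → v ∈ P j ∷ outer → v ∈ vs
        vs⊇ = Unique-⊆⇒⊇ distinct vs⊆ (ℕₚ.≰⇒> few-outer)
      by-end : Dec (P 0 ∈ vs) → OuterVertices
      by-end (yes v₀∈) = with-end 0 λ {v} v∈ → place v∈ (vertex-on-line (vertices v∈))
        where
        place : ∀ {v} → v ∈ vs → Off v ⊎ (v ≡ P 0) ⊎ (v ≡ P K) → v ∈ P 0 ∷ outer
        place v∈ (inj₁ off) = there (∈-filter⁺ off? (proj₁ (vertices v∈)) off)
        place v∈ (inj₂ (inj₁ eq)) = here eq
        place v∈ (inj₂ (inj₂ eq)) = ⊥-elim (not-both-ends (vertices v₀∈) (subst (Vertex L) eq (vertices v∈)))
      by-end (no v₀∉) = with-end K λ {v} v∈ → place v∈ (vertex-on-line (vertices v∈))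
        where
        place : ∀ {v} → v ∈ vs → Off v ⊎ (v ≡ P 0) ⊎ (v ≡ P K) → v ∈ P K ∷ outer
        place v∈ (inj₁ off) = there (∈-filter⁺ off? (proj₁ (vertices v∈)) off)
        place v∈ (inj₂ (inj₁ eq)) = ⊥-elim (v₀∉ (subst (_∈ vs) eq v∈))
        place v∈ (inj₂ (inj₂ eq)) = here eq

  three-outer : Σ Pt λ u₁ → Σ Pt λ u₂ → Σ Pt λ u₃ → outer ≡ u₁ ∷ u₂ ∷ u₃ ∷ []
  three-outer = exactly outer (proj₁ outer-vertices) few-outer
    where
    exactly : ∀ xs → 3 ℕ.≤ length xs → ¬ (4 ℕ.≤ length xs) → Σ Pt λ u₁ → Σ Pt λ u₂ → Σ Pt λ u₃ → xs ≡ u₁ ∷ u₂ ∷ u₃ ∷ []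
    exactly (a ∷ b ∷ c ∷ []) _ _ = a , b , c , refl
    exactly (_ ∷ _ ∷ []) (s≤s (s≤s ())) _
    exactly (_ ∷ []) (s≤s ()) _
    exactly (_ ∷ _ ∷ _ ∷ _ ∷ _) _ ¬four = ⊥-elim (¬four (s≤s (s≤s (s≤s (s≤s z≤n)))))

  Levelled : Pt → Pt → Pt → Set
  Levelled s t f = (dot f e ≡ + 0) × (dot f s ≡ + 1) × (dot f t ≡ + 1)

  -- `cross e (s ⊖ t)` takes the values 0, `d`, `d` on `e`, `s`, `t`. A solution can only be its
  -- quotient by `d`, so existence is divisibility of the three coordinates.
  levelled? : ∀ s t → det3 e s t ≢ + 0 → Dec (Σ Pt (Levelled s t))
  levelled? s t d≢0 = decide (d ∣ℤ? proj₁ n) (d ∣ℤ? proj₁ (proj₂ n)) (d ∣ℤ? proj₂ (proj₂ n))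
    where
    d : ℤ
    d = det3 e s t
    n : Pt
    n = cross e (s ⊖ t)
    ne : dot n e ≡ + 0
    ne = prove (e ▸ s ▸ t ▸ []) (dot′ (cross′ V₀ (V₁ ⊖′ V₂)) V₀) (con (+ 0)) refl
    ns : dot n s ≡ d
    ns = prove (e ▸ s ▸ t ▸ []) (dot′ (cross′ V₀ (V₁ ⊖′ V₂)) V₁) (det3′ V₀ V₁ V₂) refl
    nt : dot n t ≡ d
    nt = prove (e ▸ s ▸ t ▸ []) (dot′ (cross′ V₀ (V₁ ⊖′ V₂)) V₂) (det3′ V₀ V₁ V₂) refl
    determined : ∀ f → Levelled s t f → n ≡ scale d f
    determined f (fe , fs , ft) = ⊖≡origin n (scale d f) (scale≡origin d (n ⊖ scale d f) d≢0 (orthogonal e s t (n ⊖ scale d f)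
      (minus e ne fe (ℤₚ.*-zeroʳ d)) (minus s ns fs (ℤₚ.*-identityʳ d)) (minus t nt ft (ℤₚ.*-identityʳ d))))
      where
      minus : ∀ x {k j} → dot n x ≡ k → dot f x ≡ j → d * j ≡ k → dot (n ⊖ scale d f) x ≡ + 0
      minus x {k} {j} nx fx eq = trans (prove (n ▸ f ▸ x ▸ d ∷ []) (dot′ (V₀ ⊖′ scale′ (ν 9) V₁) V₂)
        (dot′ V₀ V₂ :- ν 9 :* dot′ V₁ V₂) refl)
        (trans (cong₂ _-_ nx (trans (cong (d *_) fx) eq)) (ℤₚ.+-inverseʳ k))
    cancel : ∀ f x {k} → n ≡ scale d f → dot n x ≡ d * k → dot f x ≡ k
    cancel f x {k} n≡ nx = ℤₚ.*-cancelˡ-≡ d (dot f x) k ⦃ ℤ.≢-nonZero d≢0 ⦄ (trans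
      (prove (f ▸ x ▸ d ∷ []) (ν 6 :* dot′ V₀ V₁) (dot′ (scale′ (ν 6) V₀) V₁) refl) (trans (cong (λ w → dot w x) (sym n≡)) nx))
    decide : Dec (d ∣ℤ proj₁ n) → Dec (d ∣ℤ proj₁ (proj₂ n)) → Dec (d ∣ℤ proj₂ (proj₂ n)) → Dec (Σ Pt (Levelled s t))
    decide (yes (divides a a≡)) (yes (divides b b≡)) (yes (divides c c≡)) =
      yes ((a , b , c) , cancel (a , b , c) e n≡ (trans ne (sym (ℤₚ.*-zeroʳ d))) ,
        cancel (a , b , c) s n≡ (trans ns (sym (ℤₚ.*-identityʳ d))) , cancel (a , b , c) t n≡ (trans nt (sym (ℤₚ.*-identityʳ d))))
      where
      n≡ : n ≡ scale d (a , b , c)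
      n≡ = pt≡ (trans a≡ (ℤₚ.*-comm a d)) (trans b≡ (ℤₚ.*-comm b d)) (trans c≡ (ℤₚ.*-comm c d))
    decide (no ¬a) _ _ = no λ { (f , lev) → ¬a (divides (proj₁ f)
      (trans (cong proj₁ (determined f lev)) (ℤₚ.*-comm d (proj₁ f)))) }
    decide _ (no ¬b) _ = no λ { (f , lev) → ¬b (divides (proj₁ (proj₂ f))
      (trans (cong (λ w → proj₁ (proj₂ w)) (determined f lev)) (ℤₚ.*-comm d (proj₁ (proj₂ f))))) }
    decide _ _ (no ¬c) = no λ { (f , lev) → ¬c (divides (proj₂ (proj₂ f))
      (trans (cong (λ w → proj₂ (proj₂ w)) (determined f lev)) (ℤₚ.*-comm d (proj₂ (proj₂ f))))) }

  opaque
    -- Without such a functional neither alternative of `dichotomy` is possible, so `L` stays wide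
    -- when `u` is removed. It also stays wide without the end `P j`, and `P 1`, `P 2`, `s`, `t`
    -- keep the rest three-dimensional: `u` and `P j` would witness merging.
    levelled : ∀ u s t → u ∈ outer → s ∈ outer → t ∈ outer → s ≢ u → t ≢ u → det3 e (s ⊖ o) (t ⊖ o) ≢ + 0 →
      Σ Pt (Levelled (s ⊖ o) (t ⊖ o))
    levelled u s t u∈ s∈ t∈ s≢u t≢u d≢0 with levelled? (s ⊖ o) (t ⊖ o) d≢0
    ... | yes lev = lev
    ... | no none = ⊥-elim (unmerged (proj₁ (proj₂ outer-vertices) u∈) vⱼ (λ eq → off≢P offu j (sym eq)) wideᵤ (line-wide j) λ
      planar →
        d≢0 (planar⇒det planar (∈-∖∖ (P∈ 1 (s≤s z≤n)) (off≢P offu 1) (P₁≢vertex vⱼ))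
          (∈-∖∖ (P∈ 2 (s≤s (s≤s z≤n))) (off≢P offu 2) (P₂≢vertex vⱼ))
          (∈-∖∖ s∈L s≢u (λ eq → off≢P offs j (sym eq))) (∈-∖∖ t∈L t≢u (λ eq → off≢P offt j (sym eq)))))
      where
      j : ℕ
      j = proj₁ (proj₂ (proj₂ outer-vertices))
      vⱼ : Vertex L (P j)
      vⱼ = proj₂ (proj₂ (proj₂ outer-vertices))
      offu : Off u
      offu = proj₂ (outer⁻ u∈)
      s∈L : s ∈ L
      s∈L = proj₁ (outer⁻ s∈)
      offs : Off s
      offs = proj₂ (outer⁻ s∈)
      t∈L : t ∈ L
      t∈L = proj₁ (outer⁻ t∈)
      offt : Off t
      offt = proj₂ (outer⁻ t∈)
      wideᵤ : Wide (L ∖ u)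
      wideᵤ a a≢0 flat = [ (λ A → d≢0 (coplanar e (s ⊖ o) (t ⊖ o) a a≢0 (flat⇒e u a flat) (A s∈L s≢u) (A t∈L t≢u))) ,
        (λ { (f , fe , F) → none (f , fe , F s∈L s≢u offs , F t∈L t≢u offt) }) ]′ (dichotomy u a offu flat s s∈L s≢u offs)

-- Recognition of the two exceptional families

Place : Pt → Pt → ℕ → Pt → Pt → Pt → Pt → Set
Place o e K v₁ v₂ v₃ x = (Σ ℕ λ j → j ℕ.≤ K × x ≡ o ⊕ scale (+ j) e) ⊎ (x ≡ o ⊕ v₁) ⊎ (x ≡ o ⊕ v₂) ⊎ (x ≡ o ⊕ v₃)

record Spine (L : List Pt) (o e g : Pt) (K : ℕ) (v₁ v₂ v₃ : Pt) : Set where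
  field
    ge : dot g e ≡ + 1
    on : ∀ j → j ℕ.≤ K → (o ⊕ scale (+ j) e) ∈ L
    on₁ : (o ⊕ v₁) ∈ L
    on₂ : (o ⊕ v₂) ∈ L
    on₃ : (o ⊕ v₃) ∈ L
    cover : ∀ {x} → x ∈ L → Place o e K v₁ v₂ v₃ x

-- The same configuration seen from the other end of the line.
flip : ∀ {L o e g K v₁ v₂ v₃} → Spine L o e g K v₁ v₂ v₃ →
  Spine L (o ⊕ scale (+ K) e) (scale (- + 1) e) (scale (- + 1) g) K (v₁ ⊖ scale (+ K) e) (v₂ ⊖ scale (+ K) e) (v₃ ⊖ scale (+ K) e)
flip {L} {o} {e} {g} {K} {v₁} {v₂} {v₃} spine = record
  { ge = trans (prove (e ▸ g ▸ []) (dot′ (scale′ (con (- + 1)) V₁) (scale′ (con (- + 1)) V₀)) (dot′ V₁ V₀) refl) ge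
  ; on = λ j j≤K → subst (_∈ L) (sym (from-top j j≤K)) (on (K ℕ.∸ j) (ℕₚ.m∸n≤m K j))
  ; on₁ = subst (_∈ L) (shift v₁) on₁
  ; on₂ = subst (_∈ L) (shift v₂) on₂
  ; on₃ = subst (_∈ L) (shift v₃) on₃
  ; cover = λ x∈ → recover (cover x∈) }
  where
  open Spine spine
  o′ e′ : Pt
  o′ = o ⊕ scale (+ K) e
  e′ = scale (- + 1) e
  shift : ∀ v → o ⊕ v ≡ o′ ⊕ (v ⊖ scale (+ K) e)
  shift v = proveᵥ (o ▸ e ▸ v ▸ + K ∷ []) (V₀ ⊕′ V₂) ((V₀ ⊕′ scale′ (ν 9) V₁) ⊕′ (V₂ ⊖′ scale′ (ν 9) V₁)) refl refl refl
  from-top : ∀ j → j ℕ.≤ K → o′ ⊕ scale (+ j) e′ ≡ o ⊕ scale (+ (K ℕ.∸ j)) e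
  from-top j j≤K = trans (cong (λ k → (o ⊕ scale (+ k) e) ⊕ scale (+ j) e′) (sym (ℕₚ.m+[n∸m]≡n j≤K)))
    (proveᵥ (o ▸ e ▸ + j ∷ + (K ℕ.∸ j) ∷ []) ((V₀ ⊕′ scale′ (ν 6 :+ ν 7) V₁) ⊕′ scale′ (ν 6) (scale′ (con (- + 1)) V₁))
      (V₀ ⊕′ scale′ (ν 7) V₁) refl refl refl)
  recover : ∀ {x} → Place o e K v₁ v₂ v₃ x →
    Place o′ e′ K (v₁ ⊖ scale (+ K) e) (v₂ ⊖ scale (+ K) e) (v₃ ⊖ scale (+ K) e) x
  recover (inj₁ (j , j≤K , x≡)) = inj₁ (K ℕ.∸ j , ℕₚ.m∸n≤m K j , trans x≡ (sym (trans (from-top (K ℕ.∸ j) (ℕₚ.m∸n≤m K j))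
    (cong (λ k → o ⊕ scale (+ k) e) (ℕₚ.m∸[m∸n]≡n j≤K)))))
  recover (inj₂ (inj₁ x≡)) = inj₂ (inj₁ (trans x≡ (shift v₁)))
  recover (inj₂ (inj₂ (inj₁ x≡))) = inj₂ (inj₂ (inj₁ (trans x≡ (shift v₂))))
  recover (inj₂ (inj₂ (inj₂ x≡))) = inj₂ (inj₂ (inj₂ (trans x≡ (shift v₃))))

spine-vertex : ∀ {L o e g K v₁ v₂ v₃} → Spine L o e g K v₁ v₂ v₃ → ∀ c → + 0 < dot c e →
  + 0 < dot c v₁ → + 0 < dot c v₂ → + 0 < dot c v₃ → Vertex L o
spine-vertex {L} {o} {e} {g} {K} {v₁} {v₂} {v₃} spine c ce c₁ c₂ c₃ = subst (_∈ L) (⊕-identityʳ o) (on 0 z≤n) , scale (- + 1) c ,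
  λ {x} x∈ x≢o → below x≢o (cover x∈)
  where
  open Spine spine
  lower : ∀ v → + 0 < dot c v → dot (scale (- + 1) c) (o ⊕ v) < dot (scale (- + 1) c) o
  lower v cv = subst₂ _<_ (sym (prove (c ▸ o ▸ v ▸ []) (dot′ (scale′ (con (- + 1)) V₀) (V₁ ⊕′ V₂))
    (dot′ (scale′ (con (- + 1)) V₀) V₁ :+ (:- dot′ V₀ V₂)) refl))
    (ℤₚ.+-identityʳ (dot (scale (- + 1) c) o)) (ℤₚ.+-monoʳ-< (dot (scale (- + 1) c) o) (ℤₚ.neg-mono-< {+ 0} {dot c v} cv))
  below : ∀ {x} → x ≢ o → Place o e K v₁ v₂ v₃ x →
    dot (scale (- + 1) c) x < dot (scale (- + 1) c) o
  below x≢o (inj₁ (0 , _ , refl)) = ⊥-elim (x≢o (⊕-identityʳ o))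
  below x≢o (inj₁ (ℕ.suc j , _ , refl)) = lower (scale (+ ℕ.suc j) e) (subst (+ 0 <_) (sym (dot-scale c (+ ℕ.suc j) e))
    (subst (_< + ℕ.suc j * dot c e) (ℤₚ.*-zeroʳ (+ ℕ.suc j)) (ℤₚ.*-monoˡ-<-pos (+ ℕ.suc j) ce)))
  below _ (inj₂ (inj₁ refl)) = lower v₁ c₁
  below _ (inj₂ (inj₂ (inj₁ refl))) = lower v₂ c₂
  below _ (inj₂ (inj₂ (inj₂ refl))) = lower v₃ c₃

-- Multiplicativity of the determinant for the images of `e`, `x`, `y`: the image of `e` is the
-- third unit vector, so a 2 by 2 minor is left. It yields unimodularity of the rows from a known
-- determinant `det3 e x y`.
rows-determinant : ∀ e g r₁ r₂ r₃ x y → dot g e ≡ + 1 → dot r₁ e ≡ + 0 → dot r₂ e ≡ + 0 → dot r₃ e ≡ + 1 →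
  det3 r₁ r₂ r₃ * det3 e x y ≡ dot r₁ x * dot r₂ y - dot r₁ y * dot r₂ x
rows-determinant e g r₁ r₂ r₃ x y ge r₁e r₂e r₃e = begin
  det3 r₁ r₂ r₃ * det3 e x y            ≡⟨ cong (_* det3 e x y) κ≡ ⟩
  κ * det3 e x y                        ≡⟨ prove (e ▸ x ▸ y ▸ κ ∷ []) (ν 9 :* det3′ V₀ V₁ V₂)
    (dot′ (scale′ (ν 9) V₀) (cross′ V₁ V₂)) refl ⟩
  dot (scale κ e) (cross x y)           ≡⟨ cong (λ w → dot w (cross x y)) (sym c≡) ⟩
  dot (cross r₁ r₂) (cross x y)         ≡⟨ binet-cauchy r₁ r₂ x y ⟩
  dot r₁ x * dot r₂ y - dot r₁ y * dot r₂ x ∎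
  where
  open ≡-Reasoning
  κ : ℤ
  κ = dot g (cross r₁ r₂)
  c≡ : cross r₁ r₂ ≡ scale κ e
  c≡ = begin
    cross r₁ r₂ ≡⟨ along g e (cross r₁ r₂) ge ⟩
    scale κ e ⊕ cross g (cross (cross r₁ r₂) e)
      ≡⟨ cong (λ w → scale κ e ⊕ cross g w) (trans
           (proveᵥ (r₁ ▸ r₂ ▸ e ▸ []) (cross′ (cross′ V₀ V₁) V₂) (scale′ (dot′ V₀ V₂) V₁ ⊖′ scale′ (dot′ V₁ V₂) V₀) refl refl
             refl)
           (cong₂ (λ i j → scale i r₂ ⊖ scale j r₁) r₁e r₂e)) ⟩
    scale κ e ⊕ cross g (scale (+ 0) r₂ ⊖ scale (+ 0) r₁)
      ≡⟨ proveᵥ (scale κ e ▸ g ▸ r₁ ▸ r₂ ▸ []) (V₀ ⊕′ cross′ V₁ (scale′ (con (+ 0)) V₃ ⊖′ scale′ (con (+ 0)) V₂)) V₀ refl refl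
        refl ⟩
    scale κ e ∎
  κ≡ : det3 r₁ r₂ r₃ ≡ κ
  κ≡ = begin
    det3 r₁ r₂ r₃          ≡⟨ prove (r₁ ▸ r₂ ▸ r₃ ▸ []) (det3′ V₀ V₁ V₂) (dot′ V₂ (cross′ V₀ V₁)) refl ⟩
    dot r₃ (cross r₁ r₂)   ≡⟨ cong (dot r₃) c≡ ⟩
    dot r₃ (scale κ e)     ≡⟨ dot-scale r₃ κ e ⟩
    κ * dot r₃ e           ≡⟨ cong (κ *_) r₃e ⟩
    κ * + 1                ≡⟨ ℤₚ.*-identityʳ κ ⟩
    κ ∎

∣∣-divide : ∀ κ d n → κ * d ≡ n → ∣ d ∣ ≡ ∣ n ∣ → d ≢ + 0 → ∣ κ ∣ ≡ 1
∣∣-divide κ d n eq abs d≢0 = ℕₚ.*-cancelʳ-≡ (∣ κ ∣) 1 (∣ d ∣) ⦃ ℕ.≢-nonZero (λ z → d≢0 (ℤₚ.∣i∣≡0⇒i≡0 {d} z)) ⦄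
  (trans (sym (ℤₚ.abs-* κ d)) (trans (cong ∣_∣ eq) (trans (sym abs) (sym (ℕₚ.*-identityˡ ∣ d ∣)))))

module _ {A : PtSet} {L : List Pt} (to : ∀ {x} → InConv A x → x ∈ L) (from : ∀ {x} → x ∈ L → InConv A x)
  {o e g K v₁ v₂ v₃} (spine : Spine L o e g K v₁ v₂ v₃) where
  open Spine spine

  Rows : Pt → Pt → Pt → Pt → Pt → Set
  Rows r₁ r₂ r₃ v t = (dot r₁ v , dot r₂ v , dot r₃ v) ≡ t

  -- Only the end `P K` and the three outer points have to be matched with the vertices of the
  -- target. Since the origin lies in the target, the whole image of the line does too; conversely a
  -- convex combination of target vertices pulls back with the same weights, and injectivity of `R`
  -- identifies the point it represents.
  equivalence : ∀ r₁ r₂ r₃ t₁ t₂ t₃ → ∣ det3 r₁ r₂ r₃ ∣ ≡ 1 →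
    Rows r₁ r₂ r₃ e (+ 0 , + 0 , + 1) → Rows r₁ r₂ r₃ v₁ t₁ → Rows r₁ r₂ r₃ v₂ t₂ → Rows r₁ r₂ r₃ v₃ t₃ →
    let T = t₁ ∷ t₂ ∷ t₃ ∷ (+ 0 , + 0 , + K) ∷ [] in InConv (_∈ T) origin → UnimodEquiv A (_∈ T)
  equivalence r₁ r₂ r₃ t₁ t₂ t₃ unit Re R₁ R₂ R₃ T0 = r₁ , r₂ , r₃ , scale (- + 1) (R o) , unit , λ x → forward x , backward x
    where
    T : List Pt
    T = t₁ ∷ t₂ ∷ t₃ ∷ (+ 0 , + 0 , + K) ∷ []
    R : Pt → Pt
    R v = dot r₁ v , dot r₂ v , dot r₃ v
    f : Pt → Pt
    f = apply r₁ r₂ r₃ (scale (- + 1) (R o))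
    R-linear : ∀ k v → R (scale k v) ≡ scale k (R v)
    R-linear k v = pt≡ (dot-scale r₁ k v) (dot-scale r₂ k v) (dot-scale r₃ k v)
    R-⊕ : ∀ v w → R (v ⊕ w) ≡ R v ⊕ R w
    R-⊕ v w = pt≡ (dot-⊕ r₁ v w) (dot-⊕ r₂ v w) (dot-⊕ r₃ v w)
    f-at : ∀ v → f (o ⊕ v) ≡ R v
    f-at v = trans (cong (_⊕ scale (- + 1) (R o)) (R-⊕ o v))
      (proveᵥ (R o ▸ R v ▸ []) ((V₀ ⊕′ V₁) ⊕′ scale′ (con (- + 1)) V₀) V₁ refl refl refl)
    member : ∀ {t} → t ∈ T → InConv (_∈ T) t
    member = InConv-single {_∈ T}
    segment : ∀ j → j ℕ.≤ K → InConv (_∈ T) (scale (+ j) (+ 0 , + 0 , + 1))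
    segment 0 _ = T0
    segment (ℕ.suc j) j<K = combine₂ {InConv (_∈ T)} (InConv-convex {_∈ T}) (ℕ.suc j) (K ℕ.∸ ℕ.suc j) {+ 0 , + 0 , + K} {origin}
      (member (there (there (there (here refl))))) T0 (s≤s z≤n)
      (trans (proveᵥ (+ ℕ.suc j ∷ + (K ℕ.∸ ℕ.suc j) ∷ + K ∷ [])
        (scale′ (var zero) (con (+ 0) , con (+ 0) , ν 2) ⊕′ scale′ (ν 1) origin′)
          (scale′ (ν 2) (scale′ (var zero) (con (+ 0) , con (+ 0) , con (+ 1)))) refl refl refl)
        (cong (λ k → scale (+ k) (scale (+ ℕ.suc j) (+ 0 , + 0 , + 1))) (sym (ℕₚ.m+[n∸m]≡n j<K))))
    forward : ∀ x → InConv A x → InConv (_∈ T) (f x)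
    forward x x∈ = image (cover (to x∈))
      where
      image : Place o e K v₁ v₂ v₃ x → InConv (_∈ T) (f x)
      image (inj₁ (j , j≤K , refl)) = subst (InConv (_∈ T))
        (sym (trans (f-at (scale (+ j) e)) (trans (R-linear (+ j) e) (cong (scale (+ j)) Re)))) (segment j j≤K)
      image (inj₂ (inj₁ refl)) = subst (InConv (_∈ T)) (sym (trans (f-at v₁) R₁)) (member (here refl))
      image (inj₂ (inj₂ (inj₁ refl))) = subst (InConv (_∈ T)) (sym (trans (f-at v₂) R₂)) (member (there (here refl)))
      image (inj₂ (inj₂ (inj₂ refl))) = subst (InConv (_∈ T)) (sym (trans (f-at v₃) R₃)) (member (there (there (here refl))))
    preimage : ∀ {t} → t ∈ T → Σ Pt λ x → InConv A x × f x ≡ t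
    preimage (here refl) = o ⊕ v₁ , from on₁ , trans (f-at v₁) R₁
    preimage (there (here refl)) = o ⊕ v₂ , from on₂ , trans (f-at v₂) R₂
    preimage (there (there (here refl))) = o ⊕ v₃ , from on₃ , trans (f-at v₃) R₃
    preimage (there (there (there (here refl)))) = o ⊕ scale (+ K) e , from (on K ℕₚ.≤-refl) , trans (f-at (scale (+ K) e))
      (trans (R-linear (+ K) e) (trans (cong (scale (+ K)) Re)
      (pt≡ (ℤₚ.*-zeroʳ (+ K)) (ℤₚ.*-zeroʳ (+ K)) (ℤₚ.*-identityʳ (+ K)))))
    R-injective : ∀ v → R v ≡ origin → v ≡ origin
    R-injective v Rv = scale≡origin (det3 r₁ r₂ r₃) v (λ z → zero≢one (trans (sym (cong ∣_∣ z)) unit)) (orthogonal r₁ r₂ r₃ v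
        (trans (dot-comm v r₁) (cong proj₁ Rv)) (trans (dot-comm v r₂) (cong (λ w → proj₁ (proj₂ w)) Rv))
          (trans (dot-comm v r₃) (cong (λ w → proj₂ (proj₂ w)) Rv)))
      where
      zero≢one : 0 ≢ 1
      zero≢one ()
    backward : ∀ x → InConv (_∈ T) (f x) → InConv A x
    backward x (ws , ws∈ , pos , eq) = let (vs , vs∈ , tot , sum) = pull ws ws∈ in
      InConv-convex {A} x (vs , vs∈ , subst (0 ℕ.<_) (sym tot) pos , same vs tot
        (trans sum (trans eq (cong (λ k → scale (+ k) (f x)) (sym tot)))))
      where
      weight : List (ℕ × Pt) → Pt
      weight vs = R (wsum vs) ⊕ scale (+ wtot vs) (scale (- + 1) (R o))
      pull : ∀ ws → All (λ wp → proj₂ wp ∈ T) ws → Σ (List (ℕ × Pt)) λ vs → All (λ wp → InConv A (proj₂ wp)) vs ×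
        (wtot vs ≡ wtot ws) ×
        (weight vs ≡ wsum ws)
      pull [] [] = [] , [] , refl , trans (cong (_⊕ scale (+ 0) (scale (- + 1) (R o)))
        (pt≡ (dot-origin r₁) (dot-origin r₂) (dot-origin r₃)))
          (proveᵥ (R o ▸ []) (origin′ ⊕′ scale′ (con (+ 0)) (scale′ (con (- + 1)) V₀)) origin′ refl refl refl)
        where
        dot-origin : ∀ r → dot r origin ≡ + 0
        dot-origin r = prove (r ▸ []) (dot′ V₀ origin′) (con (+ 0)) refl
      pull ((w , t) ∷ ws) (t∈ ∷ ws∈) =
        let (vs , vs∈ , tot , sum) = pull ws ws∈
            (y , y∈ , fy) = preimage t∈
        in (w , y) ∷ vs , y∈ ∷ vs∈ , cong (w ℕ.+_) tot , step w y vs t (wsum ws) fy sum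
        where
        step : ∀ w y vs t s → f y ≡ t → weight vs ≡ s → weight ((w , y) ∷ vs) ≡ scale (+ w) t ⊕ s
        step w y vs t s refl refl = trans (cong (_⊕ scale (+ (w ℕ.+ wtot vs)) (scale (- + 1) (R o)))
          (trans (R-⊕ (scale (+ w) y) (wsum vs)) (cong (_⊕ R (wsum vs)) (R-linear (+ w) y))))
          (proveᵥ (R o ▸ R y ▸ R (wsum vs) ▸ + w ∷ + wtot vs ∷ [])
            ((scale′ (ν 9) V₁ ⊕′ V₂) ⊕′ scale′ (ν 9 :+ ν 10) (scale′ (con (- + 1)) V₀))
            (scale′ (ν 9) (V₁ ⊕′ scale′ (con (- + 1)) V₀) ⊕′ (V₂ ⊕′ scale′ (ν 10) (scale′ (con (- + 1)) V₀))) refl refl refl)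
      same : ∀ vs → wtot vs ≡ wtot ws → weight vs ≡ scale (+ wtot vs) (f x) → wsum vs ≡ scale (+ wtot vs) x
      same vs tot eq = ⊖≡origin (wsum vs) (scale (+ wtot vs) x) (R-injective (wsum vs ⊖ scale (+ wtot vs) x) (begin
        R (wsum vs ⊖ scale (+ wtot vs) x)
          ≡⟨ pt≡ (dot-⊖ r₁ (wsum vs) (scale (+ wtot vs) x)) (dot-⊖ r₂ (wsum vs) (scale (+ wtot vs) x))
            (dot-⊖ r₃ (wsum vs) (scale (+ wtot vs) x)) ⟩
        R (wsum vs) ⊖ R (scale (+ wtot vs) x)
          ≡⟨ cong (R (wsum vs) ⊖_) (R-linear (+ wtot vs) x) ⟩
        R (wsum vs) ⊖ scale (+ wtot vs) (R x)
          ≡⟨ proveᵥ (R (wsum vs) ▸ R x ▸ R o ▸ + wtot vs ∷ []) (V₀ ⊖′ scale′ (ν 9) V₁)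
               ((V₀ ⊕′ scale′ (ν 9) (scale′ (con (- + 1)) V₂)) ⊖′ scale′ (ν 9) (V₁ ⊕′ scale′ (con (- + 1)) V₂)) refl refl refl ⟩
        weight vs ⊖ scale (+ wtot vs) (f x)
          ≡⟨ cong (_⊖ scale (+ wtot vs) (f x)) eq ⟩
        scale (+ wtot vs) (f x) ⊖ scale (+ wtot vs) (f x)
          ≡⟨ ⊖-inverse (scale (+ wtot vs) (f x)) ⟩
        origin ∎))
        where open ≡-Reasoning

  Combination : Pt → Pt → Pt → Set
  Combination b₁ b₂ v = Σ ℤ λ m₁ → Σ ℤ λ m₂ → Σ ℤ λ m₃ → v ≡ scale m₁ b₁ ⊕ (scale m₂ b₂ ⊕ scale m₃ e)

  sublattice-index : ∀ b₁ b₂ k → 1 ℕ.≤ K → (o ⊕ b₁) ∈ L → (o ⊕ b₂) ∈ L → Combination b₁ b₂ v₁ → Combination b₁ b₂ v₂ →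
    Combination b₁ b₂ v₃ →
    ∣ det3 b₁ b₂ e ∣ ≡ k → SublatticeIndex A k
  sublattice-index b₁ b₂ k 1≤K b₁∈ b₂∈ C₁ C₂ C₃ det = b₁ , b₂ , e , spanned b₁ b₁∈ , spanned b₂ b₂∈ ,
    spanned e (subst (λ v → (o ⊕ v) ∈ L) (scale-one e) (on 1 1≤K)) , differences , det
    where
    o∈ : o ∈ L
    o∈ = subst (_∈ L) (⊕-identityʳ o) (on 0 z≤n)
    spanned : ∀ b → (o ⊕ b) ∈ L → IntSpan (Diffs A) b
    spanned b b∈ = (+ 1 , b) ∷ [] , (o ⊕ b , o , from b∈ , from o∈ , proveᵥ (o ▸ b ▸ []) V₁ ((V₀ ⊕′ V₁) ⊖′ V₀) refl refl refl) ∷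
      [] ,
      trans (⊕-identityʳ (scale (+ 1) b)) (scale-one b)
    relative : ∀ x → x ∈ L → Σ Pt λ v → x ≡ o ⊕ v × Combination b₁ b₂ v
    relative x x∈ = by (cover x∈)
      where
      by : Place o e K v₁ v₂ v₃ x → Σ Pt λ v → x ≡ o ⊕ v × Combination b₁ b₂ v
      by (inj₁ (j , _ , x≡)) = scale (+ j) e , x≡ , + 0 , + 0 , + j ,
        proveᵥ (b₁ ▸ b₂ ▸ e ▸ + j ∷ []) (scale′ (ν 9) V₂) (scale′ (con (+ 0)) V₀ ⊕′ (scale′ (con (+ 0)) V₁ ⊕′ scale′ (ν 9) V₂))
          refl refl refl
      by (inj₂ (inj₁ x≡)) = v₁ , x≡ , C₁
      by (inj₂ (inj₂ (inj₁ x≡))) = v₂ , x≡ , C₂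
      by (inj₂ (inj₂ (inj₂ x≡))) = v₃ , x≡ , C₃
    differences : ∀ y → Diffs A y → Combination b₁ b₂ y
    differences y (x , z , x∈ , z∈ , y≡) =
      let (v , x≡ , m₁ , m₂ , m₃ , v≡) = relative x (to x∈)
          (w , z≡ , n₁ , n₂ , n₃ , w≡) = relative z (to z∈)
      in m₁ - n₁ , m₂ - n₂ , m₃ - n₃ , trans y≡ (trans (cong₂ _⊖_ (trans x≡ (cong (o ⊕_) v≡)) (trans z≡ (cong (o ⊕_) w≡)))
           (trans (⊕-⊖-⊕ o (scale m₁ b₁ ⊕ (scale m₂ b₂ ⊕ scale m₃ e)) (scale n₁ b₁ ⊕ (scale n₂ b₂ ⊕ scale n₃ e)))
             (subtract m₁ m₂ m₃ n₁ n₂ n₃)))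
      where
      subtract : ∀ m₁ m₂ m₃ n₁ n₂ n₃ → (scale m₁ b₁ ⊕ (scale m₂ b₂ ⊕ scale m₃ e)) ⊖ (scale n₁ b₁ ⊕ (scale n₂ b₂ ⊕ scale n₃ e)) ≡
        scale (m₁ - n₁) b₁ ⊕ (scale (m₂ - n₂) b₂ ⊕ scale (m₃ - n₃) e)
      subtract m₁ m₂ m₃ n₁ n₂ n₃ = proveᵥ (b₁ ▸ b₂ ▸ e ▸ m₁ ∷ m₂ ∷ m₃ ∷ n₁ ∷ n₂ ∷ n₃ ∷ [])
        ((scale′ (ν 9) V₀ ⊕′ (scale′ (ν 10) V₁ ⊕′ scale′ (ν 11) V₂)) ⊖′
          (scale′ (ν 12) V₀ ⊕′ (scale′ (ν 13) V₁ ⊕′ scale′ (ν 14) V₂)))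
        (scale′ (ν 9 :- ν 12) V₀ ⊕′ (scale′ (ν 10 :- ν 13) V₁ ⊕′ scale′ (ν 11 :- ν 14) V₂)) refl refl refl

dot-combination : ∀ i j k a b c x {p q r} → dot a x ≡ p → dot b x ≡ q → dot c x ≡ r →
  dot (scale i a ⊕ (scale j b ⊕ scale k c)) x ≡ i * p + (j * q + k * r)
dot-combination i j k a b c x refl refl refl = prove (a ▸ b ▸ c ▸ x ▸ i ∷ j ∷ k ∷ [])
  (dot′ (scale′ (ν 12) V₀ ⊕′ (scale′ (ν 13) V₁ ⊕′ scale′ (ν 14) V₂)) V₃)
  (ν 12 :* dot′ V₀ V₃ :+ (ν 13 :* dot′ V₁ V₃ :+ ν 14 :* dot′ V₂ V₃)) refl

dot-shift : ∀ f v e K {k} → dot f e ≡ + 0 → dot f v ≡ k → dot f (v ⊖ scale K e) ≡ k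
dot-shift f v e K {k} fe fv = trans (dot-⊖ f v (scale K e))
  (trans (cong₂ _-_ fv (trans (dot-scale f K e) (trans (cong (K *_) fe) (ℤₚ.*-zeroʳ K)))) (ℤₚ.+-identityʳ k))

dot-shift-neg : ∀ g v e K → dot g e ≡ + 1 → dot (scale (- + 1) g) (v ⊖ scale K e) ≡ K - dot g v
dot-shift-neg g v e K ge = trans (dot-neg g (v ⊖ scale K e))
  (trans (cong -_ (trans (dot-⊖ g v (scale K e)) (cong (λ k → dot g v - k) (trans (dot-scale g K e) (cong (K *_) ge)))))
  (solve 2 (λ h K → :- (h :- K :* con (+ 1)) := K :- h) refl (dot g v) K))

det3-shift : ∀ e v w K → ∣ det3 (scale (- + 1) e) (v ⊖ scale K e) (w ⊖ scale K e) ∣ ≡ ∣ det3 e v w ∣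
det3-shift e v w K = trans (cong ∣_∣ (prove (e ▸ v ▸ w ▸ K ∷ [])
  (det3′ (scale′ (con (- + 1)) V₀) (V₁ ⊖′ scale′ (ν 9) V₀) (V₂ ⊖′ scale′ (ν 9) V₀)) (:- det3′ V₀ V₁ V₂) refl))
  (ℤₚ.∣-i∣≡∣i∣ (det3 e v w))

positive : ∀ {k} n → k ≡ + ℕ.suc n → + 0 < k
positive n refl = +<+ (s≤s z≤n)

-- Normal forms of the two families

tetrahedron₂ tetrahedron₃ : ℤ → List Pt
tetrahedron₂ z = (+ 1 , - + 1 , + 0) ∷ (- + 1 , + 1 , + 0) ∷ (- + 1 , - + 1 , + 1) ∷ (+ 0 , + 0 , z) ∷ []
tetrahedron₃ z = (+ 2 , - + 1 , + 1) ∷ (- + 1 , + 2 , - + 1) ∷ (- + 1 , - + 1 , + 0) ∷ (+ 0 , + 0 , z) ∷ []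

-- In projection along `e` the points `v₁` and `v₂` are opposite to each other, and `f₁`, `f₂`
-- define the lines through `v₃` and one of them. `c` is the height of the midpoint of `v₁` and
-- `v₂`. `odd` reflects that the midpoint of `v₁` and `v₃` is not a lattice point.
record T2Data (e g v₁ v₂ v₃ f₁ f₂ : Pt) (c : ℤ) : Set where
  field
    f₁e : dot f₁ e ≡ + 0
    f₂e : dot f₂ e ≡ + 0
    f₁v₁ : dot f₁ v₁ ≡ - + 1
    f₁v₂ : dot f₁ v₂ ≡ + 1
    f₁v₃ : dot f₁ v₃ ≡ + 1
    f₂v₁ : dot f₂ v₁ ≡ + 1
    f₂v₂ : dot f₂ v₂ ≡ - + 1
    f₂v₃ : dot f₂ v₃ ≡ + 1
    det : ∣ det3 e v₁ v₃ ∣ ≡ 2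
    k : ℤ
    odd : dot g v₁ ≡ dot g v₃ + (+ 2 * k + + 1)
    sum : v₁ ⊕ v₂ ≡ scale (+ 2 * c) e

-- The projection is the reflexive triangle with three edges of lattice length three; each
-- functional defines the edge opposite to the vertex where it is -2. `c` is the height of the
-- centroid, and `residue` says that `v₁` and `v₃` have heights incongruent modulo 3.
record T3Data (e g v₁ v₂ v₃ f₁ f₂ f₃ : Pt) (c : ℤ) : Set where
  field
    f₁e : dot f₁ e ≡ + 0
    f₂e : dot f₂ e ≡ + 0
    f₃e : dot f₃ e ≡ + 0
    f₁v₁ : dot f₁ v₁ ≡ - + 2
    f₁v₂ : dot f₁ v₂ ≡ + 1
    f₁v₃ : dot f₁ v₃ ≡ + 1
    f₂v₁ : dot f₂ v₁ ≡ + 1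
    f₂v₂ : dot f₂ v₂ ≡ - + 2
    f₂v₃ : dot f₂ v₃ ≡ + 1
    f₃v₁ : dot f₃ v₁ ≡ + 1
    f₃v₂ : dot f₃ v₂ ≡ + 1
    f₃v₃ : dot f₃ v₃ ≡ - + 2
    det : ∣ det3 e v₁ v₂ ∣ ≡ 3
    k : ℤ
    residue : (dot g v₁ ≡ dot g v₃ + (+ 3 * k + + 1)) ⊎ (dot g v₁ ≡ dot g v₃ + (+ 3 * k + + 2))
    sum : v₁ ⊕ (v₂ ⊕ v₃) ≡ scale (+ 3 * c) e

module _ {e g v₁ v₂ v₃ : Pt} (K : ℤ) (ge : dot g e ≡ + 1) where
  private
    e′ g′ w₁ w₂ w₃ : Pt
    e′ = scale (- + 1) e
    g′ = scale (- + 1) g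
    w₁ = v₁ ⊖ scale K e
    w₂ = v₂ ⊖ scale K e
    w₃ = v₃ ⊖ scale K e

    neg-e : ∀ f → dot f e ≡ + 0 → dot f e′ ≡ + 0
    neg-e f fe = trans (dot-scale f (- + 1) e) (cong (- + 1 *_) fe)

    flip-height : ∀ r → dot g v₁ ≡ dot g v₃ + r → dot g′ w₁ ≡ dot g′ w₃ + - r
    flip-height r eq = trans (dot-shift-neg g v₁ e K ge) (trans (cong (λ h → K - h) eq)
      (trans (solve 3 (λ K h r → K :- (h :+ r) := (K :- h) :+ :- r) refl K (dot g v₃) r)
        (cong (_+ - r) (sym (dot-shift-neg g v₃ e K ge)))))

  flip₂ : ∀ {f₁ f₂ c} → T2Data e g v₁ v₂ v₃ f₁ f₂ c → T2Data e′ g′ w₁ w₂ w₃ f₁ f₂ (K - c)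
  flip₂ {f₁} {f₂} {c} D = record
    { f₁e = neg-e f₁ f₁e ; f₂e = neg-e f₂ f₂e
    ; f₁v₁ = dot-shift f₁ v₁ e K f₁e f₁v₁ ; f₁v₂ = dot-shift f₁ v₂ e K f₁e f₁v₂ ; f₁v₃ = dot-shift f₁ v₃ e K f₁e f₁v₃
    ; f₂v₁ = dot-shift f₂ v₁ e K f₂e f₂v₁ ; f₂v₂ = dot-shift f₂ v₂ e K f₂e f₂v₂ ; f₂v₃ = dot-shift f₂ v₃ e K f₂e f₂v₃
    ; det = trans (det3-shift e v₁ v₃ K) det
    -- The height difference changes sign, and `-(2k + 1) = 2(-k - 1) + 1`.
    ; k = - k - + 1
    ; odd = trans (flip-height (+ 2 * k + + 1) odd) (cong (λ r → dot g′ w₃ + r)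
      (solve 1 (λ k → :- (con (+ 2) :* k :+ con (+ 1)) := con (+ 2) :* (:- k :- con (+ 1)) :+ con (+ 1)) refl k))
    ; sum = trans (proveᵥ (e ▸ v₁ ▸ v₂ ▸ K ∷ []) ((V₁ ⊖′ scale′ (ν 9) V₀) ⊕′ (V₂ ⊖′ scale′ (ν 9) V₀))
      ((V₁ ⊕′ V₂) ⊖′ scale′ (con (+ 2) :* ν 9) V₀) refl refl refl)
        (trans (cong (_⊖ scale (+ 2 * K) e) sum) (proveᵥ (e ▸ K ∷ c ∷ [])
          (scale′ (con (+ 2) :* ν 4) V₀ ⊖′ scale′ (con (+ 2) :* ν 3) V₀)
          (scale′ (con (+ 2) :* (ν 3 :- ν 4)) (scale′ (con (- + 1)) V₀)) refl refl refl)) }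
    where open T2Data D

  flip₃ : ∀ {f₁ f₂ f₃ c} → T3Data e g v₁ v₂ v₃ f₁ f₂ f₃ c → T3Data e′ g′ w₁ w₂ w₃ f₁ f₂ f₃ (K - c)
  flip₃ {f₁} {f₂} {f₃} {c} D = record
    { f₁e = neg-e f₁ f₁e ; f₂e = neg-e f₂ f₂e ; f₃e = neg-e f₃ f₃e
    ; f₁v₁ = dot-shift f₁ v₁ e K f₁e f₁v₁ ; f₁v₂ = dot-shift f₁ v₂ e K f₁e f₁v₂ ; f₁v₃ = dot-shift f₁ v₃ e K f₁e f₁v₃
    ; f₂v₁ = dot-shift f₂ v₁ e K f₂e f₂v₁ ; f₂v₂ = dot-shift f₂ v₂ e K f₂e f₂v₂ ; f₂v₃ = dot-shift f₂ v₃ e K f₂e f₂v₃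
    ; f₃v₁ = dot-shift f₃ v₁ e K f₃e f₃v₁ ; f₃v₂ = dot-shift f₃ v₂ e K f₃e f₃v₂ ; f₃v₃ = dot-shift f₃ v₃ e K f₃e f₃v₃
    ; det = trans (det3-shift e v₁ v₂ K) det
    ; k = - k - + 1
    ; residue = flip-residue residue
    ; sum = trans (proveᵥ (e ▸ v₁ ▸ v₂ ▸ v₃ ▸ K ∷ []) ((V₁ ⊖′ scale′ (ν 12) V₀) ⊕′
      ((V₂ ⊖′ scale′ (ν 12) V₀) ⊕′ (V₃ ⊖′ scale′ (ν 12) V₀)))
          ((V₁ ⊕′ (V₂ ⊕′ V₃)) ⊖′ scale′ (con (+ 3) :* ν 12) V₀) refl refl refl)
        (trans (cong (_⊖ scale (+ 3 * K) e) sum) (proveᵥ (e ▸ K ∷ c ∷ [])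
          (scale′ (con (+ 3) :* ν 4) V₀ ⊖′ scale′ (con (+ 3) :* ν 3) V₀)
          (scale′ (con (+ 3) :* (ν 3 :- ν 4)) (scale′ (con (- + 1)) V₀)) refl refl refl)) }
    where
    open T3Data D
    flip-residue : (dot g v₁ ≡ dot g v₃ + (+ 3 * k + + 1)) ⊎ (dot g v₁ ≡ dot g v₃ + (+ 3 * k + + 2)) →
      (dot g′ w₁ ≡ dot g′ w₃ + (+ 3 * (- k - + 1) + + 1)) ⊎ (dot g′ w₁ ≡ dot g′ w₃ + (+ 3 * (- k - + 1) + + 2))
    flip-residue (inj₁ eq) = inj₂ (trans (flip-height (+ 3 * k + + 1) eq)
      (cong (λ r → dot g′ w₃ + r) (solve 1 (λ k → :- (con (+ 3) :* k :+ con (+ 1)) := con (+ 3) :* (:- k :- con (+ 1)) :+ con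
      (+ 2)) refl k)))
    flip-residue (inj₂ eq) = inj₁ (trans (flip-height (+ 3 * k + + 2) eq)
      (cong (λ r → dot g′ w₃ + r) (solve 1 (λ k → :- (con (+ 3) :* k :+ con (+ 2)) := con (+ 3) :* (:- k :- con (+ 1)) :+ con
      (+ 1)) refl k)))

swap-spine : ∀ {L o e g K v₁ v₂ v₃} → Spine L o e g K v₁ v₂ v₃ → Spine L o e g K v₃ v₂ v₁
swap-spine {L} {o} {e} {K = K} {v₁} {v₂} {v₃} spine = record
  { ge = ge ; on = on ; on₁ = on₃ ; on₂ = on₂ ; on₃ = on₁ ; cover = λ x∈ → permute (cover x∈) }
  where
  open Spine spine
  permute : ∀ {x} → Place o e K v₁ v₂ v₃ x →
    Place o e K v₃ v₂ v₁ x
  permute (inj₁ p) = inj₁ p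
  permute (inj₂ (inj₁ p)) = inj₂ (inj₂ (inj₂ p))
  permute (inj₂ (inj₂ (inj₁ p))) = inj₂ (inj₂ (inj₁ p))
  permute (inj₂ (inj₂ (inj₂ p))) = inj₂ (inj₁ p)

module _ {L o e g K v₁ v₂ v₃} (spine : Spine L o e g K v₁ v₂ v₃) where
  open Spine spine using (ge)

  -- The functional takes the value 2c at v₁ and v₂, and 2 at v₃ and e.
  T2-vertex : ∀ {f₁ f₂} j → T2Data e g v₁ v₂ v₃ f₁ f₂ (+ ℕ.suc j) → Vertex L o
  T2-vertex {f₁} {f₂} j D = spine-vertex spine c
      (positive 1 (trans (dot-combination (+ 2) α β g f₁ f₂ e ge f₁e f₂e)
        (solve 2 (λ α β → con (+ 2) :* con (+ 1) :+ (α :* con (+ 0) :+ β :* con (+ 0)) := con (+ 2)) refl α β)))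
      (positive (j ℕ.+ ℕ.suc (j ℕ.+ 0)) (trans (dot-combination (+ 2) α β g f₁ f₂ v₁ refl f₁v₁ f₂v₁)
        (solve 3 (λ h₁ h₃ c → con (+ 2) :* h₁ :+ ((c :- h₁ :- h₃ :+ con (+ 1) :+ con (+ 2) :* h₁ :- con (+ 2) :* c) :* con
          (- + 1) :+ (c :- h₁ :- h₃ :+ con (+ 1)) :* con (+ 1)) := con (+ 2) :* c) refl h₁ h₃ (+ ℕ.suc j))))
      (positive (j ℕ.+ ℕ.suc (j ℕ.+ 0)) (trans (dot-combination (+ 2) α β g f₁ f₂ v₂ refl f₁v₂ f₂v₂)
        (trans (cong (λ h → + 2 * h + (α * + 1 + β * - + 1)) h₂≡)
        (solve 3 (λ h₁ h₃ c → con (+ 2) :* (con (+ 2) :* c :- h₁) :+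
          ((c :- h₁ :- h₃ :+ con (+ 1) :+ con (+ 2) :* h₁ :- con (+ 2) :* c) :* con (+ 1) :+ (c :- h₁ :- h₃ :+ con (+ 1)) :* con
          (- + 1)) := con (+ 2) :* c) refl h₁ h₃ (+ ℕ.suc j)))))
      (positive 1 (trans (dot-combination (+ 2) α β g f₁ f₂ v₃ refl f₁v₃ f₂v₃)
        (solve 3 (λ h₁ h₃ c → con (+ 2) :* h₃ :+ ((c :- h₁ :- h₃ :+ con (+ 1) :+ con (+ 2) :* h₁ :- con (+ 2) :* c) :* con (+ 1)
          :+ (c :- h₁ :- h₃ :+ con (+ 1)) :* con (+ 1)) := con (+ 2)) refl h₁ h₃ (+ ℕ.suc j))))
    where
    open T2Data D
    h₁ h₃ α β : ℤ
    h₁ = dot g v₁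
    h₃ = dot g v₃
    β = + ℕ.suc j - h₁ - h₃ + + 1
    α = β + + 2 * h₁ - + 2 * + ℕ.suc j
    c : Pt
    c = scale (+ 2) g ⊕ (scale α f₁ ⊕ scale β f₂)
    h₂≡ : dot g v₂ ≡ + 2 * + ℕ.suc j - h₁
    h₂≡ = linear₁ {dot g v₂} {+ 2 * + ℕ.suc j - h₁} {dot g v₁ + dot g v₂} {+ 2 * + ℕ.suc j * + 1} (+ 1)
      (solve 3 (λ h₂ h₁ c → h₂ :- (con (+ 2) :* c :- h₁) := con (+ 1) :* ((h₁ :+ h₂) :- con (+ 2) :* c :* con (+ 1))) refl
        (dot g v₂) h₁ (+ ℕ.suc j))
      (trans (sym (dot-⊕ g v₁ v₂)) (trans (cong (dot g) sum)
        (trans (dot-scale g (+ 2 * + ℕ.suc j) e) (cong (+ 2 * + ℕ.suc j *_) ge))))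

  -- The functional takes the value 3c at v₁, v₂ and v₃, and 3 at e.
  T3-vertex : ∀ {f₁ f₂ f₃} j → T3Data e g v₁ v₂ v₃ f₁ f₂ f₃ (+ ℕ.suc j) → Vertex L o
  T3-vertex {f₁} {f₂} {f₃} j D = spine-vertex spine c
      (positive 2 (trans (dot-combination (+ 3) α β g f₁ f₂ e ge f₁e f₂e)
        (solve 2 (λ α β → con (+ 3) :* con (+ 1) :+ (α :* con (+ 0) :+ β :* con (+ 0)) := con (+ 3)) refl α β)))
      (value v₁ refl f₁v₁ f₂v₁ (solve 3 (λ h₁ h₂ h₃ → con (+ 3) :* h₁ :+ ((h₁ :- h₃) :* con (- + 2) :+ (h₂ :- h₃) :* con (+ 1))
        := h₁ :+ (h₂ :+ h₃)) refl h₁ h₂ h₃))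
      (value v₂ refl f₁v₂ f₂v₂ (solve 3 (λ h₁ h₂ h₃ → con (+ 3) :* h₂ :+ ((h₁ :- h₃) :* con (+ 1) :+ (h₂ :- h₃) :* con (- + 2))
        := h₁ :+ (h₂ :+ h₃)) refl h₁ h₂ h₃))
      (value v₃ refl f₁v₃ f₂v₃ (solve 3 (λ h₁ h₂ h₃ → con (+ 3) :* h₃ :+ ((h₁ :- h₃) :* con (+ 1) :+ (h₂ :- h₃) :* con (+ 1)) :=
        h₁ :+ (h₂ :+ h₃)) refl h₁ h₂ h₃))
    where
    open T3Data D
    h₁ h₂ h₃ α β : ℤ
    h₁ = dot g v₁
    h₂ = dot g v₂
    h₃ = dot g v₃
    α = h₁ - h₃
    β = h₂ - h₃
    c : Pt
    c = scale (+ 3) g ⊕ (scale α f₁ ⊕ scale β f₂)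
    total : h₁ + (h₂ + h₃) ≡ + 3 * + ℕ.suc j
    total = trans (sym (trans (dot-⊕ g v₁ (v₂ ⊕ v₃)) (cong (λ k → h₁ + k) (dot-⊕ g v₂ v₃)))) (trans (cong (dot g) sum)
      (trans (dot-scale g (+ 3 * + ℕ.suc j) e) (trans (cong (+ 3 * + ℕ.suc j *_) ge) (ℤₚ.*-identityʳ (+ 3 * + ℕ.suc j)))))
    value : ∀ v {h p q} → dot g v ≡ h → dot f₁ v ≡ p → dot f₂ v ≡ q → + 3 * h + (α * p + β * q) ≡ h₁ + (h₂ + h₃) → + 0 < dot c v
    value v gv f₁v f₂v eq = positive (j ℕ.+ ℕ.suc (j ℕ.+ ℕ.suc (j ℕ.+ 0)))
      (trans (dot-combination (+ 3) α β g f₁ f₂ v gv f₁v f₂v) (trans eq total))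

module _ {A : PtSet} {L : List Pt} (to : ∀ {x} → InConv A x → x ∈ L) (from : ∀ {x} → x ∈ L → InConv A x) where

  T2-final : ∀ {o e g K v₁ v₂ v₃ f₁ f₂} → Spine L o e g K v₁ v₂ v₃ → 1 ℕ.≤ K → T2Data e g v₁ v₂ v₃ f₁ f₂ (+ 0) →
    SublatticeIndex A 2 × UnimodEquiv A (_∈ tetrahedron₂ (+ K))
  T2-final {o} {e} {g} {K} {v₁} {v₂} {v₃} {f₁} {f₂} spine 1≤K D =
    sublattice-index to from spine v₁ v₃ 2 1≤K on₁ on₃
      (+ 1 , + 0 , + 0 , proveᵥ (v₁ ▸ v₃ ▸ e ▸ []) V₀ (scale′ (con (+ 1)) V₀ ⊕′ (scale′ (con (+ 0)) V₁ ⊕′ scale′ (con (+ 0)) V₂))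
        refl refl refl)
      (- + 1 , + 0 , + 0 , trans v₂≡ (proveᵥ (v₁ ▸ v₃ ▸ e ▸ []) (scale′ (con (- + 1)) V₀)
        (scale′ (con (- + 1)) V₀ ⊕′ (scale′ (con (+ 0)) V₁ ⊕′ scale′ (con (+ 0)) V₂)) refl refl refl))
      (+ 0 , + 1 , + 0 , proveᵥ (v₁ ▸ v₃ ▸ e ▸ []) V₁ (scale′ (con (+ 0)) V₀ ⊕′ (scale′ (con (+ 1)) V₁ ⊕′ scale′ (con (+ 0)) V₂))
        refl refl refl)
      (trans (cong ∣_∣ (prove (v₁ ▸ v₃ ▸ e ▸ []) (det3′ V₀ V₁ V₂) (det3′ V₂ V₀ V₁) refl)) det) ,
    equivalence to from spine r₁ r₂ r₃ (+ 1 , - + 1 , + 0) (- + 1 , + 1 , + 0) (- + 1 , - + 1 , + 1) unit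
      (pt≡ r₁e r₂e r₃e)
      (pt≡ (neg f₁ v₁ f₁v₁) (neg f₂ v₁ f₂v₁) (trans (dot-combination (+ 1) α β g f₁ f₂ v₁ refl f₁v₁ f₂v₁)
        (solve 2 (λ h k → con (+ 1) :* h :+ ((k :+ con (+ 1)) :* con (- + 1) :+ (k :+ con (+ 1) :- h) :* con (+ 1)) := con (+ 0))
          refl h₁ k)))
      (pt≡ (neg f₁ v₂ f₁v₂) (neg f₂ v₂ f₂v₂) (trans (dot-combination (+ 1) α β g f₁ f₂ v₂
        (trans (cong (dot g) v₂≡) (dot-scale g (- + 1) v₁)) f₁v₂ f₂v₂)
        (solve 2 (λ h k → con (+ 1) :* (con (- + 1) :* h) :+
          ((k :+ con (+ 1)) :* con (+ 1) :+ (k :+ con (+ 1) :- h) :* con (- + 1)) := con (+ 0)) refl h₁ k)))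
      (pt≡ (neg f₁ v₃ f₁v₃) (neg f₂ v₃ f₂v₃) (trans (dot-combination (+ 1) α β g f₁ f₂ v₃ refl f₁v₃ f₂v₃)
        (trans (cong (λ h → + 1 * dot g v₃ + (α * + 1 + (α - h) * + 1)) odd)
          (solve 2 (λ h k → con (+ 1) :* h :+ ((k :+ con (+ 1)) :* con (+ 1) :+
            (k :+ con (+ 1) :- (h :+ (con (+ 2) :* k :+ con (+ 1)))) :* con (+ 1)) := con (+ 1)) refl (dot g v₃) k))))
      ((1 , (+ 1 , - + 1 , + 0)) ∷ (1 , (- + 1 , + 1 , + 0)) ∷ [] , here refl ∷ there (here refl) ∷ [] , s≤s z≤n , refl)
    where
    open Spine spine
    open T2Data D
    h₁ α β : ℤ
    h₁ = dot g v₁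
    -- Solved from the values 0 of `r₃` at `v₁` and 1 at `v₃`. These require `α` to be half of
    -- `h₁ - h₃ + 1` with `h₃` the height of `v₃`, an integer because the difference is odd.
    α = k + + 1
    β = α - h₁
    r₁ r₂ r₃ : Pt
    r₁ = scale (- + 1) f₁
    r₂ = scale (- + 1) f₂
    r₃ = scale (+ 1) g ⊕ (scale α f₁ ⊕ scale β f₂)
    neg : ∀ f v {m} → dot f v ≡ m → dot (scale (- + 1) f) v ≡ - m
    neg f v fv = trans (dot-neg f v) (cong -_ fv)
    r₁e : dot r₁ e ≡ + 0
    r₁e = neg f₁ e f₁e
    r₂e : dot r₂ e ≡ + 0
    r₂e = neg f₂ e f₂e
    r₃e : dot r₃ e ≡ + 1
    r₃e = trans (dot-combination (+ 1) α β g f₁ f₂ e ge f₁e f₂e)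
      (solve 2 (λ α β → con (+ 1) :* con (+ 1) :+ (α :* con (+ 0) :+ β :* con (+ 0)) := con (+ 1)) refl α β)
    v₂≡ : v₂ ≡ scale (- + 1) v₁
    v₂≡ = ⊖≡origin v₂ (scale (- + 1) v₁) (trans (proveᵥ (v₁ ▸ v₂ ▸ []) (V₁ ⊖′ scale′ (con (- + 1)) V₀) (V₀ ⊕′ V₁) refl refl refl)
      sum)
    d≢0 : det3 e v₁ v₃ ≢ + 0
    d≢0 z = zero≢two (trans (sym (cong ∣_∣ z)) det)
      where
      zero≢two : 0 ≢ 2
      zero≢two ()
    unit : ∣ det3 r₁ r₂ r₃ ∣ ≡ 1
    unit = ∣∣-divide (det3 r₁ r₂ r₃) (det3 e v₁ v₃) (- + 2) (trans (rows-determinant e g r₁ r₂ r₃ v₁ v₃ ge r₁e r₂e r₃e)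
      (cong₂ _-_ (cong₂ _*_ (neg f₁ v₁ f₁v₁) (neg f₂ v₃ f₂v₃)) (cong₂ _*_ (neg f₁ v₃ f₁v₃) (neg f₂ v₁ f₂v₁)))) det d≢0

  private
    T3-final₁ : ∀ {o e g K v₁ v₂ v₃ f₁ f₂ f₃} → Spine L o e g K v₁ v₂ v₃ → 1 ℕ.≤ K → T3Data e g v₁ v₂ v₃ f₁ f₂ f₃ (+ 0) →
      ∀ k → dot g v₁ ≡ dot g v₃ + (+ 3 * k + + 1) →
      SublatticeIndex A 3 × UnimodEquiv A (_∈ tetrahedron₃ (+ K))
    T3-final₁ {o} {e} {g} {K} {v₁} {v₂} {v₃} {f₁} {f₂} {f₃} spine 1≤K D k residue₁ =
      sublattice-index to from spine v₁ v₂ 3 1≤K on₁ on₂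
        (+ 1 , + 0 , + 0 , proveᵥ (v₁ ▸ v₂ ▸ e ▸ []) V₀ (scale′ (con (+ 1)) V₀ ⊕′
          (scale′ (con (+ 0)) V₁ ⊕′ scale′ (con (+ 0)) V₂)) refl refl refl)
        (+ 0 , + 1 , + 0 , proveᵥ (v₁ ▸ v₂ ▸ e ▸ []) V₁ (scale′ (con (+ 0)) V₀ ⊕′
          (scale′ (con (+ 1)) V₁ ⊕′ scale′ (con (+ 0)) V₂)) refl refl refl)
        (- + 1 , - + 1 , + 0 , trans v₃≡ (proveᵥ (v₁ ▸ v₂ ▸ e ▸ []) (scale′ (con (- + 1)) (V₀ ⊕′ V₁))
          (scale′ (con (- + 1)) V₀ ⊕′ (scale′ (con (- + 1)) V₁ ⊕′ scale′ (con (+ 0)) V₂)) refl refl refl))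
        (trans (cong ∣_∣ (prove (v₁ ▸ v₂ ▸ e ▸ []) (det3′ V₀ V₁ V₂) (det3′ V₂ V₀ V₁) refl)) det) ,
      equivalence to from spine r₁ r₂ r₃ (+ 2 , - + 1 , + 1) (- + 1 , + 2 , - + 1) (- + 1 , - + 1 , + 0) unit
        (pt≡ r₁e r₂e r₃e)
        (pt≡ (neg f₁ v₁ f₁v₁) (neg f₂ v₁ f₂v₁) (trans (dot-combination (+ 1) k β g f₁ f₂ v₁ residue₁ f₁v₁ f₂v₁)
          (solve 2 (λ h k → con (+ 1) :* (h :+ (con (+ 3) :* k :+ con (+ 1))) :+ (k :* con (- + 2) :+ (:- (h :+ k)) :* con (+ 1))
            := con (+ 1)) refl h₃ k)))
        (pt≡ (neg f₁ v₂ f₁v₂) (neg f₂ v₂ f₂v₂) (trans (dot-combination (+ 1) k β g f₁ f₂ v₂ h₂≡ f₁v₂ f₂v₂)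
          (solve 2 (λ h k → con (+ 1) :* (:- (h :+ (con (+ 3) :* k :+ con (+ 1))) :- h) :+
            (k :* con (+ 1) :+ (:- (h :+ k)) :* con (- + 2)) := con (- + 1)) refl h₃ k)))
        (pt≡ (neg f₁ v₃ f₁v₃) (neg f₂ v₃ f₂v₃) (trans (dot-combination (+ 1) k β g f₁ f₂ v₃ refl f₁v₃ f₂v₃)
          (solve 2 (λ h k → con (+ 1) :* h :+ (k :* con (+ 1) :+ (:- (h :+ k)) :* con (+ 1)) := con (+ 0)) refl h₃ k)))
        ((1 , (+ 2 , - + 1 , + 1)) ∷ (1 , (- + 1 , + 2 , - + 1)) ∷ (1 , (- + 1 , - + 1 , + 0)) ∷ [] , here refl ∷ there
          (here refl) ∷ there (there (here refl)) ∷ [] , s≤s z≤n , refl)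
      where
      open Spine spine
      open T3Data D hiding (k)
      h₃ β : ℤ
      h₃ = dot g v₃
      -- This makes `r₃` vanish at `v₃`. Its value at `v₁` is then the height difference minus
      -- `3 * k`, which is 1 in this residue class.
      β = - (h₃ + k)
      r₁ r₂ r₃ : Pt
      r₁ = scale (- + 1) f₁
      r₂ = scale (- + 1) f₂
      r₃ = scale (+ 1) g ⊕ (scale k f₁ ⊕ scale β f₂)
      neg : ∀ f v {m} → dot f v ≡ m → dot (scale (- + 1) f) v ≡ - m
      neg f v fv = trans (dot-neg f v) (cong -_ fv)
      r₁e : dot r₁ e ≡ + 0
      r₁e = neg f₁ e f₁e
      r₂e : dot r₂ e ≡ + 0
      r₂e = neg f₂ e f₂e
      r₃e : dot r₃ e ≡ + 1
      r₃e = trans (dot-combination (+ 1) k β g f₁ f₂ e ge f₁e f₂e)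
        (solve 2 (λ α β → con (+ 1) :* con (+ 1) :+ (α :* con (+ 0) :+ β :* con (+ 0)) := con (+ 1)) refl k β)
      v₃≡ : v₃ ≡ scale (- + 1) (v₁ ⊕ v₂)
      v₃≡ = ⊖≡origin v₃ (scale (- + 1) (v₁ ⊕ v₂)) (trans (proveᵥ (v₁ ▸ v₂ ▸ v₃ ▸ []) (V₂ ⊖′ scale′ (con (- + 1)) (V₀ ⊕′ V₁))
        (V₀ ⊕′ (V₁ ⊕′ V₂)) refl refl refl) sum)
      v₂≡ : v₂ ≡ scale (- + 1) v₁ ⊖ v₃
      v₂≡ = ⊖≡origin v₂ (scale (- + 1) v₁ ⊖ v₃) (trans (proveᵥ (v₁ ▸ v₂ ▸ v₃ ▸ []) (V₁ ⊖′ (scale′ (con (- + 1)) V₀ ⊖′ V₂))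
        (V₀ ⊕′ (V₁ ⊕′ V₂)) refl refl refl) sum)
      h₂≡ : dot g v₂ ≡ - (h₃ + (+ 3 * k + + 1)) - h₃
      h₂≡ = trans (cong (dot g) v₂≡) (trans (dot-⊖ g (scale (- + 1) v₁) v₃)
        (cong (_- h₃) (trans (dot-scale g (- + 1) v₁) (trans (ℤₚ.-1*i≡-i (dot g v₁)) (cong -_ residue₁)))))
      d≢0 : det3 e v₁ v₂ ≢ + 0
      d≢0 z = zero≢three (trans (sym (cong ∣_∣ z)) det)
        where
        zero≢three : 0 ≢ 3
        zero≢three ()
      unit : ∣ det3 r₁ r₂ r₃ ∣ ≡ 1
      unit = ∣∣-divide (det3 r₁ r₂ r₃) (det3 e v₁ v₂) (+ 3) (trans (rows-determinant e g r₁ r₂ r₃ v₁ v₂ ge r₁e r₂e r₃e)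
        (cong₂ _-_ (cong₂ _*_ (neg f₁ v₁ f₁v₁) (neg f₂ v₂ f₂v₂)) (cong₂ _*_ (neg f₁ v₂ f₁v₂) (neg f₂ v₁ f₂v₁)))) det d≢0

    swap-data : ∀ {e g v₁ v₂ v₃ f₁ f₂ f₃} → T3Data e g v₁ v₂ v₃ f₁ f₂ f₃ (+ 0) → ∀ k → dot g v₃ ≡ dot g v₁ + (+ 3 * k + + 1) →
      T3Data e g v₃ v₂ v₁ f₃ f₂ f₁ (+ 0)
    swap-data {e} {g} {v₁} {v₂} {v₃} D k eq = record
      { f₁e = f₃e ; f₂e = f₂e ; f₃e = f₁e ; f₁v₁ = f₃v₃ ; f₁v₂ = f₃v₂ ; f₁v₃ = f₃v₁ ; f₂v₁ = f₂v₃ ; f₂v₂ = f₂v₂ ; f₂v₃ = f₂v₁ ;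
        f₃v₁ = f₁v₃ ; f₃v₂ = f₁v₂ ; f₃v₃ = f₁v₁
      ; det = trans (cong ∣_∣ (trans (cong (λ v → det3 e v v₂) v₃≡)
        (prove (e ▸ v₁ ▸ v₂ ▸ []) (det3′ V₀ (scale′ (con (- + 1)) (V₁ ⊕′ V₂)) V₂) (:- det3′ V₀ V₁ V₂) refl)))
          (trans (ℤₚ.∣-i∣≡∣i∣ (det3 e v₁ v₂)) det)
      ; k = k ; residue = inj₁ eq
      ; sum = trans (proveᵥ (v₁ ▸ v₂ ▸ v₃ ▸ []) (V₂ ⊕′ (V₁ ⊕′ V₀)) (V₀ ⊕′ (V₁ ⊕′ V₂)) refl refl refl) sum }
      where
      open T3Data D hiding (k)
      v₃≡ : v₃ ≡ scale (- + 1) (v₁ ⊕ v₂)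
      v₃≡ = ⊖≡origin v₃ (scale (- + 1) (v₁ ⊕ v₂)) (trans (proveᵥ (v₁ ▸ v₂ ▸ v₃ ▸ []) (V₂ ⊖′ scale′ (con (- + 1)) (V₀ ⊕′ V₁))
        (V₀ ⊕′ (V₁ ⊕′ V₂)) refl refl refl) sum)

  -- Exchanging `v₁` and `v₃` turns residue 2 into residue 1, so both classes lead to the same
  -- normal form.
  T3-final : ∀ {o e g K v₁ v₂ v₃ f₁ f₂ f₃} → Spine L o e g K v₁ v₂ v₃ → 1 ℕ.≤ K → T3Data e g v₁ v₂ v₃ f₁ f₂ f₃ (+ 0) →
    SublatticeIndex A 3 × UnimodEquiv A (_∈ tetrahedron₃ (+ K))
  T3-final {o} {e} {g} {K} {v₁} {v₂} {v₃} spine 1≤K D = by-residue (T3Data.residue D)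
    where
    open T3Data D using (k)
    by-residue : (dot g v₁ ≡ dot g v₃ + (+ 3 * k + + 1)) ⊎ (dot g v₁ ≡ dot g v₃ + (+ 3 * k + + 2)) →
      SublatticeIndex A 3 × UnimodEquiv A (_∈ tetrahedron₃ (+ K))
    by-residue (inj₁ eq) = T3-final₁ spine 1≤K D k eq
    by-residue (inj₂ eq) = T3-final₁ (swap-spine spine) 1≤K (swap-data D (- k - + 1) swapped) (- k - + 1) swapped
      where
      swapped : dot g v₃ ≡ dot g v₁ + (+ 3 * (- k - + 1) + + 1)
      swapped = trans (solve 2 (λ h k → h := h :+ (con (+ 3) :* k :+ con (+ 2)) :+
        (con (+ 3) :* (:- k :- con (+ 1)) :+ con (+ 1))) refl (dot g v₃) k)
        (cong (_+ (+ 3 * (- k - + 1) + + 1)) (sym eq))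

-- Arithmetic of the edge lengths

Products∣Sum : ℤ → ℤ → ℤ → Set
Products∣Sum a b c = (a * c ∣ℤ a + (b + c)) × (b * a ∣ℤ a + (b + c)) × (c * b ∣ℤ a + (b + c))

EvenOrThree : ℤ → ℤ → ℤ → Set
EvenOrThree a b c = ((+ 2 ∣ℤ a) × (+ 2 ∣ℤ b) × (+ 2 ∣ℤ c)) ⊎ (a ≡ b × b ≡ c × ∣ a ∣ ≡ 3)

private
  ≤3 ≤6 : List ℤ
  ≤3 = + 2 ∷ + 3 ∷ - + 2 ∷ - + 3 ∷ []
  ≤6 = + 2 ∷ + 3 ∷ + 4 ∷ + 5 ∷ + 6 ∷ - + 2 ∷ - + 3 ∷ - + 4 ∷ - + 5 ∷ - + 6 ∷ []

  Excluded : ℤ → ℤ → ℤ → Set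
  Excluded a b c = ¬ (Products∣Sum a b c × a + (b + c) ≢ + 0)

  excluded? : ∀ a b c → Dec (Excluded a b c)
  excluded? a b c = ¬? (((a * c ∣ℤ? a + (b + c)) ×-dec ((b * a ∣ℤ? a + (b + c)) ×-dec (c * b ∣ℤ? a + (b + c)))) ×-dec ¬?
    (a + (b + c) ≟ + 0))

  evenOrThree? : ∀ a b c → Dec (EvenOrThree a b c)
  evenOrThree? a b c = ((+ 2 ∣ℤ? a) ×-dec ((+ 2 ∣ℤ? b) ×-dec (+ 2 ∣ℤ? c))) ⊎-dec ((a ≟ b) ×-dec ((b ≟ c) ×-dec (∣ a ∣ ℕ.≟ 3)))

  table : All (λ a → All (λ b → All (λ c → EvenOrThree a b c ⊎ Excluded a b c) ≤6) ≤3) ≤3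
  table = from-yes (all? (λ a → all? (λ b → all? (λ c → evenOrThree? a b c ⊎-dec excluded? a b c) ≤6) ≤3) ≤3)

  ∈≤3 : ∀ a → 2 ℕ.≤ ∣ a ∣ → ∣ a ∣ ℕ.≤ 3 → a ∈ ≤3
  ∈≤3 (+ 2) _ _ = here refl
  ∈≤3 (+ 3) _ _ = there (here refl)
  ∈≤3 -[1+ 1 ] _ _ = there (there (here refl))
  ∈≤3 -[1+ 2 ] _ _ = there (there (there (here refl)))
  ∈≤3 (+ 0) () _
  ∈≤3 (+ 1) (s≤s ()) _
  ∈≤3 -[1+ 0 ] (s≤s ()) _
  ∈≤3 (+ ℕ.suc (ℕ.suc (ℕ.suc (ℕ.suc _)))) _ (s≤s (s≤s (s≤s ())))
  ∈≤3 -[1+ ℕ.suc (ℕ.suc (ℕ.suc _)) ] _ (s≤s (s≤s (s≤s ())))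

  ∈≤6 : ∀ a → 2 ℕ.≤ ∣ a ∣ → ∣ a ∣ ℕ.≤ 6 → a ∈ ≤6
  ∈≤6 (+ 2) _ _ = here refl
  ∈≤6 (+ 3) _ _ = there (here refl)
  ∈≤6 (+ 4) _ _ = there (there (here refl))
  ∈≤6 (+ 5) _ _ = there (there (there (here refl)))
  ∈≤6 (+ 6) _ _ = there (there (there (there (here refl))))
  ∈≤6 -[1+ 1 ] _ _ = there (there (there (there (there (here refl)))))
  ∈≤6 -[1+ 2 ] _ _ = there (there (there (there (there (there (here refl))))))
  ∈≤6 -[1+ 3 ] _ _ = there (there (there (there (there (there (there (here refl)))))))
  ∈≤6 -[1+ 4 ] _ _ = there (there (there (there (there (there (there (there (here refl))))))))
  ∈≤6 -[1+ 5 ] _ _ = there (there (there (there (there (there (there (there (there (here refl)))))))))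
  ∈≤6 (+ 0) () _
  ∈≤6 (+ 1) (s≤s ()) _
  ∈≤6 -[1+ 0 ] (s≤s ()) _
  ∈≤6 (+ ℕ.suc (ℕ.suc (ℕ.suc (ℕ.suc (ℕ.suc (ℕ.suc (ℕ.suc _))))))) _ (s≤s (s≤s (s≤s (s≤s (s≤s (s≤s ()))))))
  ∈≤6 -[1+ ℕ.suc (ℕ.suc (ℕ.suc (ℕ.suc (ℕ.suc (ℕ.suc _))))) ] _ (s≤s (s≤s (s≤s (s≤s (s≤s (s≤s ()))))))

  ∣⇒≤ : ∀ a s → a ∣ℤ s → s ≢ + 0 → ∣ a ∣ ℕ.≤ ∣ s ∣
  ∣⇒≤ a s (divides q s≡) s≢0 = by (∣ q ∣) refl
    where
    by : ∀ n → ∣ q ∣ ≡ n → ∣ a ∣ ℕ.≤ ∣ s ∣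
    by 0 eq = ⊥-elim (s≢0 (trans s≡ (cong (_* a) (ℤₚ.∣i∣≡0⇒i≡0 {q} eq))))
    by (ℕ.suc n) eq = subst (∣ a ∣ ℕ.≤_) (sym (trans (cong ∣_∣ s≡) (trans (ℤₚ.abs-* q a) (cong (ℕ._* ∣ a ∣) eq))))
      (ℕₚ.m≤m+n (∣ a ∣) (n ℕ.* ∣ a ∣))

  product-bound : ∀ p q r → 2 ℕ.≤ q → p ℕ.≤ q → r ℕ.≤ q → p ℕ.* q ℕ.≤ p ℕ.+ (r ℕ.+ q) → p ℕ.≤ 3
  product-bound p q@(ℕ.suc _) r _ p≤q r≤q le = ℕₚ.*-cancelʳ-≤ p 3 q
    (ℕₚ.≤-trans le (ℕₚ.≤-trans (ℕₚ.+-mono-≤ p≤q (ℕₚ.+-monoˡ-≤ q r≤q))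
    (ℕₚ.≤-reflexive (cong (λ n → q ℕ.+ (q ℕ.+ n)) (sym (ℕₚ.+-identityʳ q))))))

  -- As `c * b` divides the sum, `c` divides `a + b`. That is not 0, because otherwise `a * c` would
  -- divide `c` and `a` would be a unit. Hence `c` is at most 6 in absolute value, and a finite
  -- table decides.
  two-small : ∀ a b c → 2 ℕ.≤ ∣ a ∣ → 2 ℕ.≤ ∣ b ∣ → 2 ℕ.≤ ∣ c ∣ → ∣ a ∣ ℕ.≤ 3 → ∣ b ∣ ℕ.≤ 3 → Products∣Sum a b c → a + (b + c) ≢
    + 0 → EvenOrThree a b c
  two-small a b c 2≤a 2≤b 2≤c a≤3 b≤3 (ac@(divides x x≡) , ba , cb@(divides z z≡)) σ≢0 =
    [ (λ good → good) , (λ excluded → ⊥-elim (excluded ((ac , ba , cb) , σ≢0))) ]′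
      (All.lookup (All.lookup (All.lookup table (∈≤3 a 2≤a a≤3)) (∈≤3 b 2≤b b≤3)) (∈≤6 c 2≤c c≤6))
    where
    c∣a+b : c ∣ℤ a + b
    c∣a+b = divides (z * b - + 1) (linear₁ {a + b} {(z * b - + 1) * c} {a + (b + c)} {z * (c * b)} (+ 1)
      (solve 4 (λ a b c z → a :+ b :- (z :* b :- con (+ 1)) :* c := con (+ 1) :* ((a :+ (b :+ c)) :- z :* (c :* b))) refl a b c
        z) z≡)
    a+b≢0 : a + b ≢ + 0
    a+b≢0 eq = one (ℕₚ.m*n≡1⇒n≡1 (∣ x ∣) (∣ a ∣) (trans (sym (ℤₚ.abs-* x a)) (cong ∣_∣ xa≡1)))
      where
      c≢0 : c ≢ + 0
      c≢0 refl = ℕₚ.n≮0 2≤c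
      xa≡1 : x * a ≡ + 1
      xa≡1 = ℤₚ.*-cancelʳ-≡ (x * a) (+ 1) c ⦃ ℤ.≢-nonZero c≢0 ⦄ (trans (ℤₚ.*-assoc x a c) (trans (sym x≡)
        (trans (solve 3 (λ a b c → a :+ (b :+ c) := (a :+ b) :+ con (+ 1) :* c) refl a b c)
          (trans (cong (_+ + 1 * c) eq) (ℤₚ.+-identityˡ (+ 1 * c))))))
      one : ¬ (∣ a ∣ ≡ 1)
      one eq = ℕₚ.<-irrefl refl (subst (2 ℕ.≤_) eq 2≤a)
    c≤6 : ∣ c ∣ ℕ.≤ 6
    c≤6 = ℕₚ.≤-trans (∣⇒≤ c (a + b) c∣a+b a+b≢0) (ℕₚ.≤-trans (ℤₚ.∣i+j∣≤∣i∣+∣j∣ a b) (ℕₚ.+-mono-≤ a≤3 b≤3))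

  rotate-sum : ∀ a b c → a + (b + c) ≡ b + (c + a)
  rotate-sum = solve 3 (λ a b c → a :+ (b :+ c) := b :+ (c :+ a)) refl

  rotate-products : ∀ a b c → Products∣Sum a b c → Products∣Sum b c a
  rotate-products a b c (ac , ba , cb) = subst (b * a ∣ℤ_) (rotate-sum a b c) ba , subst (c * b ∣ℤ_) (rotate-sum a b c) cb ,
    subst (a * c ∣ℤ_) (rotate-sum a b c) ac

  rotate-answer : ∀ {a b c} → EvenOrThree a b c → EvenOrThree b c a
  rotate-answer (inj₁ (a , b , c)) = inj₁ (b , c , a)
  rotate-answer (inj₂ (refl , refl , three)) = inj₂ (refl , refl , three)

  -- In absolute values `a * c` is at most the sum of all three, hence at most three times the
  -- largest, `c`; so `a` is at most 3, and likewise `b`.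
  largest-last : ∀ a b c → 2 ℕ.≤ ∣ a ∣ → 2 ℕ.≤ ∣ b ∣ → 2 ℕ.≤ ∣ c ∣ → ∣ a ∣ ℕ.≤ ∣ c ∣ → ∣ b ∣ ℕ.≤ ∣ c ∣ → Products∣Sum a b c → a +
    (b + c) ≢ + 0 → EvenOrThree a b c
  largest-last a b c 2≤a 2≤b 2≤c a≤c b≤c ∣σ@(ac , _ , cb) σ≢0 = two-small a b c 2≤a 2≤b 2≤c
    (product-bound (∣ a ∣) (∣ c ∣) (∣ b ∣) 2≤c a≤c b≤c (ℕₚ.≤-trans (ℕₚ.≤-reflexive (sym (ℤₚ.abs-* a c)))
      (ℕₚ.≤-trans (∣⇒≤ (a * c) (a + (b + c)) ac σ≢0) triangle)))
    (product-bound (∣ b ∣) (∣ c ∣) (∣ a ∣) 2≤c b≤c a≤c (ℕₚ.≤-trans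
      (ℕₚ.≤-reflexive (trans (ℕₚ.*-comm (∣ b ∣) (∣ c ∣)) (sym (ℤₚ.abs-* c b))))
      (ℕₚ.≤-trans (∣⇒≤ (c * b) (a + (b + c)) cb σ≢0) (ℕₚ.≤-trans triangle (ℕₚ.≤-reflexive (swap-sum (∣ a ∣) (∣ b ∣) (∣ c ∣)))))))
    ∣σ σ≢0
    where
    triangle : ∣ a + (b + c) ∣ ℕ.≤ ∣ a ∣ ℕ.+ (∣ b ∣ ℕ.+ ∣ c ∣)
    triangle = ℕₚ.≤-trans (ℤₚ.∣i+j∣≤∣i∣+∣j∣ a (b + c)) (ℕₚ.+-monoʳ-≤ (∣ a ∣) (ℤₚ.∣i+j∣≤∣i∣+∣j∣ b c))
    swap-sum : ∀ i j k → i ℕ.+ (j ℕ.+ k) ≡ j ℕ.+ (i ℕ.+ k)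
    swap-sum i j k = trans (sym (ℕₚ.+-assoc i j k)) (trans (cong (ℕ._+ k) (ℕₚ.+-comm i j)) (ℕₚ.+-assoc j i k))

-- The three numbers are the lattice edge lengths of a reflexive triangle without edges of length one.
even-or-three : ∀ a b c → 2 ℕ.≤ ∣ a ∣ → 2 ℕ.≤ ∣ b ∣ → 2 ℕ.≤ ∣ c ∣ → Products∣Sum a b c → a + (b + c) ≢ + 0 → EvenOrThree a b c
even-or-three a b c 2≤a 2≤b 2≤c ∣σ σ≢0 with ℕₚ.≤-total (∣ a ∣) (∣ c ∣) | ℕₚ.≤-total (∣ b ∣) (∣ c ∣) | ℕₚ.≤-total (∣ a ∣) (∣ b ∣)
... | inj₁ a≤c | inj₁ b≤c | _ = largest-last a b c 2≤a 2≤b 2≤c a≤c b≤c ∣σ σ≢0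
... | inj₂ c≤a | _ | inj₂ b≤a = rotate-answer (rotate-answer
  (largest-last b c a 2≤b 2≤c 2≤a b≤a c≤a (rotate-products a b c ∣σ) (λ eq → σ≢0 (trans (rotate-sum a b c) eq))))
... | _ | inj₂ c≤b | inj₁ a≤b = rotate-answer (largest-last c a b 2≤c 2≤a 2≤b c≤b a≤b
  (rotate-products b c a (rotate-products a b c ∣σ)) (λ eq → σ≢0 (trans (rotate-sum a b c) (trans (rotate-sum b c a) eq))))
... | inj₁ a≤c | inj₂ c≤b | inj₂ b≤a = rotate-answer
  (largest-last c a b 2≤c 2≤a 2≤b c≤b (ℕₚ.≤-trans a≤c c≤b) (rotate-products b c a (rotate-products a b c ∣σ))
  (λ eq → σ≢0 (trans (rotate-sum a b c) (trans (rotate-sum b c a) eq))))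
... | inj₂ c≤a | inj₁ b≤c | inj₁ a≤b = rotate-answer
  (rotate-answer (largest-last b c a 2≤b 2≤c 2≤a (ℕₚ.≤-trans b≤c c≤a) c≤a (rotate-products a b c ∣σ)
  (λ eq → σ≢0 (trans (rotate-sum a b c) eq))))

-- Residues modulo 2 and 3

Mod₂ : ℤ → Set
Mod₂ x = Σ ℤ λ k → (x ≡ + 2 * k) ⊎ (x ≡ + 2 * k + + 1)

Mod₃ : ℤ → Set
Mod₃ x = Σ ℤ λ k → (x ≡ + 3 * k) ⊎ (x ≡ + 3 * k + + 1) ⊎ (x ≡ + 3 * k + + 2)

opaque
  mod₂ : ∀ x → Mod₂ x
  mod₂ x = x /ℕ 2 , by (x %ℕ 2) (n%ℕd<d x 2) (a≡a%ℕn+[a/ℕn]*n x 2)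
    where
    by : ∀ r → r ℕ.< 2 → x ≡ + r + x /ℕ 2 * + 2 → (x ≡ + 2 * (x /ℕ 2)) ⊎ (x ≡ + 2 * (x /ℕ 2) + + 1)
    by 0 _ eq = inj₁ (trans eq (solve 1 (λ q → con (+ 0) :+ q :* con (+ 2) := con (+ 2) :* q) refl (x /ℕ 2)))
    by 1 _ eq = inj₂ (trans eq (solve 1 (λ q → con (+ 1) :+ q :* con (+ 2) := con (+ 2) :* q :+ con (+ 1)) refl (x /ℕ 2)))
    by (ℕ.suc (ℕ.suc _)) (s≤s (s≤s ())) _

  mod₃ : ∀ x → Mod₃ x
  mod₃ x = x /ℕ 3 , by (x %ℕ 3) (n%ℕd<d x 3) (a≡a%ℕn+[a/ℕn]*n x 3)
    where
    by : ∀ r → r ℕ.< 3 → x ≡ + r + x /ℕ 3 * + 3 → (x ≡ + 3 * (x /ℕ 3)) ⊎ (x ≡ + 3 * (x /ℕ 3) + + 1) ⊎ (x ≡ + 3 * (x /ℕ 3) + + 2)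
    by 0 _ eq = inj₁ (trans eq (solve 1 (λ q → con (+ 0) :+ q :* con (+ 3) := con (+ 3) :* q) refl (x /ℕ 3)))
    by 1 _ eq = inj₂ (inj₁ (trans eq (solve 1 (λ q → con (+ 1) :+ q :* con (+ 3) := con (+ 3) :* q :+ con (+ 1)) refl (x /ℕ 3))))
    by 2 _ eq = inj₂ (inj₂ (trans eq (solve 1 (λ q → con (+ 2) :+ q :* con (+ 3) := con (+ 3) :* q :+ con (+ 2)) refl (x /ℕ 3))))
    by (ℕ.suc (ℕ.suc (ℕ.suc _))) (s≤s (s≤s (s≤s ()))) _

-- Three points off the line

dot-combinationʳ : ∀ f i j k x y z → dot f (scale i x ⊕ (scale j y ⊕ scale k z)) ≡ i * dot f x + (j * dot f y + k * dot f z)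
dot-combinationʳ f i j k x y z = prove (x ▸ y ▸ z ▸ f ▸ i ∷ j ∷ k ∷ [])
  (dot′ V₃ (scale′ (ν 12) V₀ ⊕′ (scale′ (ν 13) V₁ ⊕′ scale′ (ν 14) V₂)))
  (ν 12 :* dot′ V₃ V₀ :+ (ν 13 :* dot′ V₃ V₁ :+ ν 14 :* dot′ V₃ V₂)) refl

module Classified {A : PtSet} {L : List Pt} (to : ∀ {x} → InConv A x → x ∈ L) (from : ∀ {x} → x ∈ L → InConv A x)
  (F : Frame L) (convex : Convex (_∈ L)) (free : UnimodularFree (_∈ L))
  (spatial : Spatial L) (wide : Wide L) (unmerged : Unmerged L) (uniqL : Unique L) where
  open Frame F
  open Framed F convex free spatial wide unmerged
  open Counted F convex free spatial wide unmerged uniqL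

  Conclusion : Set
  Conclusion = (SublatticeIndex A 2 × UnimodEquiv A (_∈ tetrahedron₂ (+ K)))
    ⊎ (SublatticeIndex A 3 × UnimodEquiv A (_∈ tetrahedron₃ (+ K)))

  record Triple (v₁ v₂ v₃ : Pt) : Set where
    field
      m₁ : M v₁
      m₂ : M v₂
      m₃ : M v₃
      off₁ : cross e v₁ ≢ origin
      off₂ : cross e v₂ ≢ origin
      off₃ : cross e v₃ ≢ origin
      ≢₁₂ : v₁ ≢ v₂
      ≢₂₃ : v₂ ≢ v₃
      ≢₃₁ : v₃ ≢ v₁
      only : ∀ x → M x → (cross e x ≡ origin) ⊎ (x ≡ v₁) ⊎ (x ≡ v₂) ⊎ (x ≡ v₃)
      lev₁ : det3 e v₂ v₃ ≢ + 0 → Σ Pt (Levelled v₂ v₃)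
      lev₂ : det3 e v₃ v₁ ≢ + 0 → Σ Pt (Levelled v₃ v₁)
      lev₃ : det3 e v₁ v₂ ≢ + 0 → Σ Pt (Levelled v₁ v₂)

  rotate : ∀ {v₁ v₂ v₃} → Triple v₁ v₂ v₃ → Triple v₂ v₃ v₁
  rotate {v₁} {v₂} {v₃} T = record { m₁ = m₂ ; m₂ = m₃ ; m₃ = m₁ ; off₁ = off₂ ; off₂ = off₃ ; off₃ = off₁ ; ≢₁₂ = ≢₂₃ ; ≢₂₃ =
    ≢₃₁ ; ≢₃₁ = ≢₁₂
    ; only = λ x m → permute x (only x m) ; lev₁ = lev₂ ; lev₂ = lev₃ ; lev₃ = lev₁ }
    where
    open Triple T
    permute : ∀ x → (cross e x ≡ origin) ⊎ (x ≡ v₁) ⊎ (x ≡ v₂) ⊎ (x ≡ v₃) → (cross e x ≡ origin) ⊎ (x ≡ v₂) ⊎ (x ≡ v₃) ⊎ (x ≡ v₁)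
    permute x (inj₁ p) = inj₁ p
    permute x (inj₂ (inj₁ p)) = inj₂ (inj₂ (inj₂ p))
    permute x (inj₂ (inj₂ (inj₁ p))) = inj₂ (inj₁ p)
    permute x (inj₂ (inj₂ (inj₂ p))) = inj₂ (inj₂ (inj₁ p))

  spine : ∀ {v₁ v₂ v₃} → Triple v₁ v₂ v₃ → Spine L o e g K v₁ v₂ v₃
  spine {v₁} {v₂} {v₃} T = record { ge = ge ; on = on ; on₁ = m₁ ; on₂ = m₂ ; on₃ = m₃ ; cover = λ {x} x∈ → place x x∈
    (only (x ⊖ o) (M-⊖ x x∈)) }
    where
    open Triple T
    absolute : ∀ x v → x ⊖ o ≡ v → x ≡ o ⊕ v
    absolute x v eq = trans (sym (⊕-⊖ o x)) (cong (o ⊕_) eq)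
    place : ∀ x → x ∈ L → (cross e (x ⊖ o) ≡ origin) ⊎ (x ⊖ o ≡ v₁) ⊎ (x ⊖ o ≡ v₂) ⊎ (x ⊖ o ≡ v₃) →
      Place o e K v₁ v₂ v₃ x
    place x x∈ (inj₁ eq) = inj₁ (line x∈ eq)
    place x x∈ (inj₂ (inj₁ eq)) = inj₂ (inj₁ (absolute x v₁ eq))
    place x x∈ (inj₂ (inj₂ (inj₁ eq))) = inj₂ (inj₂ (inj₁ (absolute x v₂ eq)))
    place x x∈ (inj₂ (inj₂ (inj₂ eq))) = inj₂ (inj₂ (inj₂ (absolute x v₃ eq)))

  det3-swap : ∀ x y → det3 e y x ≡ - det3 e x y
  det3-swap x y = prove (e ▸ x ▸ y ▸ []) (det3′ V₀ V₂ V₁) (:- det3′ V₀ V₁ V₂) refl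

  -- The plane through the line and `v₁` would contain all of `L`.
  no-zero-pair : ∀ {v₁ v₂ v₃} → Triple v₁ v₂ v₃ → det3 e v₁ v₂ ≡ + 0 → det3 e v₁ v₃ ≢ + 0
  no-zero-pair {v₁} {v₂} {v₃} T d₂ d₃ = not-in-plane (cross e v₁) off₁ λ {x} x∈ → trans (det3-dot e v₁ (x ⊖ o))
    (value (x ⊖ o) (only (x ⊖ o) (M-⊖ x x∈)))
    where
    open Triple T
    value : ∀ x → (cross e x ≡ origin) ⊎ (x ≡ v₁) ⊎ (x ≡ v₂) ⊎ (x ≡ v₃) → det3 e v₁ x ≡ + 0
    value x (inj₁ eq) = trans (prove (e ▸ v₁ ▸ x ▸ []) (det3′ V₀ V₁ V₂) (:- dot′ V₁ (cross′ V₀ V₂)) refl)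
      (trans (cong (λ w → - dot v₁ w) eq) (prove (v₁ ▸ []) (:- dot′ V₀ origin′) (con (+ 0)) refl))
    value _ (inj₂ (inj₁ refl)) = prove (e ▸ v₁ ▸ []) (det3′ V₀ V₁ V₁) (con (+ 0)) refl
    value _ (inj₂ (inj₂ (inj₁ refl))) = d₂
    value _ (inj₂ (inj₂ (inj₂ refl))) = d₃

  level-on-line : ∀ f x → dot f e ≡ + 0 → cross e x ≡ origin → dot f x ≡ + 0
  level-on-line f x fe eq = trans (cong (dot f) (parallel⇒multiple x eq))
    (trans (dot-scale f (dot g x) e) (trans (cong (dot g x *_) fe) (ℤₚ.*-zeroʳ (dot g x))))

  -- `e` and `cross f g` form a basis of the lattice plane `f = 0`. So the difference is divisible
  -- by an integer as soon as the height difference and the determinant are.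
  level-difference : ∀ f v w → Levelled v w f → v ⊖ w ≡ scale (dot g v - dot g w) e ⊕ scale (det3 e v w) (cross f g)
  level-difference f v w (fe , fv , fw) = begin
    v ⊖ w ≡⟨ along g e (v ⊖ w) ge ⟩
    scale (dot g (v ⊖ w)) e ⊕ cross g (cross (v ⊖ w) e)
      ≡⟨ cong₂ (λ k x → scale k e ⊕ cross g x) (dot-⊖ g v w)
        (trans (proveᵥ (e ▸ v ⊖ w ▸ []) (cross′ V₁ V₀) (scale′ (con (- + 1)) (cross′ V₀ V₁)) refl refl refl)
           (cong (scale (- + 1)) (trans (normal f e (v ⊖ w) w fe (trans (dot-⊖ f v w) (cong₂ _-_ fv fw)) fw)
             (cong (λ k → scale k f)
             (prove (e ▸ v ▸ w ▸ []) (det3′ V₀ (V₁ ⊖′ V₂) V₂) (det3′ V₀ V₁ V₂) refl))))) ⟩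
    scale (dot g v - dot g w) e ⊕ cross g (scale (- + 1) (scale (det3 e v w) f))
      ≡⟨ cong (scale (dot g v - dot g w) e ⊕_) (proveᵥ (g ▸ f ▸ det3 e v w ∷ [])
        (cross′ V₀ (scale′ (con (- + 1)) (scale′ (ν 6) V₁))) (scale′ (ν 6) (cross′ V₁ V₀)) refl refl refl) ⟩
    scale (dot g v - dot g w) e ⊕ scale (det3 e v w) (cross f g) ∎
    where open ≡-Reasoning

  -- Otherwise v₃ + (v₂ - v₃)/(q+2) would be a further point of L off the line.
  no-division : ∀ {v₁ v₂ v₃} → Triple v₁ v₂ v₃ → ∀ f → Levelled v₂ v₃ f → dot f v₁ ≢ + 1 → ∀ q α β →
    dot g v₂ - dot g v₃ ≡ + (2 ℕ.+ q) * α → det3 e v₂ v₃ ≢ + (2 ℕ.+ q) * β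
  no-division {v₁} {v₂} {v₃} T f lev@(fe , fv₂ , fv₃) fv₁≢1 q α β h≡ d≡ = impossible (only (v₃ ⊕ y) my)
    where
    open Triple T
    Q : ℤ
    Q = + (2 ℕ.+ q)
    y : Pt
    y = scale α e ⊕ scale β (cross f g)
    v₂-v₃ : v₂ ⊖ v₃ ≡ scale Q y
    v₂-v₃ = trans (level-difference f v₂ v₃ lev) (trans (cong₂ (λ i j → scale i e ⊕ scale j (cross f g)) h≡ d≡)
      (proveᵥ (e ▸ cross f g ▸ Q ∷ α ∷ β ∷ []) (scale′ (ν 6 :* ν 7) V₀ ⊕′ scale′ (ν 6 :* ν 8) V₁)
        (scale′ (ν 6) (scale′ (ν 7) V₀ ⊕′ scale′ (ν 8) V₁)) refl refl refl))
    v₂≡ : v₂ ≡ v₃ ⊕ scale Q y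
    v₂≡ = trans (sym (⊕-⊖ v₃ v₂)) (cong (v₃ ⊕_) v₂-v₃)
    my : M (v₃ ⊕ y)
    my = combine₂ {M} M-convex 1 (1 ℕ.+ q) {v₂} {v₃} {v₃ ⊕ y} m₂ m₃ (s≤s z≤n)
      (trans (cong (λ w → scale (+ 1) w ⊕ scale (+ (1 ℕ.+ q)) v₃) v₂≡)
      (proveᵥ (v₃ ▸ y ▸ + q ∷ []) (scale′ (con (+ 1)) (V₀ ⊕′ scale′ (con (+ 2) :+ ν 6) V₁) ⊕′ scale′ (con (+ 1) :+ ν 6) V₀)
        (scale′ (con (+ 1) :+ (con (+ 1) :+ ν 6)) (V₀ ⊕′ V₁)) refl refl refl))
    fy : dot f y ≡ + 0
    fy = [ (λ ()) , (λ eq → eq) ]′ (ℤₚ.i*j≡0⇒i≡0∨j≡0 Q {dot f y}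
      (trans (sym (dot-scale f Q y)) (trans (cong (dot f) (sym v₂-v₃)) (trans (dot-⊖ f v₂ v₃) (cong₂ _-_ fv₂ fv₃)))))
    level : dot f (v₃ ⊕ y) ≡ + 1
    level = trans (dot-⊕ f v₃ y) (cong₂ _+_ fv₃ fy)
    y≢0 : y ≢ origin
    y≢0 y≡0 = ≢₂₃ (⊖≡origin v₂ v₃ (trans v₂-v₃ (trans (cong (scale Q) y≡0) (scale-origin Q))))
    impossible : (cross e (v₃ ⊕ y) ≡ origin) ⊎ (v₃ ⊕ y ≡ v₁) ⊎ (v₃ ⊕ y ≡ v₂) ⊎ (v₃ ⊕ y ≡ v₃) → ⊥
    impossible (inj₁ eq) = one≢0 (trans (sym level) (level-on-line f (v₃ ⊕ y) fe eq))
      where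
      one≢0 : + 1 ≢ + 0
      one≢0 ()
    impossible (inj₂ (inj₁ eq)) = fv₁≢1 (trans (cong (dot f) (sym eq)) level)
    impossible (inj₂ (inj₂ (inj₁ eq))) = y≢0 (scale≡origin (+ (1 ℕ.+ q)) y (λ ()) (begin
      scale (+ (1 ℕ.+ q)) y   ≡⟨ proveᵥ (v₃ ▸ y ▸ + q ∷ []) (scale′ (con (+ 1) :+ ν 6) V₁)
        ((V₀ ⊕′ scale′ (con (+ 2) :+ ν 6) V₁) ⊖′ (V₀ ⊕′ V₁)) refl refl refl ⟩
      (v₃ ⊕ scale Q y) ⊖ (v₃ ⊕ y) ≡⟨ cong₂ _⊖_ (sym v₂≡) eq ⟩
      v₂ ⊖ v₂                 ≡⟨ ⊖-inverse v₂ ⟩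
      origin ∎))
      where open ≡-Reasoning
    impossible (inj₂ (inj₂ (inj₂ eq))) = y≢0 (trans (proveᵥ (v₃ ▸ y ▸ []) V₁ ((V₀ ⊕′ V₁) ⊖′ V₀) refl refl refl)
      (trans (cong (_⊖ v₃) eq) (⊖-inverse v₃)))

  on-spine : ∀ c → M (scale c e) → Σ ℕ λ j → j ℕ.≤ K × c ≡ + j
  on-spine c mc =
    let (j , j≤K , eq) = line mc (proveᵥ (o ▸ e ▸ c ∷ []) (cross′ V₁ ((V₀ ⊕′ scale′ (ν 6) V₁) ⊖′ V₀)) origin′ refl refl refl)
    in j , j≤K , trans (height c) (trans (cong (λ x → dot g x - dot g o) eq) (sym (height (+ j))))
    where
    height : ∀ c → c ≡ dot g (o ⊕ scale c e) - dot g o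
    height c = sym (trans (cong (_- dot g o) (trans (dot-⊕ g o (scale c e))
      (cong (λ k → dot g o + k) (trans (dot-scale g c e) (cong (c *_) ge)))))
      (solve 2 (λ x c → x :+ c :* con (+ 1) :- x := c) refl (dot g o) c))

  private
    1≤K : 1 ℕ.≤ K
    1≤K = ℕₚ.≤-trans (s≤s z≤n) long

    remaining : ∀ j → j ℕ.< K → Σ ℕ λ i → + K - + j ≡ + ℕ.suc i
    remaining j j<K = K ℕ.∸ ℕ.suc j , (begin
      + K - + j                                   ≡⟨ cong (λ k → + k - + j) (sym (ℕₚ.m+[n∸m]≡n j<K)) ⟩
      + (ℕ.suc j ℕ.+ (K ℕ.∸ ℕ.suc j)) - + j       ≡⟨ solve 2 (λ j i → con (+ 1) :+ j :+ i :- j := con (+ 1) :+ i) refl (+ j)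
        (+ (K ℕ.∸ ℕ.suc j)) ⟩
      + ℕ.suc (K ℕ.∸ ℕ.suc j) ∎)
      where open ≡-Reasoning

    by-end : ∀ {C : Set} (D : ℕ → Set) → (D 0 → C) → (D K → C) → (∀ j → ℕ.suc j ℕ.< K → D (ℕ.suc j) → ⊥) → ∀ j → j ℕ.≤ K → D j → C
    by-end D bottom top inner 0 _ d = bottom d
    by-end D bottom top inner (ℕ.suc j) le d with ℕ.suc j ℕ.≟ K
    ... | yes refl = top d
    ... | no ne = ⊥-elim (inner j (ℕₚ.≤∧≢⇒< le ne) d)

  module _ {v₁ v₂ v₃ : Pt} (T : Triple v₁ v₂ v₃) where
    -- A midpoint strictly inside the line would make `o` a vertex, and after `flip` the other end
    -- too, against `not-both-ends`. So it is an end, and `flip` moves the upper one to height 0.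
    finish₂ : ∀ {f₁ f₂} j → j ℕ.≤ K → T2Data e g v₁ v₂ v₃ f₁ f₂ (+ j) → Conclusion
    finish₂ {f₁} {f₂} = by-end (λ j → T2Data e g v₁ v₂ v₃ f₁ f₂ (+ j))
      (λ D → inj₁ (T2-final to from (spine T) 1≤K D))
      (λ D → inj₁ (T2-final to from (flip (spine T)) 1≤K (subst (T2Data _ _ _ _ _ f₁ f₂) (ℤₚ.+-inverseʳ (+ K))
        (flip₂ (+ K) ge D))))
      (λ j j<K D → let (i , eq) = remaining (ℕ.suc j) j<K in
        not-both-ends (subst (Vertex L) (sym P0≡o) (T2-vertex (spine T) j D))
          (T2-vertex (flip (spine T)) i (subst (T2Data _ _ _ _ _ f₁ f₂) eq (flip₂ (+ K) ge D))))

    finish₃ : ∀ {f₁ f₂ f₃} j → j ℕ.≤ K → T3Data e g v₁ v₂ v₃ f₁ f₂ f₃ (+ j) → Conclusion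
    finish₃ {f₁} {f₂} {f₃} = by-end (λ j → T3Data e g v₁ v₂ v₃ f₁ f₂ f₃ (+ j))
      (λ D → inj₂ (T3-final to from (spine T) 1≤K D))
      (λ D → inj₂ (T3-final to from (flip (spine T)) 1≤K (subst (T3Data _ _ _ _ _ f₁ f₂ f₃) (ℤₚ.+-inverseʳ (+ K))
        (flip₃ (+ K) ge D))))
      (λ j j<K D → let (i , eq) = remaining (ℕ.suc j) j<K in
        not-both-ends (subst (Vertex L) (sym P0≡o) (T3-vertex (spine T) j D))
          (T3-vertex (flip (spine T)) i (subst (T3Data _ _ _ _ _ f₁ f₂ f₃) eq (flip₃ (+ K) ge D))))

m*n≡2⇒n≡2 : ∀ m n → m ℕ.* n ≡ 2 → n ≢ 1 → n ≡ 2
m*n≡2⇒n≡2 m 0 eq _ = ⊥-elim (0≢2 (trans (sym (ℕₚ.*-zeroʳ m)) eq))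
  where
  0≢2 : 0 ≢ 2
  0≢2 ()
m*n≡2⇒n≡2 m 1 _ n≢1 = ⊥-elim (n≢1 refl)
m*n≡2⇒n≡2 m 2 _ _ = refl
m*n≡2⇒n≡2 (ℕ.suc m) (ℕ.suc (ℕ.suc (ℕ.suc n))) ()

∣∣≡2 : ∀ z → ∣ z ∣ ≡ 2 → Σ ℤ λ δ → z ≡ + 2 * δ
∣∣≡2 (+ .2) refl = + 1 , refl
∣∣≡2 -[1+ .1 ] refl = - + 1 , refl

2≤∣∣ : ∀ z → z ≢ + 0 → ∣ z ∣ ≢ 1 → 2 ℕ.≤ ∣ z ∣
2≤∣∣ (+ 0) z≢0 _ = ⊥-elim (z≢0 refl)
2≤∣∣ (+ 1) _ z≢1 = ⊥-elim (z≢1 refl)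
2≤∣∣ (+ ℕ.suc (ℕ.suc _)) _ _ = s≤s (s≤s z≤n)
2≤∣∣ -[1+ 0 ] _ z≢1 = ⊥-elim (z≢1 refl)
2≤∣∣ -[1+ ℕ.suc _ ] _ _ = s≤s (s≤s z≤n)

-- The three outer points in projection along the line

module Classification {A : PtSet} {L : List Pt} (to : ∀ {x} → InConv A x → x ∈ L) (from : ∀ {x} → x ∈ L → InConv A x)
  (F : Frame L) (convex : Convex (_∈ L)) (free : UnimodularFree (_∈ L))
  (spatial : Spatial L) (wide : Wide L) (unmerged : Unmerged L) (uniqL : Unique L) where
  open Frame F
  open Framed F convex free spatial wide unmerged
  open Counted F convex free spatial wide unmerged uniqL
  open Classified {A} to from F convex free spatial wide unmerged uniqL

  det-not-unit : ∀ {v w} → M v → M w → ∣ det3 e v w ∣ ≢ 1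
  det-not-unit mv mw = free₀ {M} M-convex M-free M-origin M-e mv mw

  private
    relative : ∀ v → (o ⊕ v) ⊖ o ≡ v
    relative v = proveᵥ (o ▸ v ▸ []) ((V₀ ⊕′ V₁) ⊖′ V₀) V₁ refl refl refl

  distinct-projections : ∀ f v w → M v → M w → cross e v ≢ origin → cross e w ≢ origin → v ≢ w →
    dot f e ≡ + 0 → dot f v ≡ + 1 → dot f w ≡ + 1 → cross e (w ⊖ v) ≢ origin
  distinct-projections f v w mv mw offv offw v≢w fe fv fw eq = distinct-fibres f (o ⊕ v) (o ⊕ w) mv mw
    (λ z → offv (trans (cong (cross e) (sym (relative v))) z)) (λ z → offw (trans (cong (cross e) (sym (relative w))) z))
    (λ z → v≢w (trans (sym (relative v)) (trans (cong (_⊖ o) z) (relative w)))) fe (trans (cong (dot f) (relative v)) fv)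
      (trans (cong (dot f) (relative w)) fw)
    (trans (cong (cross e) (⊕-⊖-⊕ o w v)) eq)

  -- `e`, `v` and `cross g f` form a lattice basis, so an integral functional vanishing on `e` and
  -- `v` is an integral multiple of `cross e v`. The divisibilities between the determinants come
  -- from this.
  level-span : ∀ w f v x → dot f e ≡ + 0 → dot f v ≡ + 1 → dot w e ≡ + 0 → dot w v ≡ + 0 → dot w x ≡ dot w (cross g f) * det3 e v
    x
  level-span w f v x fe fv we wv = trans (cong (λ u → dot u x) w≡)
    (prove (e ▸ v ▸ x ▸ κ ∷ []) (dot′ (scale′ (ν 9) (cross′ V₀ V₁)) V₂) (ν 9 :* det3′ V₀ V₁ V₂) refl)
    where
    c : Pt
    c = cross g f
    κ : ℤ
    κ = dot w c
    w≡ : w ≡ scale κ (cross e v)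
    w≡ = trans (sym (scale-one w)) (trans (cong (λ k → scale k w) (sym (complement-det e v g f ge fe fv)))
      (trans (dual-expansion e v c w)
      (trans (cong₂ (λ i j → scale i (cross v c) ⊕ (scale j (cross c e) ⊕ scale κ (cross e v))) we wv)
        (proveᵥ (cross v c ▸ cross c e ▸ cross e v ▸ κ ∷ [])
          (scale′ (con (+ 0)) V₀ ⊕′ (scale′ (con (+ 0)) V₁ ⊕′ scale′ (ν 9) V₂)) (scale′ (ν 9) V₂) refl refl refl))))

  private
    negate-zero : ∀ x y → x ≡ - y → y ≡ + 0 → x ≡ + 0
    negate-zero x y eq y≡0 = trans eq (cong -_ y≡0)

  module OneZero {v₁ v₂ v₃ : Pt} (T : Triple v₁ v₂ v₃) (d₁₂ : det3 e v₁ v₂ ≡ + 0) (f₁ f₂ : Pt)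
    (lev₁ : Levelled v₂ v₃ f₁) (lev₂ : Levelled v₃ v₁ f₂) where
    open Triple T hiding (lev₁; lev₂)
    private
      f₁e = proj₁ lev₁
      f₁v₂ = proj₁ (proj₂ lev₁)
      f₁v₃ = proj₂ (proj₂ lev₁)
      f₂e = proj₁ lev₂
      f₂v₃ = proj₁ (proj₂ lev₂)
      f₂v₁ = proj₂ (proj₂ lev₂)
      h₁ h₂ h₃ μ : ℤ
      h₁ = dot g v₁
      h₂ = dot g v₂
      h₃ = dot g v₃
      μ = dot f₂ v₂
      y : Pt
      y = v₂ ⊖ scale μ v₁
      y-parallel : cross e y ≡ origin
      y-parallel = trans (normal f₂ e y v₁ f₂e (trans (dot-⊖ f₂ v₂ (scale μ v₁))
        (trans (cong (λ k → μ - k) (trans (dot-scale f₂ μ v₁) (trans (cong (μ *_) f₂v₁) (ℤₚ.*-identityʳ μ)))) (ℤₚ.+-inverseʳ μ)))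
        f₂v₁)
        (cong (λ k → scale k f₂) (trans (prove (e ▸ v₁ ▸ v₂ ▸ μ ∷ []) (det3′ V₀ (V₂ ⊖′ scale′ (ν 9) V₁) V₁) (:- det3′ V₀ V₁ V₂)
          refl) (cong -_ d₁₂)))
      -- Modulo `e`, `v₂` is `μ` times `v₁`; applying `f₁`, which is 1 at `v₂`, shows that `μ`
      -- divides 1.
      μ-unit : ∣ μ ∣ ≡ 1
      μ-unit = ℕₚ.m*n≡1⇒m≡1 (∣ μ ∣) (∣ dot f₁ v₁ ∣) (trans (sym (ℤₚ.abs-* μ (dot f₁ v₁))) (cong ∣_∣ product))
        where
        product : μ * dot f₁ v₁ ≡ + 1
        product = linear₁ {μ * dot f₁ v₁} {+ 1} {dot f₁ v₂ - μ * dot f₁ v₁} {+ 1 - + 1} (- + 1)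
          (trans (cong (λ k → μ * dot f₁ v₁ - k) (sym f₁v₂)) (trans
            (solve 2 (λ p q → q :- p := con (- + 1) :* ((p :- q) :- (con (+ 1) :- con (+ 1)))) refl (dot f₁ v₂) (μ * dot f₁ v₁))
            refl))
          (trans (cong (λ k → dot f₁ v₂ - k) (sym (dot-scale f₁ μ v₁)))
            (trans (sym (dot-⊖ f₁ v₂ (scale μ v₁))) (level-on-line f₁ y f₁e y-parallel)))
      μ≢1 : μ ≢ + 1
      μ≢1 eq = distinct-projections f₂ v₁ v₂ m₁ m₂ off₁ off₂ ≢₁₂ f₂e f₂v₁ eq
        (trans (cong (cross e) (trans (cong (v₂ ⊖_) (sym (scale-one v₁))) (cong (λ k → v₂ ⊖ scale k v₁) (sym eq)))) y-parallel)
      f₂v₂ : μ ≡ - + 1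
      f₂v₂ = [ (λ eq → ⊥-elim (μ≢1 eq)) , (λ eq → eq) ]′ (∣∣≡1 μ μ-unit)
      sum-parallel : cross e (v₁ ⊕ v₂) ≡ origin
      sum-parallel = trans (cong (cross e) (trans (proveᵥ (v₁ ▸ v₂ ▸ []) (V₀ ⊕′ V₁) (V₁ ⊖′ scale′ (con (- + 1)) V₀) refl refl
        refl) (cong (λ k → v₂ ⊖ scale k v₁) (sym f₂v₂)))) y-parallel
      f₁v₁ : dot f₁ v₁ ≡ - + 1
      f₁v₁ = linear₁ {dot f₁ v₁} { - + 1} {dot f₁ v₁ + dot f₁ v₂} {+ 0} (+ 1)
        (trans (solve 1 (λ p → p :- con (- + 1) := con (+ 1) :* ((p :+ con (+ 1)) :- con (+ 0))) refl (dot f₁ v₁))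
          (cong (λ k → + 1 * ((dot f₁ v₁ + k) - + 0)) (sym f₁v₂)))
        (trans (sym (dot-⊕ f₁ v₁ v₂)) (level-on-line f₁ (v₁ ⊕ v₂) f₁e sum-parallel))
      d : ℤ
      d = det3 e v₁ v₃
      -- `f₁ ⊕ f₂` vanishes on `e` and `v₁` and is 2 at `v₃`, so `d` divides 2; the value 1 would
      -- give a unimodular tetrahedron.
      d-two : ∣ d ∣ ≡ 2
      d-two = m*n≡2⇒n≡2 (∣ κ ∣) (∣ d ∣) (trans (sym (ℤₚ.abs-* κ d))
        (cong ∣_∣ (trans (sym (level-span w f₂ v₁ v₃ f₂e f₂v₁ (at e f₁e f₂e) (at v₁ f₁v₁ f₂v₁))) (at v₃ f₁v₃ f₂v₃))))
        (det-not-unit m₁ m₃)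
        where
        w : Pt
        w = f₁ ⊕ f₂
        κ : ℤ
        κ = dot w (cross g f₂)
        at : ∀ x {i j} → dot f₁ x ≡ i → dot f₂ x ≡ j → dot w x ≡ i + j
        at x refl refl = prove (f₁ ▸ f₂ ▸ x ▸ []) (dot′ (V₀ ⊕′ V₁) V₂) (dot′ V₀ V₂ :+ dot′ V₁ V₂) refl
      δ : ℤ
      δ = proj₁ (∣∣≡2 d d-two)
      d≡ : d ≡ + 2 * δ
      d≡ = proj₂ (∣∣≡2 d d-two)
      minus-two : ∀ x → x ≡ - d → x ≡ + 2 * (- δ)
      minus-two x eq = trans eq (trans (cong -_ d≡) (solve 1 (λ δ → :- (con (+ 2) :* δ) := con (+ 2) :* (:- δ)) refl δ))
      multiple : v₁ ⊕ v₂ ≡ scale (dot g (v₁ ⊕ v₂)) e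
      multiple = parallel⇒multiple (v₁ ⊕ v₂) sum-parallel
      d₂₃ : det3 e v₂ v₃ ≡ - d
      d₂₃ = trans (cong (λ v → det3 e v v₃) (trans (proveᵥ (v₁ ▸ v₂ ▸ []) V₁ ((V₀ ⊕′ V₁) ⊖′ V₀) refl refl refl)
        (cong (_⊖ v₁) multiple)))
        (prove (e ▸ v₁ ▸ v₃ ▸ dot g (v₁ ⊕ v₂) ∷ []) (det3′ V₀ (scale′ (ν 9) V₀ ⊖′ V₁) V₂) (:- det3′ V₀ V₁ V₂) refl)
      odd-part : ∀ {x} → (∀ α → x ≢ + 2 * α) → Mod₂ x → Σ ℤ λ k → x ≡ + 2 * k + + 1
      odd-part not (k , inj₁ eq) = ⊥-elim (not k eq)
      odd-part not (k , inj₂ eq) = k , eq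
      minus-one≢one : - + 1 ≢ + 1
      minus-one≢one ()
      -- The determinant is even, so an even height difference would make the midpoint of `v₃` and
      -- `v₁` a lattice point, hence a fourth point off the line.
      odd₃₁ : Σ ℤ λ k → h₃ - h₁ ≡ + 2 * k + + 1
      odd₃₁ = odd-part (λ α eq → no-division (rotate T) f₂ lev₂ (λ z → minus-one≢one (trans (sym f₂v₂) z)) 0 α (- δ) eq
        (minus-two (det3 e v₃ v₁) (det3-swap v₁ v₃))) (mod₂ (h₃ - h₁))
      odd₂₃ : Σ ℤ λ k → h₂ - h₃ ≡ + 2 * k + + 1
      odd₂₃ = odd-part (λ α eq → no-division T f₁ lev₁ (λ z → minus-one≢one (trans (sym f₁v₁) z)) 0 α (- δ) eq
        (minus-two (det3 e v₂ v₃) d₂₃)) (mod₂ (h₂ - h₃))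
      k l c : ℤ
      k = proj₁ odd₃₁
      l = proj₁ odd₂₃
      -- Both height differences to `v₃` are odd, so `h₁ + h₂` is even, and this is half of it.
      c = l - k + h₃
      h₁≡ : h₁ ≡ h₃ + (+ 2 * (- k - + 1) + + 1)
      h₁≡ = linear₁ {h₁} {h₃ + (+ 2 * (- k - + 1) + + 1)} {h₃ - h₁} {+ 2 * k + + 1} (- + 1)
        (solve 3 (λ h₁ h₃ k → h₁ :- (h₃ :+ (con (+ 2) :* (:- k :- con (+ 1)) :+ con (+ 1))) := con (- + 1) :*
          ((h₃ :- h₁) :- (con (+ 2) :* k :+ con (+ 1)))) refl h₁ h₃ k) (proj₂ odd₃₁)
      height : dot g (v₁ ⊕ v₂) ≡ + 2 * c
      height = trans (dot-⊕ g v₁ v₂) (trans (cong₂ _+_ h₁≡ h₂≡)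
        (solve 3 (λ h₃ k l → (h₃ :+ (con (+ 2) :* (:- k :- con (+ 1)) :+ con (+ 1))) :+ (h₃ :+ (con (+ 2) :* l :+ con (+ 1))) :=
        con (+ 2) :* (l :- k :+ h₃)) refl h₃ k l))
        where
        h₂≡ : h₂ ≡ h₃ + (+ 2 * l + + 1)
        h₂≡ = linear₁ {h₂} {h₃ + (+ 2 * l + + 1)} {h₂ - h₃} {+ 2 * l + + 1} (+ 1)
          (solve 3 (λ h₂ h₃ l → h₂ :- (h₃ :+ (con (+ 2) :* l :+ con (+ 1))) := con (+ 1) :*
            ((h₂ :- h₃) :- (con (+ 2) :* l :+ con (+ 1)))) refl h₂ h₃ l) (proj₂ odd₂₃)
      sum : v₁ ⊕ v₂ ≡ scale (+ 2 * c) e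
      sum = trans multiple (cong (λ k → scale k e) height)
      centre : M (scale c e)
      centre = combine₂ {M} M-convex 1 1 {v₁} {v₂} {scale c e} m₁ m₂ (s≤s z≤n)
        (trans (proveᵥ (v₁ ▸ v₂ ▸ []) (scale′ (con (+ 1)) V₀ ⊕′ scale′ (con (+ 1)) V₁) (V₀ ⊕′ V₁) refl refl refl)
        (trans sum (sym (scale-scale (+ 2) c e))))

    conclude : Conclusion
    conclude = let (j , j≤K , c≡) = on-spine c centre in finish₂ T {f₁} {f₂} j j≤K (record
      { f₁e = f₁e ; f₂e = f₂e ; f₁v₁ = f₁v₁ ; f₁v₂ = f₁v₂ ; f₁v₃ = f₁v₃ ; f₂v₁ = f₂v₁ ; f₂v₂ = f₂v₂ ; f₂v₃ = f₂v₃ ; det = d-two ;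
        k = - k - + 1 ; odd = h₁≡
      ; sum = trans sum (cong (λ c → scale (+ 2 * c) e) c≡) })

  one-zero : ∀ {v₁ v₂ v₃} → Triple v₁ v₂ v₃ → det3 e v₁ v₂ ≡ + 0 → Conclusion
  one-zero {v₁} {v₂} {v₃} T d₁₂ =
    let (f₁ , l₁) = lev₁ (λ d₂₃ → no-zero-pair (rotate T) d₂₃ (negate-zero (det3 e v₂ v₁) (det3 e v₁ v₂) (det3-swap v₁ v₂) d₁₂))
        (f₂ , l₂) = lev₂ (λ d₃₁ → no-zero-pair T d₁₂ (negate-zero (det3 e v₁ v₃) (det3 e v₃ v₁) (det3-swap v₃ v₁) d₃₁))
    in OneZero.conclude T d₁₂ f₁ f₂ l₁ l₂
    where open Triple T

  level-third : ∀ {v₁ v₂ v₃} → Triple v₁ v₂ v₃ → ∀ f → Levelled v₂ v₃ f → dot f v₁ ≢ + 1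
  level-third {v₁} {v₂} {v₃} T f (fe , fv₂ , fv₃) fv₁ = not-all-level f fe λ {x} x∈ off → value (x ⊖ o) off
    (only (x ⊖ o) (M-⊖ x x∈))
    where
    open Triple T
    value : ∀ x → cross e x ≢ origin → (cross e x ≡ origin) ⊎ (x ≡ v₁) ⊎ (x ≡ v₂) ⊎ (x ≡ v₃) → dot f x ≡ + 1
    value x off (inj₁ eq) = ⊥-elim (off eq)
    value _ _ (inj₂ (inj₁ refl)) = fv₁
    value _ _ (inj₂ (inj₂ (inj₁ refl))) = fv₂
    value _ _ (inj₂ (inj₂ (inj₂ refl))) = fv₃

  -- Cramer's rule for `e` in terms of the three points, to which a functional vanishing on `e` is
  -- applied: the linear dependence of their projections.
  relation : ∀ v₁ v₂ v₃ f → dot f e ≡ + 0 → det3 e v₂ v₃ * dot f v₁ + (det3 e v₃ v₁ * dot f v₂ + det3 e v₁ v₂ * dot f v₃) ≡ + 0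
  relation v₁ v₂ v₃ f fe = trans (sym (dot-combinationʳ f (det3 e v₂ v₃) (det3 e v₃ v₁) (det3 e v₁ v₂) v₁ v₂ v₃))
    (trans (cong (dot f) (sym (syzygy v₁ v₂ v₃)))
    (trans (dot-scale f (det3 v₁ v₂ v₃) e) (trans (cong (det3 v₁ v₂ v₃ *_) fe) (ℤₚ.*-zeroʳ (det3 v₁ v₂ v₃)))))
    where
    cyclic : ∀ x y → dot (cross x y) e ≡ det3 e x y
    cyclic x y = prove (e ▸ x ▸ y ▸ []) (dot′ (cross′ V₁ V₂) V₀) (det3′ V₀ V₁ V₂) refl
    syzygy : ∀ v₁ v₂ v₃ → scale (det3 v₁ v₂ v₃) e ≡ scale (det3 e v₂ v₃) v₁ ⊕ (scale (det3 e v₃ v₁) v₂ ⊕ scale (det3 e v₁ v₂) v₃)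
    syzygy v₁ v₂ v₃ = trans (cramer v₁ v₂ v₃ e) (cong₂ _⊕_ (cong (λ k → scale k v₁) (cyclic v₂ v₃))
      (cong₂ _⊕_ (cong (λ k → scale k v₂) (cyclic v₃ v₁)) (cong (λ k → scale k v₃) (cyclic v₁ v₂))))

  -- By `relation` the sum is `c * (1 - dot f₃ v₃)`. Since `f₃ ⊖ f₁` vanishes on `e` and `v₂`, its
  -- value at `v₃`, which is `dot f₃ v₃ - 1`, is a multiple of `a`.
  product-divides : ∀ v₁ v₂ v₃ f₁ f₃ → Levelled v₂ v₃ f₁ → Levelled v₁ v₂ f₃ →
    (det3 e v₂ v₃ * det3 e v₁ v₂) ∣ℤ (det3 e v₂ v₃ + (det3 e v₃ v₁ + det3 e v₁ v₂))
  product-divides v₁ v₂ v₃ f₁ f₃ (f₁e , f₁v₂ , f₁v₃) (f₃e , f₃v₁ , f₃v₂) = divides (- κ) (begin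
      a + (b + c)                                    ≡⟨ solve 4
        (λ a b c p → a :+ (b :+ c) := (a :* con (+ 1) :+ (b :* con (+ 1) :+ c :* p)) :+ :- (c :* (p :- con (+ 1)))) refl a b c
        (dot f₃ v₃) ⟩
      (a * + 1 + (b * + 1 + c * dot f₃ v₃)) + - (c * (dot f₃ v₃ - + 1)) ≡⟨ cong₂ (λ x y → x + - (c * y)) rel p₃ ⟩
      + 0 + - (c * (κ * a))                          ≡⟨ solve 3 (λ c κ a → con (+ 0) :+ :- (c :* (κ :* a)) := :- κ :* (a :* c))
        refl c κ a ⟩
      - κ * (a * c) ∎)
    where
    open ≡-Reasoning
    a b c κ : ℤ
    a = det3 e v₂ v₃
    b = det3 e v₃ v₁
    c = det3 e v₁ v₂
    w : Pt
    w = f₃ ⊖ f₁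
    κ = dot w (cross g f₁)
    at : ∀ x {i j} → dot f₃ x ≡ i → dot f₁ x ≡ j → dot w x ≡ i - j
    at x refl refl = prove (f₃ ▸ f₁ ▸ x ▸ []) (dot′ (V₀ ⊖′ V₁) V₂) (dot′ V₀ V₂ :- dot′ V₁ V₂) refl
    rel : a * + 1 + (b * + 1 + c * dot f₃ v₃) ≡ + 0
    rel = trans (cong₂ (λ i j → a * i + (b * j + c * dot f₃ v₃)) (sym f₃v₁) (sym f₃v₂)) (relation v₁ v₂ v₃ f₃ f₃e)
    p₃ : dot f₃ v₃ - + 1 ≡ κ * a
    p₃ = trans (sym (at v₃ refl f₁v₃)) (level-span w f₁ v₂ v₃ f₁e f₁v₂ (at e f₃e f₁e) (at v₂ f₃v₂ f₁v₂))

  module NonZero {v₁ v₂ v₃ : Pt} (T : Triple v₁ v₂ v₃) (a≢0 : det3 e v₂ v₃ ≢ + 0) (b≢0 : det3 e v₃ v₁ ≢ + 0)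
    (c≢0 : det3 e v₁ v₂ ≢ + 0)
    (f₁ f₂ f₃ : Pt) (lev₁ : Levelled v₂ v₃ f₁) (lev₂ : Levelled v₃ v₁ f₂) (lev₃ : Levelled v₁ v₂ f₃) where
    open Triple T hiding (lev₁; lev₂; lev₃)
    private
      f₁e = proj₁ lev₁
      f₁v₂ = proj₁ (proj₂ lev₁)
      f₁v₃ = proj₂ (proj₂ lev₁)
      f₂e = proj₁ lev₂
      f₂v₃ = proj₁ (proj₂ lev₂)
      f₂v₁ = proj₂ (proj₂ lev₂)
      f₃e = proj₁ lev₃
      f₃v₁ = proj₁ (proj₂ lev₃)
      f₃v₂ = proj₂ (proj₂ lev₃)
      a b c h₁ h₂ h₃ : ℤ
      a = det3 e v₂ v₃
      b = det3 e v₃ v₁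
      c = det3 e v₁ v₂
      h₁ = dot g v₁
      h₂ = dot g v₂
      h₃ = dot g v₃
      T′ : Triple v₂ v₃ v₁
      T′ = rotate T
      T″ : Triple v₃ v₁ v₂
      T″ = rotate T′
      p₁≢1 : dot f₁ v₁ ≢ + 1
      p₁≢1 = level-third T f₁ lev₁
      p₂≢1 : dot f₂ v₂ ≢ + 1
      p₂≢1 = level-third T′ f₂ lev₂
      p₃≢1 : dot f₃ v₃ ≢ + 1
      p₃≢1 = level-third T″ f₃ lev₃
      -- A zero sum would put `v₃` at level one of `f₃`, beside `v₁` and `v₂`, and the width would
      -- be one.
      σ≢0 : a + (b + c) ≢ + 0
      σ≢0 σ≡0 = [ c≢0 , (λ eq → p₃≢1 (ℤₚ.i-j≡0⇒i≡j (dot f₃ v₃) (+ 1) eq)) ]′ (ℤₚ.i*j≡0⇒i≡0∨j≡0 c {dot f₃ v₃ - + 1} (begin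
        c * (dot f₃ v₃ - + 1) ≡⟨ solve 4 (λ a b c p → c :* (p :- con (+ 1)) := (a :* con (+ 1) :+ (b :* con (+ 1) :+ c :* p)) :-
          (a :+ (b :+ c))) refl a b c (dot f₃ v₃) ⟩
        (a * + 1 + (b * + 1 + c * dot f₃ v₃)) - (a + (b + c)) ≡⟨ cong₂ _-_
          (trans (cong₂ (λ i j → a * i + (b * j + c * dot f₃ v₃)) (sym f₃v₁) (sym f₃v₂)) (relation v₁ v₂ v₃ f₃ f₃e)) σ≡0 ⟩
        + 0 ∎))
        where open ≡-Reasoning
      cyclic-sum : ∀ x y z → y + (z + x) ≡ x + (y + z)
      cyclic-sum = solve 3 (λ x y z → y :+ (z :+ x) := x :+ (y :+ z)) refl
      products : Products∣Sum a b c
      products = product-divides v₁ v₂ v₃ f₁ f₃ lev₁ lev₃ ,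
        subst ((b * a) ∣ℤ_) (cyclic-sum a b c) (product-divides v₂ v₃ v₁ f₂ f₁ lev₂ lev₁) ,
        subst ((c * b) ∣ℤ_) (trans (cyclic-sum b c a) (cyclic-sum a b c)) (product-divides v₃ v₁ v₂ f₃ f₂ lev₃ lev₂)
      answer : EvenOrThree a b c
      answer = even-or-three a b c (2≤∣∣ a a≢0 (det-not-unit m₂ m₃)) (2≤∣∣ b b≢0 (det-not-unit m₃ m₁))
        (2≤∣∣ c c≢0 (det-not-unit m₁ m₂)) products σ≢0

      commute : ∀ {x} → + 2 ∣ℤ x → Σ ℤ λ q → x ≡ + 2 * q
      commute (divides q eq) = q , trans eq (ℤₚ.*-comm q (+ 2))

      double : ∀ {x y} k l r → x ≡ + 2 * k + r → y ≡ + 2 * l + r → x - y ≡ + 2 * (k - l)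
      double k l r refl refl = solve 3 (λ k l r → (con (+ 2) :* k :+ r) :- (con (+ 2) :* l :+ r) := con (+ 2) :* (k :- l)) refl k
        l r

      zero-rest : ∀ {x k} → x ≡ + 2 * k → x ≡ + 2 * k + + 0
      zero-rest {k = k} eq = trans eq (sym (ℤₚ.+-identityʳ (+ 2 * k)))

      -- Two of the three heights have the same parity.
      not-even : (+ 2 ∣ℤ a) × (+ 2 ∣ℤ b) × (+ 2 ∣ℤ c) → ⊥
      not-even (2∣a , 2∣b , 2∣c) = parities (mod₂ h₁) (mod₂ h₂) (mod₂ h₃)
        where
        not₂₃ : ∀ α → h₂ - h₃ ≢ + 2 * α
        not₂₃ α eq = no-division T f₁ lev₁ p₁≢1 0 α (proj₁ (commute 2∣a)) eq (proj₂ (commute 2∣a))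
        not₃₁ : ∀ α → h₃ - h₁ ≢ + 2 * α
        not₃₁ α eq = no-division T′ f₂ lev₂ p₂≢1 0 α (proj₁ (commute 2∣b)) eq (proj₂ (commute 2∣b))
        not₁₂ : ∀ α → h₁ - h₂ ≢ + 2 * α
        not₁₂ α eq = no-division T″ f₃ lev₃ p₃≢1 0 α (proj₁ (commute 2∣c)) eq (proj₂ (commute 2∣c))
        parities : Mod₂ h₁ → Mod₂ h₂ → Mod₂ h₃ → ⊥
        parities (k , inj₁ x) (l , inj₁ y) _ = not₁₂ (k - l) (double k l (+ 0) (zero-rest x) (zero-rest y))
        parities (k , inj₂ x) (l , inj₂ y) _ = not₁₂ (k - l) (double k l (+ 1) x y)
        parities (k , inj₁ x) (l , inj₂ y) (m , inj₁ z) = not₃₁ (m - k) (double m k (+ 0) (zero-rest z) (zero-rest x))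
        parities (k , inj₁ x) (l , inj₂ y) (m , inj₂ z) = not₂₃ (l - m) (double l m (+ 1) y z)
        parities (k , inj₂ x) (l , inj₁ y) (m , inj₁ z) = not₂₃ (l - m) (double l m (+ 0) (zero-rest y) (zero-rest z))
        parities (k , inj₂ x) (l , inj₁ y) (m , inj₂ z) = not₃₁ (m - k) (double m k (+ 1) z x)

      module Three (a≡b : a ≡ b) (b≡c : b ≡ c) (a-three : ∣ a ∣ ≡ 3) where
        third : Σ ℤ λ β → a ≡ + 3 * β
        third = by a a-three
          where
          by : ∀ z → ∣ z ∣ ≡ 3 → Σ ℤ λ β → z ≡ + 3 * β
          by (+ .3) refl = + 1 , refl
          by -[1+ .2 ] refl = - + 1 , refl
        β : ℤ
        β = proj₁ third
        a≡3β : a ≡ + 3 * β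
        a≡3β = proj₂ third
        not₂₃ : ∀ α → h₂ - h₃ ≢ + 3 * α
        not₂₃ α eq = no-division T f₁ lev₁ p₁≢1 1 α β eq a≡3β
        not₃₁ : ∀ α → h₃ - h₁ ≢ + 3 * α
        not₃₁ α eq = no-division T′ f₂ lev₂ p₂≢1 1 α β eq (trans (sym a≡b) a≡3β)
        not₁₂ : ∀ α → h₁ - h₂ ≢ + 3 * α
        not₁₂ α eq = no-division T″ f₃ lev₃ p₃≢1 1 α β eq (trans (sym b≡c) (trans (sym a≡b) a≡3β))

        -- With three equal determinants `relation` reads `a * p + 2 * a = 0`, where `p` is the
        -- value of a level functional at the opposite vertex.
        minus-two : ∀ x y p → x ≡ a → y ≡ a → a * p + (x + y) ≡ + 0 → p ≡ - + 2
        minus-two x y p refl refl eq = ℤₚ.i-j≡0⇒i≡j p (- + 2)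
          ([ (λ z → ⊥-elim (a≢0 z)) , (λ z → z) ]′ (ℤₚ.i*j≡0⇒i≡0∨j≡0 a {p - - + 2}
          (trans (solve 2 (λ a p → a :* (p :- con (- + 2)) := a :* p :+ (a :+ a)) refl a p) eq)))
        f₁v₁ : dot f₁ v₁ ≡ - + 2
        f₁v₁ = minus-two b c (dot f₁ v₁) (sym a≡b) (trans (sym b≡c) (sym a≡b))
          (trans (cong₂ (λ i j → a * dot f₁ v₁ + (i + j)) (sym (ℤₚ.*-identityʳ b)) (sym (ℤₚ.*-identityʳ c)))
          (trans (cong₂ (λ i j → a * dot f₁ v₁ + (b * i + c * j)) (sym f₁v₂) (sym f₁v₃)) (relation v₁ v₂ v₃ f₁ f₁e)))
        f₂v₂ : dot f₂ v₂ ≡ - + 2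
        f₂v₂ = minus-two c a (dot f₂ v₂) (trans (sym b≡c) (sym a≡b)) refl
          (trans (cong (λ k → k * dot f₂ v₂ + (c + a)) a≡b) (trans
          (cong₂ (λ i j → b * dot f₂ v₂ + (i + j)) (sym (ℤₚ.*-identityʳ c)) (sym (ℤₚ.*-identityʳ a)))
          (trans (cong₂ (λ i j → b * dot f₂ v₂ + (c * i + a * j)) (sym f₂v₃) (sym f₂v₁)) (relation v₂ v₃ v₁ f₂ f₂e))))
        f₃v₃ : dot f₃ v₃ ≡ - + 2
        f₃v₃ = minus-two a b (dot f₃ v₃) refl (sym a≡b) (trans (cong (λ k → k * dot f₃ v₃ + (a + b)) (trans a≡b b≡c))
          (trans (cong₂ (λ i j → c * dot f₃ v₃ + (i + j)) (sym (ℤₚ.*-identityʳ a)) (sym (ℤₚ.*-identityʳ b)))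
          (trans (cong₂ (λ i j → c * dot f₃ v₃ + (a * i + b * j)) (sym f₃v₁) (sym f₃v₂)) (relation v₃ v₁ v₂ f₃ f₃e))))

        total : Pt
        total = v₁ ⊕ (v₂ ⊕ v₃)
        total-level : ∀ f {i j k} → dot f v₁ ≡ i → dot f v₂ ≡ j → dot f v₃ ≡ k → dot f total ≡ i + (j + k)
        total-level f refl refl refl = trans (dot-⊕ f v₁ (v₂ ⊕ v₃)) (cong (λ k → dot f v₁ + k) (dot-⊕ f v₂ v₃))
        total-parallel : cross e total ≡ origin
        total-parallel = trans (normal f₁ e total v₂ f₁e (total-level f₁ f₁v₁ f₁v₂ f₁v₃) f₁v₂)
          (cong (λ k → scale k f₁) (trans (prove (e ▸ total ▸ v₂ ▸ []) (det3′ V₀ V₁ V₂) (:- det3′ V₀ V₂ V₁) refl)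
            (cong -_ det≡0)))
          where
          det≡0 : det3 e v₂ total ≡ + 0
          det≡0 = trans (prove (e ▸ v₁ ▸ v₂ ▸ v₃ ▸ []) (det3′ V₀ V₂ (V₁ ⊕′ (V₂ ⊕′ V₃))) (det3′ V₀ V₂ V₃ :- det3′ V₀ V₁ V₂) refl)
            (trans (cong (_- c) (trans a≡b b≡c)) (ℤₚ.+-inverseʳ c))

        -- Equal residues of the two differences make the sum of the three heights divisible by 3,
        -- so the centroid is a lattice point of the line.
        finish : ∀ k l r → h₂ - h₃ ≡ + 3 * k + r → h₃ - h₁ ≡ + 3 * l + r → (r ≡ + 1) ⊎ (r ≡ + 2) → Conclusion
        finish k l r h₂₃ h₃₁ r≡ = let (j , j≤K , c≡) = on-spine (h₃ + k - l) centre in finish₃ T {f₁} {f₂} {f₃} j j≤K (record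
            { f₁e = f₁e ; f₂e = f₂e ; f₃e = f₃e ; f₁v₁ = f₁v₁ ; f₁v₂ = f₁v₂ ; f₁v₃ = f₁v₃ ; f₂v₁ = f₂v₁ ; f₂v₂ = f₂v₂ ; f₂v₃ =
              f₂v₃ ; f₃v₁ = f₃v₁ ; f₃v₂ = f₃v₂ ; f₃v₃ = f₃v₃
            ; det = trans (cong ∣_∣ (trans (sym b≡c) (sym a≡b))) a-three ; k = - l - + 1 ; residue = residues r≡
            ; sum = trans sum (cong (λ c → scale (+ 3 * c) e) c≡) })
          where
          h₁≡ : h₁ ≡ h₃ - (+ 3 * l + r)
          h₁≡ = linear₁ {h₁} {h₃ - (+ 3 * l + r)} {h₃ - h₁} {+ 3 * l + r} (- + 1)
            (solve 4 (λ h₁ h₃ l r → h₁ :- (h₃ :- (con (+ 3) :* l :+ r)) := con (- + 1) :* ((h₃ :- h₁) :- (con (+ 3) :* l :+ r)))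
            refl h₁ h₃ l r) h₃₁
          h₂≡ : h₂ ≡ h₃ + (+ 3 * k + r)
          h₂≡ = linear₁ {h₂} {h₃ + (+ 3 * k + r)} {h₂ - h₃} {+ 3 * k + r} (+ 1)
            (solve 4 (λ h₂ h₃ k r → h₂ :- (h₃ :+ (con (+ 3) :* k :+ r)) := con (+ 1) :* ((h₂ :- h₃) :- (con (+ 3) :* k :+ r)))
            refl h₂ h₃ k r) h₂₃
          sum : total ≡ scale (+ 3 * (h₃ + k - l)) e
          sum = trans (parallel⇒multiple total total-parallel) (cong (λ k → scale k e) (trans (total-level g h₁≡ h₂≡ refl)
            (solve 4 (λ h k l r → (h :- (con (+ 3) :* l :+ r)) :+ ((h :+ (con (+ 3) :* k :+ r)) :+ h) := con (+ 3) :*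
              (h :+ k :- l)) refl h₃ k l r)))
          centre : M (scale (h₃ + k - l) e)
          centre = combine₃ {M} M-convex 1 1 1 {v₁} {v₂} {v₃} {scale (h₃ + k - l) e} m₁ m₂ m₃ (s≤s z≤n)
            (trans (proveᵥ (v₁ ▸ v₂ ▸ v₃ ▸ []) (scale′ (con (+ 1)) V₀ ⊕′ (scale′ (con (+ 1)) V₁ ⊕′ scale′ (con (+ 1)) V₂))
              (V₀ ⊕′ (V₁ ⊕′ V₂)) refl refl refl) (trans sum (sym (scale-scale (+ 3) (h₃ + k - l) e))))
          residues : (r ≡ + 1) ⊎ (r ≡ + 2) → (h₁ ≡ h₃ + (+ 3 * (- l - + 1) + + 1)) ⊎ (h₁ ≡ h₃ + (+ 3 * (- l - + 1) + + 2))
          residues (inj₁ refl) = inj₂ (trans h₁≡ (solve 2 (λ h l → h :- (con (+ 3) :* l :+ con (+ 1)) := h :+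
            (con (+ 3) :* (:- l :- con (+ 1)) :+ con (+ 2))) refl h₃ l))
          residues (inj₂ refl) = inj₁ (trans h₁≡ (solve 2 (λ h l → h :- (con (+ 3) :* l :+ con (+ 2)) := h :+
            (con (+ 3) :* (:- l :- con (+ 1)) :+ con (+ 1))) refl h₃ l))

        -- Residues 1 and 2 would make `h₁ - h₂` divisible by 3, and with the determinant also
        -- divisible by 3 there would be a lattice point between `v₁` and `v₂`.
        opposite : ∀ k l r s → h₂ - h₃ ≡ + 3 * k + r → h₃ - h₁ ≡ + 3 * l + s → r + s ≡ + 3 → ⊥
        opposite k l r s h₂₃ h₃₁ rs = not₁₂ (- (k + l + + 1)) (begin
          h₁ - h₂                                   ≡⟨ solve 3 (λ h₁ h₂ h₃ → h₁ :- h₂ := :- ((h₂ :- h₃) :+ (h₃ :- h₁))) refl h₁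
            h₂ h₃ ⟩
          - ((h₂ - h₃) + (h₃ - h₁))                 ≡⟨ cong₂ (λ x y → - (x + y)) h₂₃ h₃₁ ⟩
          - ((+ 3 * k + r) + (+ 3 * l + s))         ≡⟨ solve 4
            (λ k l r s → :- ((con (+ 3) :* k :+ r) :+ (con (+ 3) :* l :+ s)) := :- (con (+ 3) :* (k :+ l) :+ (r :+ s))) refl k l
            r s ⟩
          - (+ 3 * (k + l) + (r + s))               ≡⟨ cong (λ x → - (+ 3 * (k + l) + x)) rs ⟩
          - (+ 3 * (k + l) + + 3)                   ≡⟨ solve 2
            (λ k l → :- (con (+ 3) :* (k :+ l) :+ con (+ 3)) := con (+ 3) :* (:- (k :+ l :+ con (+ 1)))) refl k l ⟩
          + 3 * (- (k + l + + 1)) ∎)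
          where open ≡-Reasoning

        by-residues : Mod₃ (h₂ - h₃) → Mod₃ (h₃ - h₁) → Conclusion
        by-residues (k , inj₁ x) _ = ⊥-elim (not₂₃ k x)
        by-residues _ (l , inj₁ y) = ⊥-elim (not₃₁ l y)
        by-residues (k , inj₂ (inj₁ x)) (l , inj₂ (inj₁ y)) = finish k l (+ 1) x y (inj₁ refl)
        by-residues (k , inj₂ (inj₂ x)) (l , inj₂ (inj₂ y)) = finish k l (+ 2) x y (inj₂ refl)
        by-residues (k , inj₂ (inj₁ x)) (l , inj₂ (inj₂ y)) = ⊥-elim (opposite k l (+ 1) (+ 2) x y refl)
        by-residues (k , inj₂ (inj₂ x)) (l , inj₂ (inj₁ y)) = ⊥-elim (opposite k l (+ 2) (+ 1) x y refl)

    conclude : Conclusion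
    conclude = [ (λ even → ⊥-elim (not-even even)) , (λ
      { (a≡b , b≡c , three) → Three.by-residues a≡b b≡c three (mod₃ (h₂ - h₃)) (mod₃ (h₃ - h₁)) }) ]′ answer

  classify-triple : ∀ {v₁ v₂ v₃} → Triple v₁ v₂ v₃ → Conclusion
  classify-triple {v₁} {v₂} {v₃} T = by (det3 e v₂ v₃ ≟ + 0) (det3 e v₃ v₁ ≟ + 0) (det3 e v₁ v₂ ≟ + 0)
    where
    open Triple T
    by : Dec (det3 e v₂ v₃ ≡ + 0) → Dec (det3 e v₃ v₁ ≡ + 0) → Dec (det3 e v₁ v₂ ≡ + 0) → Conclusion
    by (yes d₂₃) _ _ = one-zero (rotate T) d₂₃
    by (no _) (yes d₃₁) _ = one-zero (rotate (rotate T)) d₃₁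
    by (no _) (no _) (yes d₁₂) = one-zero T d₁₂
    by (no a≢0) (no b≢0) (no c≢0) = let (f₁ , l₁) = lev₁ a≢0 ; (f₂ , l₂) = lev₂ b≢0 ; (f₃ , l₃) = lev₃ c≢0 in
      NonZero.conclude T a≢0 b≢0 c≢0 f₁ f₂ f₃ l₁ l₂ l₃

  outer-triple : ∀ u₁ u₂ u₃ → outer ≡ u₁ ∷ u₂ ∷ u₃ ∷ [] → Triple (u₁ ⊖ o) (u₂ ⊖ o) (u₃ ⊖ o)
  outer-triple u₁ u₂ u₃ outer≡ = record
      { m₁ = M-⊖ u₁ (proj₁ (outer⁻ u₁∈)) ; m₂ = M-⊖ u₂ (proj₁ (outer⁻ u₂∈)) ; m₃ = M-⊖ u₃ (proj₁ (outer⁻ u₃∈))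
      ; off₁ = proj₂ (outer⁻ u₁∈) ; off₂ = proj₂ (outer⁻ u₂∈) ; off₃ = proj₂ (outer⁻ u₃∈)
      ; ≢₁₂ = λ eq → u₁≢u₂ (cancel u₁ u₂ eq) ; ≢₂₃ = λ eq → u₂≢u₃ (cancel u₂ u₃ eq) ; ≢₃₁ = λ eq → u₁≢u₃ (sym (cancel u₃ u₁ eq))
      ; only = λ x mx → place x mx (off-or-on (o ⊕ x))
      ; lev₁ = levelled u₁ u₂ u₃ u₁∈ u₂∈ u₃∈ (λ eq → u₁≢u₂ (sym eq)) (λ eq → u₁≢u₃ (sym eq))
      ; lev₂ = levelled u₂ u₃ u₁ u₂∈ u₃∈ u₁∈ (λ eq → u₂≢u₃ (sym eq)) u₁≢u₂
      ; lev₃ = levelled u₃ u₁ u₂ u₃∈ u₁∈ u₂∈ u₁≢u₃ u₂≢u₃ }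
    where
    member : ∀ {u} → u ∈ u₁ ∷ u₂ ∷ u₃ ∷ [] → u ∈ outer
    member = subst (_ ∈_) (sym outer≡)
    u₁∈ : u₁ ∈ outer
    u₁∈ = member (here refl)
    u₂∈ : u₂ ∈ outer
    u₂∈ = member (there (here refl))
    u₃∈ : u₃ ∈ outer
    u₃∈ = member (there (there (here refl)))
    distinct : Unique (u₁ ∷ u₂ ∷ u₃ ∷ [])
    distinct = subst Unique outer≡ uniq-outer
    u₁≢u₂ : u₁ ≢ u₂
    u₁≢u₂ eq = Unique⇒∉ distinct (here eq)
    u₁≢u₃ : u₁ ≢ u₃
    u₁≢u₃ eq = Unique⇒∉ distinct (there (here eq))
    u₂≢u₃ : u₂ ≢ u₃
    u₂≢u₃ eq = Unique⇒∉ (Unique-tail distinct) (here eq)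
    cancel : ∀ x y → x ⊖ o ≡ y ⊖ o → x ≡ y
    cancel x y eq = trans (sym (⊕-⊖ o x)) (trans (cong (o ⊕_) eq) (⊕-⊖ o y))
    place : ∀ x → M x → Off (o ⊕ x) ⊎ cross e ((o ⊕ x) ⊖ o) ≡ origin → (cross e x ≡ origin) ⊎ (x ≡ u₁ ⊖ o) ⊎ (x ≡ u₂ ⊖ o) ⊎
      (x ≡ u₃ ⊖ o)
    place x mx (inj₂ eq) = inj₁ (trans (cong (cross e) (sym (relative x))) eq)
    place x mx (inj₁ off) = inj₂ (among (subst ((o ⊕ x) ∈_) outer≡ (∈-filter⁺ off? mx off)))
      where
      among : (o ⊕ x) ∈ u₁ ∷ u₂ ∷ u₃ ∷ [] → (x ≡ u₁ ⊖ o) ⊎ (x ≡ u₂ ⊖ o) ⊎ (x ≡ u₃ ⊖ o)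
      among (here eq) = inj₁ (trans (sym (relative x)) (cong (_⊖ o) eq))
      among (there (here eq)) = inj₂ (inj₁ (trans (sym (relative x)) (cong (_⊖ o) eq)))
      among (there (there (here eq))) = inj₂ (inj₂ (trans (sym (relative x)) (cong (_⊖ o) eq)))

  classify : Conclusion
  classify = let (u₁ , u₂ , u₃ , outer≡) = three-outer in classify-triple (outer-triple u₁ u₂ u₃ outer≡)

  length-frame : length L ≡ 4 ℕ.+ K
  length-frame = trans (length-split off? L) (cong₂ ℕ._+_ (let (u₁ , u₂ , u₃ , outer≡) = three-outer in cong length outer≡)
      (ℕₚ.≤-antisym (ℕₚ.≤-trans (Unique-⊆⇒≤ (Uniqueₚ.filter⁺ on? uniqL) inner⊆) (ℕₚ.≤-reflexive length-segment))
        (ℕₚ.≤-trans (ℕₚ.≤-reflexive (sym length-segment)) (Unique-⊆⇒≤ unique-segment segment⊆))))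
    where
    on? : ∀ x → Dec (¬ Off x)
    on? x = ¬? (off? x)
    segment : List Pt
    segment = map P (upTo (ℕ.suc K))
    length-segment : length segment ≡ ℕ.suc K
    length-segment = trans (length-map P (upTo (ℕ.suc K))) (length-upTo (ℕ.suc K))
    unique-segment : Unique segment
    unique-segment = Uniqueₚ.map⁺ (λ {i} {j} → P-injective i j) (Uniqueₚ.upTo⁺ (ℕ.suc K))
    inner⊆ : ∀ {x} → x ∈ filter on? L → x ∈ segment
    inner⊆ {x} x∈ = let (x∈L , ¬off) = ∈-filter⁻ on? {xs = L} x∈ in on-segment x∈L ([ (λ off → ⊥-elim (¬off off)) , (λ eq → eq) ]′ (off-or-on x))
      where
      on-segment : x ∈ L → cross e (x ⊖ o) ≡ origin → x ∈ segment
      on-segment x∈L eq = let (j , j≤K , x≡) = line x∈L eq in subst (_∈ segment) (sym x≡) (∈-map⁺ P (∈-upTo⁺ (s≤s j≤K)))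
    segment⊆ : ∀ {x} → x ∈ segment → x ∈ filter on? L
    segment⊆ x∈ = let (j , j∈ , x≡) = ∈-map⁻ P x∈ in subst (_∈ filter on? L) (sym x≡) (∈-filter⁺ on? (on j (ℕ.s≤s⁻¹ (∈-upTo⁻ j∈))) (λ off → off (P-on j)))

-- Lattice points of a polytope

module _ {L : List Pt} (convex : Convex (_∈ L)) where

  -- The ends are the points of `L` on the line with least and greatest height `g`. The heights of
  -- `x` and `y` already differ by a positive multiple of 3, so the length is at least three;
  -- convexity fills the segment.
  make-frame : ∀ x y → x ∈ L → y ∈ L → x ≢ y → Congruent₃ x y → Frame L
  make-frame x y x∈ y∈ x≢y (z , x≡) =
    let (k , e , g , z≡ , ge) = primitive-part z (λ z≡0 → x≢y (trans x≡ (trans (cong (λ w → y ⊕ scale (+ 3) w) z≡0) (trans (cong (y ⊕_) (scale-origin (+ 3))) (⊕-identityʳ y)))))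
    in along-direction k e g z≡ ge
    where
    along-direction : ∀ k e g → z ≡ scale (+ ℕ.suc k) e → dot g e ≡ + 1 → Frame L
    along-direction k e g z≡ ge =
      let (o , o∈ , min) = maximum (λ w → - dot g w) collinear y∈collinear
          (b , b∈ , max) = maximum (dot g) collinear y∈collinear
      in between o o∈ (λ {w} w∈ → ℤₚ.neg-cancel-≤ {dot g w} {dot g o} (min w∈)) b b∈ max
      where
      on? : ∀ w → Dec (cross e (w ⊖ y) ≡ origin)
      on? w = cross e (w ⊖ y) ≟ₚ origin
      collinear : List Pt
      collinear = filter on? L
      y∈collinear : y ∈ collinear
      y∈collinear = ∈-filter⁺ on? y∈ (proveᵥ (e ▸ y ▸ []) (cross′ V₀ (V₁ ⊖′ V₁)) origin′ refl refl refl)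
      x≡′ : x ≡ y ⊕ scale (+ 3) (scale (+ ℕ.suc k) e)
      x≡′ = trans x≡ (cong (λ w → y ⊕ scale (+ 3) w) z≡)
      x∈collinear : x ∈ collinear
      x∈collinear = ∈-filter⁺ on? x∈ (trans (cong (λ w → cross e (w ⊖ y)) x≡′)
        (proveᵥ (e ▸ y ▸ + ℕ.suc k ∷ []) (cross′ V₀ ((V₁ ⊕′ scale′ (con (+ 3)) (scale′ (ν 6) V₀)) ⊖′ V₁)) origin′ refl refl refl))
      gx : dot g x ≡ dot g y + + (3 ℕ.* ℕ.suc k)
      gx = trans (cong (dot g) x≡′) (trans (dot-⊕ g y (scale (+ 3) (scale (+ ℕ.suc k) e))) (cong (λ m → dot g y + m)
        (trans (dot-scale g (+ 3) (scale (+ ℕ.suc k) e)) (trans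
          (cong (+ 3 *_) (trans (dot-scale g (+ ℕ.suc k) e) (trans (cong (+ ℕ.suc k *_) ge) (ℤₚ.*-identityʳ (+ ℕ.suc k)))))
          (sym (ℤₚ.pos-* 3 (ℕ.suc k)))))))

      between : ∀ o → o ∈ collinear → (∀ {w} → w ∈ collinear → dot g o ℤ.≤ dot g w) → ∀ b → b ∈ collinear →
        (∀ {w} → w ∈ collinear → dot g w ℤ.≤ dot g b) → Frame L
      between o o∈ min b b∈ max = record { o = o ; e = e ; g = g ; K = K ; ge = ge ; long = long ; on = on ; line = line }
        where
        o-on : cross e (o ⊖ y) ≡ origin
        o-on = proj₂ (∈-filter⁻ on? {xs = L} o∈)
        K : ℕ
        K = proj₁ (≤-witness (min b∈))
        gb : dot g b ≡ dot g o + + K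
        gb = proj₂ (≤-witness (min b∈))
        position : ∀ w j → cross e (w ⊖ o) ≡ origin → dot g w ≡ dot g o + + j → w ≡ o ⊕ scale (+ j) e
        position w j eq gw = trans (sym (⊕-⊖ o w)) (cong (o ⊕_)
          (trans (along g e (w ⊖ o) ge) (trans (cong₂ (λ m v → scale m e ⊕ cross g v)
            (trans (dot-⊖ g w o) (trans (cong (_- dot g o) gw) (solve 2 (λ x j → x :+ j :- x := j) refl (dot g o) (+ j))))
            (trans (proveᵥ (e ▸ w ⊖ o ▸ []) (cross′ V₁ V₀) (scale′ (con (- + 1)) (cross′ V₀ V₁)) refl refl refl)
              (cong (scale (- + 1)) eq)))
          (proveᵥ (scale (+ j) e ▸ g ▸ []) (V₀ ⊕′ cross′ V₁ (scale′ (con (- + 1)) origin′)) V₀ refl refl refl))))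
        to-o : ∀ w → cross e (w ⊖ y) ≡ origin → cross e (w ⊖ o) ≡ origin
        to-o w eq = trans (proveᵥ (e ▸ w ▸ y ▸ o ▸ []) (cross′ V₀ (V₁ ⊖′ V₃)) (cross′ V₀ (V₁ ⊖′ V₂) ⊖′ cross′ V₀ (V₃ ⊖′ V₂)) refl
          refl refl) (cong₂ _⊖_ eq o-on)
        from-o : ∀ w → cross e (w ⊖ o) ≡ origin → cross e (w ⊖ y) ≡ origin
        from-o w eq = trans (proveᵥ (e ▸ w ▸ y ▸ o ▸ []) (cross′ V₀ (V₁ ⊖′ V₂)) (cross′ V₀ (V₁ ⊖′ V₃) ⊕′ cross′ V₀ (V₃ ⊖′ V₂))
          refl refl refl) (cong₂ _⊕_ eq o-on)
        bounded : ∀ {w} → w ∈ collinear → ∀ j → dot g w ≡ dot g o + + j → j ℕ.≤ K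
        bounded w∈ j gw = ℤₚ.drop‿+≤+ (subst₂ ℤ._≤_ (cancel (+ j)) (cancel (+ K))
          (ℤₚ.+-monoʳ-≤ (- dot g o) (subst₂ ℤ._≤_ gw gb (max w∈))))
          where
          cancel : ∀ i → - dot g o + (dot g o + i) ≡ i
          cancel = solve 2 (λ x i → :- x :+ (x :+ i) := i) refl (dot g o)
        line : ∀ {w} → w ∈ L → cross e (w ⊖ o) ≡ origin → Σ ℕ λ j → j ℕ.≤ K × w ≡ o ⊕ scale (+ j) e
        line {w} w∈ eq =
          let w∈c = ∈-filter⁺ on? w∈ (from-o w eq)
              (j , gw) = ≤-witness (min w∈c)
          in j , bounded w∈c j gw , position w j eq gw
        long : 3 ℕ.≤ K
        long = let (i , gy) = ≤-witness (min y∈collinear) in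
          ℕₚ.≤-trans (ℕₚ.≤-trans (ℕₚ.≤-trans (ℕₚ.≤-reflexive (sym (ℕₚ.*-identityʳ 3))) (ℕₚ.*-monoʳ-≤ 3 (s≤s (z≤n {k}))))
            (ℕₚ.m≤n+m (3 ℕ.* ℕ.suc k) i))
            (bounded x∈collinear (i ℕ.+ 3 ℕ.* ℕ.suc k) (trans gx
              (trans (cong (_+ + (3 ℕ.* ℕ.suc k)) gy) (ℤₚ.+-assoc (dot g o) (+ i) (+ (3 ℕ.* ℕ.suc k))))))
        b≡ : b ≡ o ⊕ scale (+ K) e
        b≡ = position b K (to-o b (proj₂ (∈-filter⁻ on? {xs = L} b∈))) gb
        on : ∀ j → j ℕ.≤ K → (o ⊕ scale (+ j) e) ∈ L
        on j j≤K = combine₂ {_∈ L} convex j (K ℕ.∸ j) {b} {o} {o ⊕ scale (+ j) e} (proj₁ (∈-filter⁻ on? {xs = L} b∈))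
          (proj₁ (∈-filter⁻ on? {xs = L} o∈))
          (subst (0 ℕ.<_) (sym (ℕₚ.m+[n∸m]≡n j≤K)) (ℕₚ.≤-trans (s≤s z≤n) long))
          (trans (cong (λ w → scale (+ j) w ⊕ scale (+ (K ℕ.∸ j)) o)
            (trans b≡ (cong (λ m → o ⊕ scale (+ m) e) (sym (ℕₚ.m+[n∸m]≡n j≤K)))))
            (proveᵥ (o ▸ e ▸ + j ∷ + (K ℕ.∸ j) ∷ []) (scale′ (ν 6) (V₀ ⊕′ scale′ (ν 6 :+ ν 7) V₁) ⊕′ scale′ (ν 7) V₀)
              (scale′ (ν 6 :+ ν 7) (V₀ ⊕′ scale′ (ν 6) V₁)) refl refl refl))

congruent₃? : ∀ x y → Dec (Congruent₃ x y)
congruent₃? x y = decide (+ 3 ∣ℤ? proj₁ d) (+ 3 ∣ℤ? proj₁ (proj₂ d)) (+ 3 ∣ℤ? proj₂ (proj₂ d))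
  where
  d : Pt
  d = x ⊖ y
  multiple : ∀ z → x ≡ y ⊕ scale (+ 3) z → d ≡ scale (+ 3) z
  multiple z eq = trans (cong (_⊖ y) eq) (proveᵥ (y ▸ scale (+ 3) z ▸ []) ((V₀ ⊕′ V₁) ⊖′ V₀) V₁ refl refl refl)
  decide : Dec (+ 3 ∣ℤ proj₁ d) → Dec (+ 3 ∣ℤ proj₁ (proj₂ d)) → Dec (+ 3 ∣ℤ proj₂ (proj₂ d)) → Dec (Congruent₃ x y)
  decide (yes (divides a a≡)) (yes (divides b b≡)) (yes (divides c c≡)) = yes ((a , b , c) , trans (sym (⊕-⊖ y x)) (cong (y ⊕_)
    (pt≡ (trans a≡ (ℤₚ.*-comm a (+ 3))) (trans b≡ (ℤₚ.*-comm b (+ 3))) (trans c≡ (ℤₚ.*-comm c (+ 3))))))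
  decide (no ¬a) _ _ = no λ { (z , eq) → ¬a (divides (proj₁ z) (trans (cong proj₁ (multiple z eq)) (ℤₚ.*-comm (+ 3) (proj₁ z)))) }
  decide _ (no ¬b) _ = no λ { (z , eq) → ¬b (divides (proj₁ (proj₂ z))
    (trans (cong (λ w → proj₁ (proj₂ w)) (multiple z eq)) (ℤₚ.*-comm (+ 3) (proj₁ (proj₂ z))))) }
  decide _ _ (no ¬c) = no λ { (z , eq) → ¬c (divides (proj₂ (proj₂ z))
    (trans (cong (λ w → proj₂ (proj₂ w)) (multiple z eq)) (ℤₚ.*-comm (+ 3) (proj₂ (proj₂ z))))) }

module _ {P : Pt → Pt → Set} (P? : ∀ x y → Dec (P x y)) where
  search₂ : ∀ xs → (Σ Pt λ x → Σ Pt λ y → x ∈ xs × y ∈ xs × P x y) ⊎ (∀ {x y} → x ∈ xs → y ∈ xs → ¬ P x y)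
  search₂ xs with any? (λ x → any? (P? x) xs) xs
  ... | yes some = let (x , x∈ , some-y) = find some ; (y , y∈ , p) = find some-y in inj₁ (x , y , x∈ , y∈ , p)
  ... | no none = inj₂ λ x∈ y∈ p → none (lose x∈ (lose y∈ p))

module _ {P : Pt → Pt → Pt → Pt → Set} (P? : ∀ p q r s → Dec (P p q r s)) where
  search₄ : ∀ xs → (Σ Pt λ p → Σ Pt λ q → Σ Pt λ r → Σ Pt λ s → p ∈ xs × q ∈ xs × r ∈ xs × s ∈ xs × P p q r s) ⊎
    (∀ p q r s → p ∈ xs → q ∈ xs → r ∈ xs → s ∈ xs → ¬ P p q r s)
  search₄ xs with any? (λ p → any? (λ q → any? (λ r → any? (P? p q r) xs) xs) xs) xs
  ... | yes some = let (p , p∈ , some-q) = find some ; (q , q∈ , some-r) = find some-q ; (r , r∈ , some-s) = find some-r ; (s , s∈ , holds) = find some-s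
    in inj₁ (p , q , r , s , p∈ , q∈ , r∈ , s∈ , holds)
  ... | no none = inj₂ λ p q r s p∈ q∈ r∈ s∈ holds → none (lose p∈ (lose q∈ (lose r∈ (lose s∈ holds))))

dim3⇒spatial : ∀ {L p q r s} → p ∈ L → q ∈ L → r ∈ L → s ∈ L → det3 (q ⊖ p) (r ⊖ p) (s ⊖ p) ≢ + 0 → Spatial L
dim3⇒spatial {L} {p} {q} {r} {s} p∈ q∈ r∈ s∈ d≢0 n n≢0 t = by (dot n p ≟ t) (dot n q ≟ t) (dot n r ≟ t) (dot n s ≟ t)
  where
  by : Dec (dot n p ≡ t) → Dec (dot n q ≡ t) → Dec (dot n r ≡ t) → Dec (dot n s ≡ t) → Σ Pt λ x → x ∈ L × dot n x ≢ t
  by (no np) _ _ _ = p , p∈ , np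
  by _ (no nq) _ _ = q , q∈ , nq
  by _ _ (no nr) _ = r , r∈ , nr
  by _ _ _ (no ns) = s , s∈ , ns
  by (yes np) (yes nq) (yes nr) (yes ns) = ⊥-elim (d≢0 (coplanar (q ⊖ p) (r ⊖ p) (s ⊖ p) n n≢0
    (dot≡⇒⊖ n q p (trans nq (sym np))) (dot≡⇒⊖ n r p (trans nr (sym np))) (dot≡⇒⊖ n s p (trans ns (sym np)))))

module _ {A : PtSet} {L : List Pt} (to : ∀ {x} → InConv A x → x ∈ L) (from : ∀ {x} → x ∈ L → InConv A x) where

  hull-convex : Convex (_∈ L)
  hull-convex x (ws , ws∈ , pos , eq) = to (InConv-convex {A} x (ws , All.map from ws∈ , pos , eq))

  hull-wide : WidthGt1 A → Wide L
  hull-wide width a a≢0 flat = let (x , y , x∈ , y∈ , gt) = width a a≢0 in ℤₚ.<⇒≱ gt (flat (to x∈) (to y∈))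

  private
    removed : ∀ {u x} → x ∈ L ∖ u → InConv (Del A u) x
    removed {u} x∈ = let (x∈L , x≢u) = ∈-∖⁻ L x∈ in InConv-single {Del A u} (from x∈L , x≢u)

    removed₂ : ∀ {u v x} → x ∈ L ∖ u ∖ v → InConv (Del (Del A u) v) x
    removed₂ {u} {v} x∈ = let (x∈₁ , x≢v) = ∈-∖⁻ (L ∖ u) x∈ in InConv-single {Del (Del A u) v} (removed x∈₁ , x≢v)

    width : ∀ u → Wide (L ∖ u) → WidthGt1 (Del A u)
    width u wide a a≢0 = [ (λ { (x , y , x∈ , y∈ , gt) → x , y , removed x∈ , removed y∈ , gt }) ,
        (λ none → ⊥-elim (wide a a≢0 λ x∈ y∈ → ℤₚ.≮⇒≥ (none x∈ y∈))) ]′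
      (search₂ (λ x y → + 1 ℤₚ.<? dot a x - dot a y) (L ∖ u))

    vertex : ∀ {u} → Vertex L u → IsVertex A u
    vertex (u∈ , c , strict) = from u∈ , c , λ x x∈ x≢u → strict (to x∈) x≢u

  -- A finite search either finds four listed points with nonzero determinant or shows that all
  -- determinants vanish. Remaining listed points generate the hull after a deletion, so wide and
  -- three-dimensional remainders of the list transfer to the polytopes directly.
  hull-unmerged : WidthGt1 A → ¬ Merged A → Unmerged L
  hull-unmerged widthA not-merged {u} {v} vu vv u≢v wideᵤ wideᵥ not-planar =
    [ (λ { (p , q , r , s , p∈ , q∈ , r∈ , s∈ , d≢0) → not-merged
      (widthA , u , v , vertex vu , vertex vv , u≢v , width u wideᵤ , width v wideᵥ ,
          p , q , r , s , removed₂ p∈ , removed₂ q∈ , removed₂ r∈ , removed₂ s∈ , d≢0) }) ,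
      (λ none → not-planar λ {p} {q} {r} {s} p∈ q∈ r∈ s∈ → stable (det3 (q ⊖ p) (r ⊖ p) (s ⊖ p)) (none p q r s p∈ q∈ r∈ s∈)) ]′
    (search₄ (λ p q r s → ¬? (det3 (q ⊖ p) (r ⊖ p) (s ⊖ p) ≟ + 0)) (L ∖ u ∖ v))
    where
    stable : ∀ d → ¬ (d ≢ + 0) → d ≡ + 0
    stable d ¬¬d with d ≟ + 0
    ... | yes d≡0 = d≡0
    ... | no d≢0 = ⊥-elim (¬¬d d≢0)

  without-unimodular : Unique L → UnimodularFree (_∈ L) → Spatial L → Wide L → Unmerged L → 8 ℕ.≤ length L →
    (SublatticeIndex A 2 × UnimodEquiv A (_∈ T2 (length L))) ⊎ (SublatticeIndex A 3 × UnimodEquiv A (_∈ T3 (length L)))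
  without-unimodular uniqL free spatial wide unmerged eight =
    [ (λ { (x , y , x∈ , y∈ , x≢y , cong₃) → framed (make-frame hull-convex x y x∈ y∈ x≢y cong₃) }) ,
      (λ none → ⊥-elim (no-short-lines (λ {x} {y} x∈ y∈ cong₃ → equal x y (λ x≢y → none x∈ y∈ (x≢y , cong₃))) uniqL hull-convex
        free eight spatial unmerged)) ]′
    (search₂ (λ x y → ¬? (x ≟ₚ y) ×-dec congruent₃? x y) L)
    where
    equal : ∀ x y → ¬ (x ≢ y) → x ≡ y
    equal x y ¬¬eq with x ≟ₚ y
    ... | yes eq = eq
    ... | no ne = ⊥-elim (¬¬eq ne)
    framed : Frame L → (SublatticeIndex A 2 × UnimodEquiv A (_∈ T2 (length L))) ⊎
      (SublatticeIndex A 3 × UnimodEquiv A (_∈ T3 (length L)))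
    framed F = [ (λ { (index , equiv) → inj₁ (index , subst (λ z → UnimodEquiv A (_∈ tetrahedron₂ z)) top equiv) }) ,
        (λ { (index , equiv) → inj₂ (index , subst (λ z → UnimodEquiv A (_∈ tetrahedron₃ z)) top equiv) }) ]′ classify
      where
      open Classification {A} to from F hull-convex free spatial wide unmerged uniqL
      open Frame F using (K)
      top : + K ≡ + length L - + 4
      top = trans (solve 1 (λ k → k := con (+ 4) :+ k :- con (+ 4)) refl (+ K)) (cong (λ n → + n - + 4) (sym length-frame))

theorem5p2 : (V : List Pt) (n : ℕ) →
    Dim3 (_∈ V) → WidthGt1 (_∈ V) → Size (_∈ V) n → 8 ≤ n → ¬ Merged (_∈ V) →
    ContainsUnimodTet (_∈ V)
    ⊎ (SublatticeIndex (_∈ V) 2 × UnimodEquiv (_∈ V) (_∈ T2 n))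
    ⊎ (SublatticeIndex (_∈ V) 3 × UnimodEquiv (_∈ V) (_∈ T3 n))
theorem5p2 V n (p , q , r , s , p∈ , q∈ , r∈ , s∈ , d≢0) width (L , uniqL , members , refl) eight not-merged =
  [ (λ { (p , q , r , s , p∈ , q∈ , r∈ , s∈ , unit) → inj₁ (p , q , r , s , from p∈ , from q∈ , from r∈ , from s∈ , unit) }) ,
    (λ free → inj₂ (without-unimodular {_∈ V} to from uniqL free (dim3⇒spatial (to p∈) (to q∈) (to r∈) (to s∈) d≢0)
      (hull-wide {_∈ V} to from width) (hull-unmerged {_∈ V} to from width not-merged) eight)) ]′
  (search₄ (λ p q r s → ∣ det3 (q ⊖ p) (r ⊖ p) (s ⊖ p) ∣ ℕ.≟ 1) L)
  where
  to : ∀ {x} → InConv (_∈ V) x → x ∈ L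
  to {x} = proj₂ (members x)
  from : ∀ {x} → x ∈ L → InConv (_∈ V) x
  from {x} = proj₁ (members x)
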